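{- Let $G$ be a finite simple graph. If $G$ is not the disjoint union of at least one cycle with at most one path, then \[p_{2,\mathrm{top}}(G) = \max\left\{\frac{v_{\mathrm{odd}}(G)}{2}, \left\lceil \frac{\Delta(G)}{2}\right \rceil\right\}.\]
   Context: All graphs are finite and simple. A path odd-cover of a graph $G=(V,E)$ is a collection of paths in the complete graph on $V$ (i.e. paths whose vertex sets are contained in $V$) whose edge sets have symmetric difference equal to $E$; $p_2(G)$ is the minimum cardinality of a path odd-cover of $G$. A subdivision of $G$ is a graph obtained by repeatedly replacing edges by paths with new internal vertices. $p_{2,\mathrm{top}}(G)$ is the minimum of $p_2(H)$ over all subdivisions $H$ of $G$ (including $G$ itself). $\Delta(G)$ is the maximum degree of $G$ and $v_{\mathrm{odd}}(G)$ is the number of vertices of odd degree in $G$.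
   Formalization: The excluded graphs also include disjoint unions of at least one cycle and at most one path together with any number of isolated vertices; for these the formula fails (a triangle plus two isolated vertices gives 1, but one path cannot cover a cycle). -}

module Defs where

open import Data.Nat using (ℕ; zero; suc; _+_; _≤_; _⊔_; ⌊_/2⌋; ⌈_/2⌉)
open import Data.Nat.Properties using ()
open import Data.Bool using (Bool; true; false; _∧_; _∨_; _xor_; not; if_then_else_)
open import Data.Fin using (Fin; zero; suc; _≟_)
open import Data.List using (List; []; _∷_; _++_; length; map; foldr; allFin; concat; [_])
open import Data.Nat.ListAction using (sum)
open import Data.List.Relation.Unary.All using (All)
open import Data.List.Relation.Unary.Unique.Propositional using (Unique)

open import Data.Product using (Σ; _×_; _,_)
open import Relation.Nullary using (does)
open import Relation.Binary.PropositionalEquality using (_≡_)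

record Graph : Set where
  field
    size : ℕ
    adj  : Fin size → Fin size → Bool
open Graph public

IsSimple : Graph → Set
IsSimple G = (∀ u v → adj G u v ≡ adj G v u) × (∀ u → adj G u u ≡ false)

_==_ : ∀ {n} → Fin n → Fin n → Bool
x == y = does (x ≟ y)

b2n : Bool → ℕ
b2n true  = 1
b2n false = 0

deg : (G : Graph) → Fin (size G) → ℕ
deg G v = sum (map (λ u → b2n (adj G v u)) (allFin (size G)))

Δ : Graph → ℕ
Δ G = foldr _⊔_ 0 (map (deg G) (allFin (size G)))

isOddB : ℕ → Bool
isOddB zero          = false
isOddB (suc zero)    = true
isOddB (suc (suc n)) = isOddB n

vodd : Graph → ℕ
vodd G = sum (map (λ v → b2n (isOddB (deg G v))) (allFin (size G)))

edgeIn : ∀ {n} → List (Fin n) → Fin n → Fin n → Bool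
edgeIn []           u v = false
edgeIn (x ∷ [])     u v = false
edgeIn (x ∷ y ∷ xs) u v =
  ((x == u) ∧ (y == v)) ∨ ((x == v) ∧ (y == u)) ∨ edgeIn (y ∷ xs) u v

-- a path in the complete graph on Fin n: nonempty list of distinct vertices
IsPath : ∀ {n} → List (Fin n) → Set
IsPath []       = Data.Empty.⊥ where import Data.Empty
IsPath (x ∷ xs) = Unique (x ∷ xs)

xorEdges : ∀ {n} → List (List (Fin n)) → Fin n → Fin n → Bool
xorEdges Ps u v = foldr (λ P b → edgeIn P u v xor b) false Ps

HasOddCover : Graph → ℕ → Set
HasOddCover G k =
  Σ (List (List (Fin (size G)))) λ Ps →
    All IsPath Ps × length Ps ≡ k × (∀ u v → adj G u v ≡ xorEdges Ps u v)

-- subdivisions: generated by repeatedly subdividing a single edge uv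
-- (new vertex is `zero`, old vertex i becomes `suc i`)

subdivide : (H : Graph) → Fin (size H) → Fin (size H) → Graph
subdivide H u v = record { size = suc (size H) ; adj = a }
  where
  a : Fin (suc (size H)) → Fin (suc (size H)) → Bool
  a zero    zero    = false
  a zero    (suc j) = (j == u) ∨ (j == v)
  a (suc i) zero    = (i == u) ∨ (i == v)
  a (suc i) (suc j) =
    adj H i j ∧ not (((i == u) ∧ (j == v)) ∨ ((i == v) ∧ (j == u)))

data Subdivision (G : Graph) : Graph → Set where
  base : Subdivision G G
  step : ∀ {H} → Subdivision G H → (u v : Fin (size H)) →
         adj H u v ≡ true → Subdivision G (subdivide H u v)

P2TopIs : Graph → ℕ → Set
P2TopIs G k =
  (Σ Graph λ H → Subdivision G H × HasOddCover H k) ×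
  (∀ H m → Subdivision G H → HasOddCover H m → k ≤ m)

-- G is a disjoint union of at least one cycle with at most one path
-- (isolated vertices allowed; a "path" with 0 or 1 vertices has no edges)

cycleEdge : ∀ {n} → List (Fin n) → Fin n → Fin n → Bool
cycleEdge []       u v = false
cycleEdge (x ∷ xs) u v = edgeIn ((x ∷ xs) ++ [ x ]) u v

IsCycle : ∀ {n} → List (Fin n) → Set
IsCycle C = Unique C × 3 ≤ length C

CyclesPlusPath : Graph → Set
CyclesPlusPath G =
  Σ (List (List (Fin (size G)))) λ Cs → Σ (List (Fin (size G))) λ P →
    1 ≤ length Cs × All IsCycle Cs × Unique (concat Cs ++ P) ×
    (∀ u v → adj G u v ≡ (foldr (λ C b → cycleEdge C u v ∨ b) false Cs ∨ edgeIn P u v))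

{-# OPTIONS --safe #-}
module Submission where

-- Lower bound: subdividing keeps old degrees and only adds vertices of degree two, and a path has
-- degree at most two everywhere and at most two vertices of odd degree.
--
-- Upper bound for k ≥ 2: subdivide until there are vertices of degree two that can be used, twice
-- each, as the missing ones among the 2k path ends.  Choose k paths through the vertices such that
-- every vertex has the right number of incident path edges; the paths then cover a subdivision of
-- some multigraph with the degrees of G.  It is turned into a subdivision of G by switchings: if ab
-- is an edge of one path and cd of another, reroute them as a x y b and c x y d with new vertices
-- x, y.  The edge xy cancels, and the connections a–b, c–d become a–c, b–d (or a–d, b–c).  A
-- connection produced by a switching contains edges of two different paths, so that any two of them
-- can be switched again.
--
-- For k = 1 the maximum degree is at most two, hence every component is a path or a cycle.

open import Defs
open import Algebra.Bundles using (CommutativeRing)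
open import Data.Bool using (Bool; true; false; _∧_; _∨_; _xor_; not; if_then_else_)
open import Data.Bool.Properties
  using (∨-assoc; ∨-comm; ∨-identityʳ; ∨-zeroʳ; ∧-comm; xor-assoc; xor-comm; xor-same; xor-identityʳ; xor-∧-commutativeRing)
  renaming (_≟_ to _≟ᵇ_)
open import Data.Bool.Solver using (module xor-∧-Solver)
open import Data.Empty using (⊥; ⊥-elim)
open import Data.Fin using (Fin; zero; suc; toℕ)
import Data.Fin as F
import Data.Fin.Properties as FP
open import Data.List
  using (List; []; _∷_; _++_; _ʳ++_; [_]; length; map; foldr; concat; reverse; lookup; tabulate; allFin)
open import Data.List.Membership.DecPropositional using (_∈?_)
open import Data.List.Membership.Propositional using (_∈_; _∉_)
open import Data.List.Membership.Propositional.Properties using (∈-++⁺ˡ; ∈-++⁺ʳ; ∈-++⁻; ∈-lookup)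
open import Data.List.Properties
  using (map-tabulate; length-tabulate; length-map; length-++; ++-assoc; ++-identityʳ; reverse-involutive)
open import Data.List.Relation.Binary.Permutation.Propositional using (_↭_; ↭-sym; ↭-trans; ↭-refl; ↭-prep; ↭-swap)
open import Data.List.Relation.Binary.Permutation.Propositional.Properties as Perm
  using (All-resp-↭; ∈-resp-↭; ↭-reverse; shift)
open import Data.List.Relation.Unary.All as All using (All; []; _∷_)
import Data.List.Relation.Unary.All.Properties as AllP
open import Data.List.Relation.Unary.AllPairs using ([]; _∷_)
open import Data.List.Relation.Unary.Any using (here; there)
open import Data.List.Relation.Unary.Linked using (Linked; [-]; _∷_)
open import Data.List.Relation.Unary.Unique.Propositional using (Unique)
import Data.List.Relation.Unary.Unique.Propositional.Properties as UniqueP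
open import Data.Nat
open import Data.Nat.ListAction.Properties using (sum-↭)
import Data.Nat.ListAction as LA
open import Data.Nat.Properties
open import Data.Nat.Solver using (module +-*-Solver)
open import Data.Product using (Σ; _×_; _,_; proj₁; proj₂)
open import Data.Sum using (_⊎_; inj₁; inj₂; [_,_]′)
open import Function using (_∘_; id)
open import Relation.Binary using (DecidableEquality; tri<; tri≈; tri>)
open import Relation.Binary.PropositionalEquality hiding ([_])
open import Relation.Nullary using (¬_; yes; no; does; ¬?; _×-dec_)
open import Relation.Nullary.Decidable using (dec-true; dec-false)

open import Algebra.Properties.CommutativeMonoid.Sum +-0-commutativeMonoid
  using (∑-comm; ∑-distrib-+) renaming (sum to ∑)
open import Algebra.Properties.CommutativeMonoid.Sum
  (CommutativeRing.+-commutativeMonoid xor-∧-commutativeRing)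
  using () renaming (sum to ⨁; ∑-distrib-+ to ⨁-distrib-xor)

-- With k paths, a vertex of degree d is made an end of one path if d is odd and of none otherwise,
-- and an inner vertex of ⌊d/2⌋ further paths. These ⌈d/2⌉ paths must be different, which is the
-- condition on Δ; the 2k ends must accommodate the odd vertices, which is the other one. A vertex
-- created by subdivision takes two ends, of two different paths: this needs k ≥ 2, and so do the
-- switchings, which act on edges of two paths.
--
-- On every path a new vertex is put between consecutive vertices of the graph. Parallel connections
-- therefore do not cancel, and loops and parallel connections may come and go during the
-- switchings; only the final list of connections has to be the edge list of G.
--
-- The obstacle to a switching is that both connections lie on one path, as connections do at the
-- outset. One switching between two paths gives a connection with edges of both, and switching it
-- with each of the others in turn makes all connections of this kind.

private variable
  n m k : ℕ
  A B : Set

-- Finite sums, indicators and parity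

∑-cong : {f g : Fin n → ℕ} → (∀ i → f i ≡ g i) → ∑ f ≡ ∑ g
∑-cong {zero} h = refl
∑-cong {suc n} h = cong₂ _+_ (h zero) (∑-cong (h ∘ suc))

⨁-cong : {f g : Fin n → Bool} → (∀ i → f i ≡ g i) → ⨁ f ≡ ⨁ g
⨁-cong {zero} h = refl
⨁-cong {suc n} h = cong₂ _xor_ (h zero) (⨁-cong (h ∘ suc))

sum-allFin : (f : Fin n → ℕ) → LA.sum (map f (allFin n)) ≡ ∑ f
sum-allFin f = trans (cong LA.sum (map-tabulate id f)) (go f)
  where
  go : ∀ {n} (f : Fin n → ℕ) → LA.sum (tabulate f) ≡ ∑ f
  go {zero} f = refl
  go {suc n} f = cong (f zero +_) (go (f ∘ suc))

∑-zero : {f : Fin n → ℕ} → (∀ i → f i ≡ 0) → ∑ f ≡ 0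
∑-zero {zero} h = refl
∑-zero {suc n} h = cong₂ _+_ (h zero) (∑-zero (h ∘ suc))

⨁-false : ∀ k → ⨁ {k} (λ _ → false) ≡ false
⨁-false zero = refl
⨁-false (suc k) = ⨁-false k

∑-one : ∀ k → ∑ {k} (λ _ → 1) ≡ k
∑-one zero = refl
∑-one (suc k) = cong suc (∑-one k)

∑-mono-≤ : {f g : Fin n → ℕ} → (∀ i → f i ≤ g i) → ∑ f ≤ ∑ g
∑-mono-≤ {zero} h = z≤n
∑-mono-≤ {suc n} h = +-mono-≤ (h zero) (∑-mono-≤ (h ∘ suc))

term≤∑ : (f : Fin n → ℕ) (i : Fin n) → f i ≤ ∑ f
term≤∑ f zero = m≤m+n _ _
term≤∑ f (suc i) = ≤-trans (term≤∑ (f ∘ suc) i) (m≤n+m _ _)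

two-terms≤∑ : (f : Fin n → ℕ) {i j : Fin n} → i ≢ j → f i + f j ≤ ∑ f
two-terms≤∑ f {zero} {zero} h = ⊥-elim (h refl)
two-terms≤∑ f {zero} {suc j} h = +-monoʳ-≤ (f zero) (term≤∑ (f ∘ suc) j)
two-terms≤∑ f {suc i} {zero} h = ≤-trans (≤-reflexive (+-comm (f (suc i)) (f zero)))
  (+-monoʳ-≤ (f zero) (term≤∑ (f ∘ suc) i))
two-terms≤∑ f {suc i} {suc j} h =
  ≤-trans (two-terms≤∑ (f ∘ suc) (h ∘ cong suc)) (m≤n+m _ _)

∑-positive : (f : Fin n → ℕ) → 1 ≤ ∑ f → Σ (Fin n) λ i → 1 ≤ f i
∑-positive {suc n} f h with f zero in eq
... | suc _ = zero , subst (1 ≤_) (sym eq) (s≤s z≤n)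
... | zero with ∑-positive (f ∘ suc) h
...   | i , p = suc i , p

b2n≤1 : ∀ b → b2n b ≤ 1
b2n≤1 true = s≤s z≤n
b2n≤1 false = z≤n

==-refl : (i : Fin n) → (i == i) ≡ true
==-refl i = dec-true (i F.≟ i) refl

==-≢ : {i j : Fin n} → i ≢ j → (i == j) ≡ false
==-≢ {i = i} {j} h = dec-false (i F.≟ j) h

==-sound : {i j : Fin n} → (i == j) ≡ true → i ≡ j
==-sound {i = i} {j} h with i F.≟ j
... | yes p = p

==-sym : (i j : Fin n) → (i == j) ≡ (j == i)
==-sym i j with i F.≟ j
... | yes refl = sym (==-refl i)
... | no h = sym (==-≢ (h ∘ sym))

==-suc : (i j : Fin n) → (Fin.suc i == suc j) ≡ (i == j)
==-suc i j with i F.≟ j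
... | yes p = refl
... | no p = refl

∑-delta : (f : Fin n → ℕ) (i : Fin n) → ∑ (λ j → f j * b2n (j == i)) ≡ f i
∑-delta {suc n} f zero = trans (cong₂ _+_ (*-identityʳ (f zero))
  (∑-zero (λ j → *-zeroʳ (f (suc j))))) (+-identityʳ _)
∑-delta {suc n} f (suc i) = trans (cong (_+ ∑ (λ j → f (suc j) * b2n (suc j == suc i))) (*-zeroʳ (f zero)))
  (trans (∑-cong (λ j → cong (λ b → f (suc j) * b2n b) (==-suc j i))) (∑-delta (f ∘ suc) i))

∑-count-one : (i : Fin n) → ∑ (λ j → b2n (j == i)) ≡ 1
∑-count-one i = trans (∑-cong (λ j → sym (+-identityʳ (b2n (j == i))))) (∑-delta (λ _ → 1) i)

isOddB-suc : ∀ n → isOddB (suc n) ≡ not (isOddB n)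
isOddB-suc zero = refl
isOddB-suc (suc zero) = refl
isOddB-suc (suc (suc n)) = isOddB-suc n

isOddB-+ : ∀ m n → isOddB (m + n) ≡ isOddB m xor isOddB n
isOddB-+ zero n = refl
isOddB-+ (suc zero) n = isOddB-suc n
isOddB-+ (suc (suc m)) n = isOddB-+ m n

isOddB-b2n : ∀ b → isOddB (b2n b) ≡ b
isOddB-b2n true = refl
isOddB-b2n false = refl

isOddB-∑ : (f : Fin n → ℕ) → isOddB (∑ f) ≡ ⨁ (λ i → isOddB (f i))
isOddB-∑ {zero} f = refl
isOddB-∑ {suc n} f = trans (isOddB-+ (f zero) (∑ (f ∘ suc)))
  (cong (isOddB (f zero) xor_) (isOddB-∑ (f ∘ suc)))

half-split : ∀ d → d ≡ b2n (isOddB d) + 2 * ⌊ d /2⌋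
half-split zero = refl
half-split (suc zero) = refl
half-split (suc (suc d)) = trans (cong (2 +_) (half-split d))
  (solve 2 (λ b h → con 2 :+ (b :+ con 2 :* h) := b :+ con 2 :* (con 1 :+ h)) refl
     (b2n (isOddB d)) ⌊ d /2⌋)
  where
  open +-*-Solver

-- Counts the paths through a vertex of degree d: ⌊d/2⌋ with the vertex inside, and one that ends
-- there if d is odd.
ceil-half : ∀ d → ⌈ d /2⌉ ≡ ⌊ d /2⌋ + b2n (isOddB d)
ceil-half zero = refl
ceil-half (suc zero) = refl
ceil-half (suc (suc d)) = cong suc (ceil-half d)

-- Walks as edge sets over the field with two elements

module Walk {A : Set} (_≟A_ : DecidableEquality A) where

  _≐_ : A → A → Bool
  x ≐ y = does (x ≟A y)

  ≐-refl : ∀ x → (x ≐ x) ≡ true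
  ≐-refl x = dec-true (x ≟A x) refl

  ≐-≢ : ∀ {x y} → x ≢ y → (x ≐ y) ≡ false
  ≐-≢ {x} {y} h = dec-false (x ≟A y) h

  edge : A → A → A → A → Bool
  edge x y u v = ((x ≐ u) ∧ (y ≐ v)) ∨ ((x ≐ v) ∧ (y ≐ u))

  edge-sound : ∀ {x y u v} → edge x y u v ≡ true → (x ≡ u × y ≡ v) ⊎ (x ≡ v × y ≡ u)
  edge-sound {x} {y} {u} {v} h with x ≟A u | y ≟A v | x ≟A v | y ≟A u
  ... | yes p | yes q | _ | _ = inj₁ (p , q)
  ... | yes p | no q | yes r | yes s = inj₂ (r , s)
  ... | no p | yes q | yes r | yes s = inj₂ (r , s)
  ... | no p | no q | yes r | yes s = inj₂ (r , s)

  edge-refl : ∀ x y → edge x y x y ≡ true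
  edge-refl x y rewrite ≐-refl x | ≐-refl y = refl

  edge-flip : ∀ x y → edge x y y x ≡ true
  edge-flip x y with x ≟A y
  ... | yes refl rewrite ≐-refl x = refl
  ... | no _ rewrite ≐-refl x | ≐-refl y = refl

  edge-false : ∀ {x y u v} → ¬ ((x ≡ u × y ≡ v) ⊎ (x ≡ v × y ≡ u)) → edge x y u v ≡ false
  edge-false {x} {y} {u} {v} h with edge x y u v in eq
  ... | true = ⊥-elim (h (edge-sound eq))
  ... | false = refl

  edge-off : ∀ {x u v} y → x ≢ u → x ≢ v → edge x y u v ≡ false
  edge-off y p q = edge-false λ { (inj₁ (r , _)) → p r ; (inj₂ (r , _)) → q r }

  edge-off′ : ∀ {y u v} x → y ≢ u → y ≢ v → edge x y u v ≡ false
  edge-off′ x p q = edge-false λ { (inj₁ (_ , r)) → q r ; (inj₂ (_ , r)) → p r }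

  edge-comm : ∀ x y u v → edge x y u v ≡ edge y x u v
  edge-comm x y u v = trans (∨-comm ((x ≐ u) ∧ (y ≐ v)) _)
    (cong₂ _∨_ (∧-comm (x ≐ v) (y ≐ u)) (∧-comm (x ≐ u) (y ≐ v)))

  edge-sym : ∀ x y u v → edge x y u v ≡ edge x y v u
  edge-sym x y u v = ∨-comm ((x ≐ u) ∧ (y ≐ v)) _

  -- Edges are added over the field with two elements, whereas `edgeIn` takes a disjunction.
  -- Inserting and cancelling edges thus become identities in a commutative ring, within reach of
  -- the xor solver. On lists without repetition both agree.
  walk : List A → A → A → Bool
  walk [] u v = false
  walk (x ∷ []) u v = false
  walk (x ∷ y ∷ xs) u v = edge x y u v xor walk (y ∷ xs) u v

  count : A → List A → ℕ
  count z [] = 0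
  count z (x ∷ xs) = b2n (x ≐ z) + count z xs

  count-++ : ∀ z xs ys → count z (xs ++ ys) ≡ count z xs + count z ys
  count-++ z [] ys = refl
  count-++ z (x ∷ xs) ys = trans (cong (b2n (x ≐ z) +_) (count-++ z xs ys))
    (sym (+-assoc (b2n (x ≐ z)) _ _))

  count-self : ∀ x → b2n (x ≐ x) ≡ 1
  count-self x = cong b2n (≐-refl x)

  count-here : ∀ x xs → 1 ≤ count x (x ∷ xs)
  count-here x xs rewrite ≐-refl x = s≤s z≤n

  All≢⇒count≡0 : ∀ {x xs} → All (x ≢_) xs → count x xs ≡ 0
  All≢⇒count≡0 [] = refl
  All≢⇒count≡0 {x} (p ∷ ps) rewrite ≐-≢ (p ∘ sym) = All≢⇒count≡0 ps

  count≡0⇒All≢ : ∀ {x} xs → count x xs ≡ 0 → All (x ≢_) xs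
  count≡0⇒All≢ [] h = []
  count≡0⇒All≢ {x} (y ∷ xs) h with y ≟A x
  ... | no p = (p ∘ sym) ∷ count≡0⇒All≢ xs h

  Unique⇒count≤1 : ∀ {xs} → Unique xs → ∀ z → count z xs ≤ 1
  Unique⇒count≤1 [] z = z≤n
  Unique⇒count≤1 {x ∷ xs} (p ∷ ps) z with x ≟A z
  ... | yes refl rewrite All≢⇒count≡0 p = s≤s z≤n
  ... | no _ = Unique⇒count≤1 ps z

  count≤1⇒Unique : ∀ xs → (∀ z → count z xs ≤ 1) → Unique xs
  count≤1⇒Unique [] h = []
  count≤1⇒Unique (x ∷ xs) h =
    count≡0⇒All≢ xs (n≤0⇒n≡0 (s≤s⁻¹ (subst (λ c → c + count x xs ≤ 1) (count-self x) (h x))))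
    ∷ count≤1⇒Unique xs (λ z → ≤-trans (m≤n+m _ _) (h z))

  walk-off : ∀ {u} v xs → count u xs ≡ 0 → walk xs u v ≡ false
  walk-off v [] h = refl
  walk-off v (x ∷ []) h = refl
  walk-off {u} v (x ∷ y ∷ xs) h = off (count≡0⇒All≢ (x ∷ y ∷ xs) h)
    (walk-off {u} v (y ∷ xs) (m+n≡0⇒n≡0 (b2n (x ≐ u)) h))
    where
    off : All (u ≢_) (x ∷ y ∷ xs) → walk (y ∷ xs) u v ≡ false → walk (x ∷ y ∷ xs) u v ≡ false
    off (p ∷ q ∷ _) e = cong₂ _xor_
      (edge-false λ { (inj₁ (a , _)) → p (sym a) ; (inj₂ (_ , b)) → q (sym b) }) e

  walk-sym : ∀ xs u v → walk xs u v ≡ walk xs v u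
  walk-sym [] u v = refl
  walk-sym (x ∷ []) u v = refl
  walk-sym (x ∷ y ∷ xs) u v = cong₂ _xor_ (edge-sym x y u v) (walk-sym (y ∷ xs) u v)

  -- A second occurrence of the edge xy would contain x again, so at most one of the two summands is
  -- true.
  Unique-∨≡walk : ∀ x y xs u v → Unique (x ∷ y ∷ xs) →
    edge x y u v ∨ walk (y ∷ xs) u v ≡ walk (x ∷ y ∷ xs) u v
  Unique-∨≡walk x y xs u v (p ∷ _) with edge x y u v in eq
  ... | false = refl
  ... | true with edge-sound eq
  ...   | inj₁ (refl , _) rewrite walk-off v (y ∷ xs) (All≢⇒count≡0 p) = refl
  ...   | inj₂ (refl , _) rewrite walk-sym (y ∷ xs) u x | walk-off u (y ∷ xs) (All≢⇒count≡0 p) = refl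

module FW {n} = Walk {Fin n} F._≟_
module NW = Walk _≟_

edgeIn≡walk : ∀ (P : List (Fin n)) → Unique P → ∀ u v → edgeIn P u v ≡ FW.walk P u v
edgeIn≡walk [] _ u v = refl
edgeIn≡walk (x ∷ []) _ u v = refl
edgeIn≡walk (x ∷ y ∷ xs) (p ∷ q) u v =
  trans (cong (λ b → ((x == u) ∧ (y == v)) ∨ ((x == v) ∧ (y == u)) ∨ b) (edgeIn≡walk (y ∷ xs) q u v))
  (trans (sym (∨-assoc ((x == u) ∧ (y == v)) _ _)) (FW.Unique-∨≡walk x y xs u v (p ∷ q)))

-- The lower bound

deg-∑ : ∀ G v → deg G v ≡ ∑ (λ u → b2n (adj G v u))
deg-∑ G v = sum-allFin (λ u → b2n (adj G v u))

vodd-∑ : ∀ G → vodd G ≡ ∑ (λ v → b2n (isOddB (deg G v)))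
vodd-∑ G = sum-allFin (λ v → b2n (isOddB (deg G v)))

max-tabulate : (f : Fin n → A) (g : A → ℕ) → ∀ i → g (f i) ≤ foldr _⊔_ 0 (map g (tabulate f))
max-tabulate f g zero = m≤m⊔n _ _
max-tabulate f g (suc i) = ≤-trans (max-tabulate (f ∘ suc) g i) (m≤n⊔m _ _)

max-tabulate-least : (f : Fin n → A) (g : A → ℕ) → ∀ {d} → (∀ i → g (f i) ≤ d) →
  foldr _⊔_ 0 (map g (tabulate f)) ≤ d
max-tabulate-least {zero} f g h = z≤n
max-tabulate-least {suc n} f g h = ⊔-lub (h zero) (max-tabulate-least (f ∘ suc) g (h ∘ suc))

deg≤Δ : ∀ G v → deg G v ≤ Δ G
deg≤Δ G v = max-tabulate id (deg G) v

Δ-least : ∀ G {d} → (∀ v → deg G v ≤ d) → Δ G ≤ d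
Δ-least G h = max-tabulate-least id (deg G) h

b2n-∧ : ∀ p q → b2n (p ∧ q) ≡ b2n p * b2n q
b2n-∧ true q = sym (+-identityʳ _)
b2n-∧ false q = refl

b2n-∨≤ : ∀ p q → b2n (p ∨ q) ≤ b2n p + b2n q
b2n-∨≤ true q = s≤s z≤n
b2n-∨≤ false q = ≤-refl

b2n-xor≤ : ∀ p q → b2n (p xor q) ≤ b2n p + b2n q
b2n-xor≤ true true = z≤n
b2n-xor≤ true false = ≤-refl
b2n-xor≤ false q = ≤-refl

b2n-∨-disjoint : ∀ p q → p ∧ q ≡ false → b2n (p ∨ q) ≡ b2n p + b2n q
b2n-∨-disjoint true false _ = refl
b2n-∨-disjoint false q _ = refl

∧-trueˡ : ∀ {p q} → p ∧ q ≡ true → p ≡ true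
∧-trueˡ {true} h = refl

∧-trueʳ : ∀ {p q} → p ∧ q ≡ true → q ≡ true
∧-trueʳ {true} h = h

¬true⇒false : ∀ {p} → p ≢ true → p ≡ false
¬true⇒false {true} h = ⊥-elim (h refl)
¬true⇒false {false} h = refl

true≢false : ∀ {b} → b ≡ true → b ≡ false → ⊥
true≢false refl ()

adj⇒≢ : ∀ G → IsSimple G → ∀ {u v} → adj G u v ≡ true → u ≢ v
adj⇒≢ G (_ , irr) {u} a refl = true≢false a (irr u)

module _ (H : Graph) (simple : IsSimple H) (u v : Fin (size H)) (a : adj H u v ≡ true) where

  private
    S = subdivide H u v
    u≢v = adj⇒≢ H simple a

  ==-both : ∀ (i j x y : Fin (size H)) → (i == x) ∧ (j == y) ≡ true → i ≡ x × j ≡ y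
  ==-both i j x y h with i F.≟ x | j F.≟ y
  ... | yes p | yes q = p , q

  ends-disjoint : ∀ j → ((j == u) ∧ (j == v)) ≡ false
  ends-disjoint j = ¬true⇒false λ t → u≢v (trans (sym (proj₁ (==-both j j u v t))) (proj₂ (==-both j j u v t)))

  subdivide-simple : IsSimple S
  subdivide-simple = symm , irr
    where
    symm : ∀ i j → adj S i j ≡ adj S j i
    symm zero zero = refl
    symm zero (suc j) = refl
    symm (suc i) zero = refl
    symm (suc i) (suc j) = cong₂ (λ p q → p ∧ not q) (proj₁ simple i j) (FW.edge-comm i j u v)
    irr : ∀ i → adj S i i ≡ false
    irr zero = refl
    irr (suc i) rewrite proj₂ simple i = refl

  deg-subdivide-new : deg S zero ≡ 2
  deg-subdivide-new = trans (deg-∑ S zero)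
    (trans (∑-cong (λ j → b2n-∨-disjoint (j == u) (j == v) (ends-disjoint j)))
    (trans (∑-distrib-+ (λ j → b2n (j == u)) (λ j → b2n (j == v)))
    (cong₂ _+_ (∑-count-one u) (∑-count-one v))))

  private
    split : ∀ a p q → (p ≡ true → a ≡ true) → (q ≡ true → a ≡ true) → p ∧ q ≡ false →
      b2n a ≡ b2n (a ∧ not (p ∨ q)) + (b2n p + b2n q)
    split true true true _ _ ()
    split true true false _ _ _ = refl
    split true false true _ _ _ = refl
    split true false false _ _ _ = refl
    split false true q f _ _ with () ← f refl
    split false false true _ g _ with () ← g refl
    split false false false _ _ _ = refl

    pointwise : ∀ i j → b2n (adj H i j) ≡ b2n (adj S (suc i) (suc j)) +
      (b2n (i == u) * b2n (j == v) + b2n (i == v) * b2n (j == u))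
    pointwise i j = trans
      (split (adj H i j) ((i == u) ∧ (j == v)) ((i == v) ∧ (j == u))
        (λ t → let p , q = ==-both i j u v t in
          subst₂ (λ x y → adj H x y ≡ true) (sym p) (sym q) a)
        (λ t → let p , q = ==-both i j v u t in
          subst₂ (λ x y → adj H x y ≡ true) (sym p) (sym q) (trans (proj₁ simple v u) a))
        (¬true⇒false λ t → u≢v (trans
          (sym (proj₁ (==-both i j u v (∧-trueˡ t))))
          (proj₁ (==-both i j v u (∧-trueʳ {(i == u) ∧ (j == v)} t))))))
      (cong₂ (λ x y → b2n (adj S (suc i) (suc j)) + (x + y))
        (b2n-∧ (i == u) (j == v)) (b2n-∧ (i == v) (j == u)))

    ∑-const-* : ∀ c (x : Fin (size H)) → ∑ (λ j → c * b2n (j == x)) ≡ c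
    ∑-const-* c x = ∑-delta (λ _ → c) x

  -- The neighbour lost to the deleted edge is made up for by the new vertex: summed over j, the
  -- products in `pointwise` are exactly the indicators of i being u or v.
  deg-subdivide-old : ∀ i → deg S (suc i) ≡ deg H i
  deg-subdivide-old i = begin
    deg S (suc i) ≡⟨ deg-∑ S (suc i) ⟩
    b2n ((i == u) ∨ (i == v)) + X ≡⟨ cong (_+ X) (b2n-∨-disjoint (i == u) (i == v) (ends-disjoint i)) ⟩
    b2n (i == u) + b2n (i == v) + X ≡⟨ +-comm _ X ⟩
    X + (b2n (i == u) + b2n (i == v))
      ≡⟨ cong (X +_) (cong₂ _+_ (∑-const-* (b2n (i == u)) v) (∑-const-* (b2n (i == v)) u)) ⟨
    X + (∑ Y + ∑ Z) ≡⟨ cong (X +_) (∑-distrib-+ Y Z) ⟨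
    X + ∑ (λ j → Y j + Z j) ≡⟨ ∑-distrib-+ (λ j → b2n (adj S (suc i) (suc j))) (λ j → Y j + Z j) ⟨
    ∑ (λ j → b2n (adj S (suc i) (suc j)) + (Y j + Z j)) ≡⟨ ∑-cong (pointwise i) ⟨
    ∑ (λ j → b2n (adj H i j)) ≡⟨ deg-∑ H i ⟨
    deg H i ∎
    where
    open ≡-Reasoning
    X = ∑ (λ j → b2n (adj S (suc i) (suc j)))
    Y = λ j → b2n (i == u) * b2n (j == v)
    Z = λ j → b2n (i == v) * b2n (j == u)

  vodd-subdivide : vodd S ≡ vodd H
  vodd-subdivide = trans (vodd-∑ S) (trans
    (cong₂ _+_ (cong (b2n ∘ isOddB) deg-subdivide-new)
      (∑-cong (λ i → cong (b2n ∘ isOddB) (deg-subdivide-old i))))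
    (sym (vodd-∑ H)))

  Δ-subdivide : Δ H ≤ Δ S
  Δ-subdivide = Δ-least H λ i → subst (_≤ Δ S) (deg-subdivide-old i) (deg≤Δ S (suc i))

Subdivision-invariants : ∀ {G H} → IsSimple G → Subdivision G H →
  IsSimple H × Δ G ≤ Δ H × vodd H ≡ vodd G
Subdivision-invariants s base = s , ≤-refl , refl
Subdivision-invariants s (step {H} σ u v a) with Subdivision-invariants s σ
... | sH , d , o = subdivide-simple H sH u v a
  , ≤-trans d (Δ-subdivide H sH u v a) , trans (vodd-subdivide H sH u v a) o

-- Each occurrence of v has at most one edge on either side. The first entry has none before it; the
-- extra summand records this gap, and the induction spends it on the edge that is put in front.
path-degree : (x : Fin n) (P : List (Fin n)) (v : Fin n) →
  ∑ (λ u → b2n (edgeIn (x ∷ P) v u)) + b2n (x == v) ≤ 2 * FW.count v (x ∷ P)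
path-degree x [] v = ≤-trans (≤-reflexive 
    (cong (_+ b2n (x == v)) (∑-zero {f = λ u → b2n (edgeIn (x ∷ []) v u)} (λ u → refl))))
  (≤-trans (m≤m+n _ _) (≤-reflexive (sym (cong (2 *_) (+-identityʳ (b2n (x == v)))))))
path-degree {n} x (y ∷ P) v = begin
  ∑ (λ u → b2n (edgeIn (x ∷ y ∷ P) v u)) + X
    ≤⟨ +-monoˡ-≤ X (∑-mono-≤ bound) ⟩
  ∑ (λ u → X * b2n (u == y) + (Y * b2n (u == x) + E u)) + X
    ≡⟨ cong (_+ X) (trans (∑-distrib-+ (λ u → X * b2n (u == y)) (λ u → Y * b2n (u == x) + E u))
        (cong₂ _+_ (∑-delta (λ _ → X) y) (trans (∑-distrib-+ (λ u → Y * b2n (u == x)) E)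
          (cong (_+ ∑ E) (∑-delta (λ _ → Y) x))))) ⟩
  X + (Y + ∑ E) + X
    ≡⟨ solve 3 (λ a b c → a :+ (b :+ c) :+ a := con 2 :* a :+ (c :+ b)) refl X Y (∑ E) ⟩
  2 * X + (∑ E + Y)
    ≤⟨ +-monoʳ-≤ (2 * X) (path-degree y P v) ⟩
  2 * X + 2 * FW.count v (y ∷ P)
    ≡⟨ *-distribˡ-+ 2 X _ ⟨
  2 * FW.count v (x ∷ y ∷ P) ∎
  where
  open ≤-Reasoning
  open +-*-Solver
  X = b2n (x == v)
  Y = b2n (y == v)
  E : Fin n → ℕ
  E u = b2n (edgeIn (y ∷ P) v u)
  bound : ∀ u → b2n (edgeIn (x ∷ y ∷ P) v u) ≤ X * b2n (u == y) + (Y * b2n (u == x) + E u)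
  bound u = ≤-trans (b2n-∨≤ ((x == v) ∧ (y == u)) _)
    (+-mono-≤ (≤-reflexive (trans (b2n-∧ (x == v) (y == u)) (cong (λ b → X * b2n b) (==-sym y u))))
      (≤-trans (b2n-∨≤ ((x == u) ∧ (y == v)) _)
        (+-monoˡ-≤ (E u) (≤-reflexive (trans (b2n-∧ (x == u) (y == v))
          (trans (*-comm (b2n (x == u)) Y) (cong (λ b → Y * b2n b) (==-sym x u))))))))

path-degree≤2 : (P : List (Fin n)) → IsPath P → ∀ v → ∑ (λ u → b2n (edgeIn P v u)) ≤ 2
path-degree≤2 (x ∷ P) uniq v = ≤-trans (m≤m+n _ _) (≤-trans (path-degree x P v)
  (*-monoʳ-≤ 2 (FW.Unique⇒count≤1 uniq v)))

-- The indicators of the ends of the edges telescope along the path, and y is its last vertex. On a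
-- one-vertex path the two ends coincide and cancel.
path-parity : (x : Fin n) (P : List (Fin n)) → Unique (x ∷ P) → Σ (Fin n) λ y → ∀ v →
  isOddB (∑ (λ u → b2n (edgeIn (x ∷ P) v u))) ≡ (x == v) xor (y == v)
path-parity {n} x [] _ = x , λ v →
  trans (cong isOddB (∑-zero {f = λ u → b2n (edgeIn (x ∷ []) v u)} (λ u → refl))) (sym (xor-same (x == v)))
path-parity {n} x (y ∷ P) (p ∷ uniq) with path-parity y P uniq
... | z , h = z , λ v → begin
  isOddB (∑ (λ u → b2n (edgeIn (x ∷ y ∷ P) v u)))
    ≡⟨ isOddB-∑ (λ u → b2n (edgeIn (x ∷ y ∷ P) v u)) ⟩
  ⨁ (λ u → isOddB (b2n (edgeIn (x ∷ y ∷ P) v u)))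
    ≡⟨ ⨁-cong (λ u → trans (isOddB-b2n (edgeIn (x ∷ y ∷ P) v u)) (trans (edgeIn≡walk (x ∷ y ∷ P) (p ∷ uniq) v u)
         (cong₂ _xor_ (edge-as-sum v u) (trans (sym (edgeIn≡walk (y ∷ P) uniq v u)) (sym (isOddB-b2n (edgeIn (y ∷ P) v u))))))) ⟩
  ⨁ (λ u → isOddB (δ v u) xor isOddB (ρ v u))
    ≡⟨ ⨁-distrib-xor (λ u → isOddB (δ v u)) (λ u → isOddB (ρ v u)) ⟩
  ⨁ (λ u → isOddB (δ v u)) xor ⨁ (λ u → isOddB (ρ v u))
    ≡⟨ cong₂ _xor_ (isOddB-∑ (δ v)) (isOddB-∑ (ρ v)) ⟨
  isOddB (∑ (δ v)) xor isOddB (∑ (ρ v))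
    ≡⟨ cong₂ _xor_ (trans (cong isOddB (trans (∑-distrib-+ (λ u → b2n (x == v) * b2n (u == y)) (λ u → b2n (y == v) * b2n (u == x)))
          (cong₂ _+_ (∑-delta (λ _ → b2n (x == v)) y) (∑-delta (λ _ → b2n (y == v)) x))))
          (trans (isOddB-+ (b2n (x == v)) _) (cong₂ _xor_ (isOddB-b2n (x == v)) (isOddB-b2n (y == v)))))
        (h v) ⟩
  ((x == v) xor (y == v)) xor ((y == v) xor (z == v))
    ≡⟨ solve 3 (λ a b c → (a :+ b) :+ (b :+ c) := a :+ c) refl (x == v) (y == v) (z == v) ⟩
  (x == v) xor (z == v) ∎
  where
  open ≡-Reasoning
  open xor-∧-Solver
  δ ρ : Fin n → Fin n → ℕ
  δ v u = b2n (x == v) * b2n (u == y) + b2n (y == v) * b2n (u == x)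
  ρ v u = b2n (edgeIn (y ∷ P) v u)
  x≢y : x ≢ y
  x≢y = All.head p
  edge-as-sum : ∀ v u → FW.edge x y v u ≡ isOddB (δ v u)
  edge-as-sum v u = trans (sym (isOddB-b2n (FW.edge x y v u))) (cong isOddB (trans
    (b2n-∨-disjoint ((x == v) ∧ (y == u)) ((x == u) ∧ (y == v))
      (¬true⇒false λ t → x≢y (trans (==-sound (∧-trueˡ (∧-trueˡ t)))
        (sym (==-sound (∧-trueʳ {x == u} (∧-trueʳ {(x == v) ∧ (y == u)} t)))))))
    (cong₂ _+_ (trans (b2n-∧ (x == v) (y == u)) (cong (λ b → b2n (x == v) * b2n b) (==-sym y u)))
      (trans (b2n-∧ (x == u) (y == v)) (trans (*-comm (b2n (x == u)) (b2n (y == v)))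
        (cong (λ b → b2n (y == v) * b2n b) (==-sym x u)))))))

path-odd≤2 : (P : List (Fin n)) → IsPath P →
  ∑ (λ v → b2n (isOddB (∑ (λ u → b2n (edgeIn P v u))))) ≤ 2
path-odd≤2 (x ∷ P) uniq with path-parity x P uniq
... | y , h = begin
  ∑ (λ v → b2n (isOddB (∑ (λ u → b2n (edgeIn (x ∷ P) v u)))))
    ≤⟨ ∑-mono-≤ (λ v → ≤-trans (≤-reflexive (cong b2n (h v))) (b2n-xor≤ (x == v) (y == v))) ⟩
  ∑ (λ v → b2n (x == v) + b2n (y == v))
    ≡⟨ ∑-cong (λ v → cong₂ (λ a b → b2n a + b2n b) (==-sym x v) (==-sym y v)) ⟩
  ∑ (λ v → b2n (v == x) + b2n (v == y))
    ≡⟨ ∑-distrib-+ (λ v → b2n (v == x)) (λ v → b2n (v == y)) ⟩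
  ∑ (λ v → b2n (v == x)) + ∑ (λ v → b2n (v == y))
    ≡⟨ cong₂ _+_ (∑-count-one x) (∑-count-one y) ⟩
  2 ∎
  where
  open ≤-Reasoning

cover-degree≤ : (Ps : List (List (Fin n))) → All IsPath Ps → ∀ v →
  ∑ (λ u → b2n (xorEdges Ps v u)) ≤ 2 * length Ps
cover-degree≤ {n} [] [] v = ≤-reflexive (∑-zero {n} {λ u → b2n (xorEdges [] v u)} (λ u → refl))
cover-degree≤ (P ∷ Ps) (p ∷ ps) v = begin
  ∑ (λ u → b2n (xorEdges (P ∷ Ps) v u))
    ≤⟨ ∑-mono-≤ (λ u → b2n-xor≤ (edgeIn P v u) (xorEdges Ps v u)) ⟩
  ∑ (λ u → b2n (edgeIn P v u) + b2n (xorEdges Ps v u))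
    ≡⟨ ∑-distrib-+ (λ u → b2n (edgeIn P v u)) (λ u → b2n (xorEdges Ps v u)) ⟩
  ∑ (λ u → b2n (edgeIn P v u)) + ∑ (λ u → b2n (xorEdges Ps v u))
    ≤⟨ +-mono-≤ (path-degree≤2 P p v) (cover-degree≤ Ps ps v) ⟩
  2 + 2 * length Ps ≡⟨ *-suc 2 (length Ps) ⟨
  2 * length (P ∷ Ps) ∎
  where
  open ≤-Reasoning

oddDegree : (Fin n → Fin n → Bool) → Fin n → Bool
oddDegree a v = isOddB (∑ (λ u → b2n (a v u)))

oddDegree≡⨁ : (a : Fin n → Fin n → Bool) → ∀ v → oddDegree a v ≡ ⨁ (a v)
oddDegree≡⨁ a v = trans (isOddB-∑ (λ u → b2n (a v u))) (⨁-cong (λ u → isOddB-b2n (a v u)))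

cover-odd≤ : (Ps : List (List (Fin n))) → All IsPath Ps →
  ∑ (λ v → b2n (oddDegree (xorEdges Ps) v)) ≤ 2 * length Ps
cover-odd≤ {n} [] [] = ≤-reflexive (∑-zero {n} λ v → cong (b2n ∘ isOddB)
  (∑-zero {n} {λ u → b2n (xorEdges [] v u)} (λ u → refl)))
cover-odd≤ (P ∷ Ps) (p ∷ ps) = begin
  ∑ (λ v → b2n (oddDegree (xorEdges (P ∷ Ps)) v))
    ≤⟨ ∑-mono-≤ (λ v → ≤-trans (≤-reflexive (cong b2n (additive v)))
         (b2n-xor≤ (oddDegree (edgeIn P) v) (oddDegree (xorEdges Ps) v))) ⟩
  ∑ (λ v → b2n (oddDegree (edgeIn P) v) + b2n (oddDegree (xorEdges Ps) v))
    ≡⟨ ∑-distrib-+ (λ v → b2n (oddDegree (edgeIn P) v)) (λ v → b2n (oddDegree (xorEdges Ps) v)) ⟩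
  ∑ (λ v → b2n (oddDegree (edgeIn P) v)) + ∑ (λ v → b2n (oddDegree (xorEdges Ps) v))
    ≤⟨ +-mono-≤ (path-odd≤2 P p) (cover-odd≤ Ps ps) ⟩
  2 + 2 * length Ps ≡⟨ *-suc 2 (length Ps) ⟨
  2 * length (P ∷ Ps) ∎
  where
  open ≤-Reasoning
  additive : ∀ v → oddDegree (xorEdges (P ∷ Ps)) v ≡ oddDegree (edgeIn P) v xor oddDegree (xorEdges Ps) v
  additive v = trans (oddDegree≡⨁ (xorEdges (P ∷ Ps)) v)
    (trans (⨁-distrib-xor (edgeIn P v) (xorEdges Ps v))
      (sym (cong₂ _xor_ (oddDegree≡⨁ (edgeIn P) v) (oddDegree≡⨁ (xorEdges Ps) v))))

⌊2*n/2⌋≡n : ∀ n → ⌊ 2 * n /2⌋ ≡ n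
⌊2*n/2⌋≡n n = trans (cong (λ x → ⌊ n + x /2⌋) (+-identityʳ n)) (sym (n≡⌊n+n/2⌋ n))

⌈2*n/2⌉≡n : ∀ n → ⌈ 2 * n /2⌉ ≡ n
⌈2*n/2⌉≡n n = trans (cong (λ x → ⌈ n + x /2⌉) (+-identityʳ n)) (sym (n≡⌈n+n/2⌉ n))

-- Under symmetric difference degrees are subadditive and their parities add up, so m paths produce
-- degrees of at most 2m and at most 2m odd vertices.
lower-bound : ∀ G → IsSimple G → ∀ H m → Subdivision G H → HasOddCover H m →
  ⌊ vodd G /2⌋ ⊔ ⌈ Δ G /2⌉ ≤ m
lower-bound G simple H m σ (Ps , paths , refl , eq) with Subdivision-invariants simple σ
... | _ , ΔG≤ΔH , voddH≡ = ⊔-lub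
  (≤-trans (⌊n/2⌋-mono (≤-trans (≤-reflexive (sym voddH≡)) vodd≤)) (≤-reflexive (⌊2*n/2⌋≡n m)))
  (≤-trans (⌈n/2⌉-mono (≤-trans ΔG≤ΔH Δ≤)) (≤-reflexive (⌈2*n/2⌉≡n m)))
  where
  deg≡ : ∀ v → deg H v ≡ ∑ (λ u → b2n (xorEdges Ps v u))
  deg≡ v = trans (deg-∑ H v) (∑-cong (λ u → cong b2n (eq v u)))
  Δ≤ : Δ H ≤ 2 * m
  Δ≤ = Δ-least H λ v → ≤-trans (≤-reflexive (deg≡ v)) (cover-degree≤ Ps paths v)
  vodd≤ : vodd H ≤ 2 * m
  vodd≤ = ≤-trans (≤-reflexive (trans (vodd-∑ H) (∑-cong (λ v → cong (b2n ∘ isOddB) (deg≡ v)))))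
    (cover-odd≤ Ps paths)

-- Over the field with two elements the first row and the first column cancel, and induction
-- disposes of the rest.
⨁-symmetric : (a : Fin n → Fin n → Bool) → (∀ u v → a u v ≡ a v u) → (∀ u → a u u ≡ false) →
  ⨁ (λ u → ⨁ (a u)) ≡ false
⨁-symmetric {zero} a s z = refl
⨁-symmetric {suc n} a s z = begin
  (a zero zero xor R) xor ⨁ (λ u → a (suc u) zero xor ⨁ (λ v → a (suc u) (suc v)))
    ≡⟨ cong₂ _xor_ (cong (_xor R) (z zero))
         (⨁-distrib-xor (λ u → a (suc u) zero) (λ u → ⨁ (λ v → a (suc u) (suc v)))) ⟩
  R xor (⨁ (λ u → a (suc u) zero) xor ⨁ (λ u → ⨁ (λ v → a (suc u) (suc v))))
    ≡⟨ cong (R xor_) (cong₂ _xor_ (⨁-cong (λ u → s (suc u) zero))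
         (⨁-symmetric (λ u v → a (suc u) (suc v)) (λ u v → s (suc u) (suc v)) (λ u → z (suc u)))) ⟩
  R xor (R xor false) ≡⟨ cong (R xor_) (xor-identityʳ R) ⟩
  R xor R ≡⟨ xor-same R ⟩
  false ∎
  where
  open ≡-Reasoning
  R = ⨁ (λ v → a zero (suc v))

-- It makes ⌊vodd/2⌋ an exact half, and it allows the odd vertices to be paired up as ends of paths.
handshake : ∀ G → IsSimple G → isOddB (vodd G) ≡ false
handshake G (s , z) = begin
  isOddB (vodd G) ≡⟨ cong isOddB (vodd-∑ G) ⟩
  isOddB (∑ (λ v → b2n (isOddB (deg G v)))) ≡⟨ isOddB-∑ (λ v → b2n (isOddB (deg G v))) ⟩
  ⨁ (λ v → isOddB (b2n (isOddB (deg G v)))) ≡⟨ ⨁-cong (λ v → trans (isOddB-b2n (isOddB (deg G v)))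
     (trans (cong isOddB (deg-∑ G v)) (oddDegree≡⨁ (adj G) v))) ⟩
  ⨁ (λ v → ⨁ (adj G v)) ≡⟨ ⨁-symmetric (adj G) s z ⟩
  false ∎
  where
  open ≡-Reasoning

-- Maximum degree two

three-terms≤∑ : (f : Fin n → ℕ) {i j l : Fin n} → i ≢ j → i ≢ l → j ≢ l →
  1 ≤ f i → 1 ≤ f j → 1 ≤ f l → 3 ≤ ∑ f
three-terms≤∑ f {i} {j} {l} ij il jl fi fj fl = ≤-trans (≤-reflexive (sym (begin
    ∑ (λ u → b2n (u == i) + (b2n (u == j) + b2n (u == l)))
      ≡⟨ ∑-distrib-+ (λ u → b2n (u == i)) (λ u → b2n (u == j) + b2n (u == l)) ⟩
    ∑ (λ u → b2n (u == i)) + ∑ (λ u → b2n (u == j) + b2n (u == l))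
      ≡⟨ cong₂ _+_ (∑-count-one i) (trans (∑-distrib-+ (λ u → b2n (u == j)) (λ u → b2n (u == l)))
           (cong₂ _+_ (∑-count-one j) (∑-count-one l))) ⟩
    3 ∎))) (∑-mono-≤ pointwise)
  where
  open ≡-Reasoning
  pointwise : ∀ u → b2n (u == i) + (b2n (u == j) + b2n (u == l)) ≤ f u
  pointwise u with u F.≟ i | u F.≟ j | u F.≟ l
  ... | yes refl | yes e | _ = ⊥-elim (ij e)
  ... | yes refl | no _ | yes e = ⊥-elim (il e)
  ... | yes refl | no _ | no _ = fi
  ... | no _ | yes refl | yes e = ⊥-elim (jl e)
  ... | no _ | yes refl | no _ = fj
  ... | no _ | no _ | yes refl = fl
  ... | no _ | no _ | no _ = z≤n

∨-true : ∀ {p q} → p ∨ q ≡ true → p ≡ true ⊎ q ≡ true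
∨-true {true} h = inj₁ refl
∨-true {false} h = inj₂ h

∨-trueʳ : ∀ p {q} → q ≡ true → p ∨ q ≡ true
∨-trueʳ p refl = ∨-zeroʳ p

same-truth : ∀ {p q} → (p ≡ true → q ≡ true) → (q ≡ true → p ≡ true) → p ≡ q
same-truth {true} f g = sym (f refl)
same-truth {false} {true} f g = g refl
same-truth {false} {false} f g = refl

edgeIn-∷ : (x y : Fin n) (xs : List (Fin n)) {u v : Fin n} →
  edgeIn (x ∷ y ∷ xs) u v ≡ FW.edge x y u v ∨ edgeIn (y ∷ xs) u v
edgeIn-∷ x y xs {u} {v} = sym (∨-assoc ((x == u) ∧ (y == v)) _ _)

edgeIn-first : (x y : Fin n) (xs : List (Fin n)) {u v : Fin n} → FW.edge x y u v ≡ true → edgeIn (x ∷ y ∷ xs) u v ≡ true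
edgeIn-first x y xs {u} {v} h = trans (edgeIn-∷ x y xs {u} {v}) (cong (_∨ edgeIn (y ∷ xs) u v) h)

edgeIn-later : (x : Fin n) (xs : List (Fin n)) {u v : Fin n} → edgeIn xs u v ≡ true → edgeIn (x ∷ xs) u v ≡ true
edgeIn-later x (y ∷ xs) {u} {v} h = trans (edgeIn-∷ x y xs {u} {v}) (∨-trueʳ (FW.edge x y u v) h)

edgeIn-inv : (x y : Fin n) (xs : List (Fin n)) {u v : Fin n} → edgeIn (x ∷ y ∷ xs) u v ≡ true →
  (x ≡ u × y ≡ v) ⊎ (x ≡ v × y ≡ u) ⊎ edgeIn (y ∷ xs) u v ≡ true
edgeIn-inv x y xs {u} {v} h with ∨-true {FW.edge x y u v} (trans (sym (edgeIn-∷ x y xs {u} {v})) h)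
... | inj₂ q = inj₂ (inj₂ q)
... | inj₁ q with FW.edge-sound {x = x} {y} {u} {v} q
...   | inj₁ e = inj₁ e
...   | inj₂ e = inj₂ (inj₁ e)

edgeIn-∈ : (xs : List (Fin n)) {u v : Fin n} → edgeIn xs u v ≡ true → u ∈ xs × v ∈ xs
edgeIn-∈ (x ∷ y ∷ xs) {u} {v} h = go (edgeIn-inv x y xs h) (edgeIn-∈ (y ∷ xs))
  where
  go : (x ≡ u × y ≡ v) ⊎ (x ≡ v × y ≡ u) ⊎ edgeIn (y ∷ xs) u v ≡ true →
    (edgeIn (y ∷ xs) u v ≡ true → u ∈ y ∷ xs × v ∈ y ∷ xs) → u ∈ x ∷ y ∷ xs × v ∈ x ∷ y ∷ xs
  go (inj₁ (refl , refl)) rec = here refl , there (here refl)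
  go (inj₂ (inj₁ (refl , refl))) rec = there (here refl) , here refl
  go (inj₂ (inj₂ q)) rec = there (proj₁ (rec q)) , there (proj₂ (rec q))

edgeIn-comm : ∀ (xs : List (Fin n)) u v → edgeIn xs u v ≡ edgeIn xs v u
edgeIn-comm [] u v = refl
edgeIn-comm (y ∷ []) u v = refl
edgeIn-comm (y ∷ z ∷ xs) u v = trans (edgeIn-∷ y z xs {u} {v})
  (trans (cong₂ _∨_ (FW.edge-sym y z u v) (edgeIn-comm (z ∷ xs) u v)) (sym (edgeIn-∷ y z xs {v} {u})))

edgeIn-at-head : (x y : Fin n) (xs : List (Fin n)) {u : Fin n} →
  Unique (x ∷ y ∷ xs) → edgeIn (x ∷ y ∷ xs) u x ≡ true → u ≡ y
edgeIn-at-head x y xs (p ∷ _) h with edgeIn-inv x y xs h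
... | inj₁ (refl , refl) = refl
... | inj₂ (inj₁ (_ , e)) = sym e
... | inj₂ (inj₂ q) = ⊥-elim (All.lookup p (proj₂ (edgeIn-∈ (y ∷ xs) q)) refl)

Unique-rotate : (x : Fin n) (xs : List (Fin n)) → Unique (x ∷ xs) → Unique (xs ++ [ x ])
Unique-rotate x xs u = FW.count≤1⇒Unique (xs ++ [ x ]) λ z → ≤-trans
  (≤-reflexive (trans (FW.count-++ z xs [ x ]) (trans (cong (FW.count z xs +_) (+-identityʳ _)) (+-comm (FW.count z xs) _))))
  (FW.Unique⇒count≤1 u z)

∑-count : (xs : List (Fin n)) → ∑ (λ v → FW.count v xs) ≡ length xs
∑-count {n} [] = ∑-zero {n} {λ _ → 0} (λ _ → refl)
∑-count (x ∷ xs) = trans (∑-distrib-+ (λ v → b2n (x == v)) (λ v → FW.count v xs))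
  (cong₂ _+_ (trans (∑-cong (λ v → cong b2n (==-sym x v))) (∑-count-one x)) (∑-count xs))

Unique⇒length≤ : (xs : List (Fin n)) → Unique xs → length xs ≤ n
Unique⇒length≤ {n} xs u = ≤-trans (≤-reflexive (sym (∑-count xs)))
  (≤-trans (∑-mono-≤ (FW.Unique⇒count≤1 u)) (≤-reflexive (∑-one n)))

-- Just what is needed for the two neighbours of an inner entry to be different. `Unique` would be
-- too strong, since a cycle is treated below as a list with its first vertex repeated at the end.
data SpreadOut {n : ℕ} : List (Fin n) → Set where
  []ˢ    : SpreadOut []
  [-]ˢ   : ∀ {x} → SpreadOut (x ∷ [])
  [-,-]ˢ : ∀ {x y} → SpreadOut (x ∷ y ∷ [])
  _∷ˢ_   : ∀ {x y z xs} → x ≢ z → SpreadOut (y ∷ z ∷ xs) → SpreadOut (x ∷ y ∷ z ∷ xs)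

Unique⇒SpreadOut : (xs : List (Fin n)) → Unique xs → SpreadOut xs
Unique⇒SpreadOut [] u = []ˢ
Unique⇒SpreadOut (x ∷ []) u = [-]ˢ
Unique⇒SpreadOut (x ∷ y ∷ []) u = [-,-]ˢ
Unique⇒SpreadOut (x ∷ y ∷ z ∷ xs) ((_ ∷ p ∷ _) ∷ u) = p ∷ˢ Unique⇒SpreadOut (y ∷ z ∷ xs) u

module _ (G : Graph) (simple : IsSimple G) (deg≤2 : ∀ v → deg G v ≤ 2) where

  private
    V = Fin (size G)

  Adj : V → V → Set
  Adj u v = adj G u v ≡ true

  Adj-sym : ∀ {u v} → Adj u v → Adj v u
  Adj-sym {u} {v} = trans (proj₁ simple v u)

  Adj⇒≢ : ∀ {u v} → Adj u v → u ≢ v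
  Adj⇒≢ = adj⇒≢ G simple

  adj-positive : ∀ {u v} → Adj u v → 1 ≤ b2n (adj G u v)
  adj-positive h = ≤-reflexive (sym (cong b2n h))

  positive-adj : ∀ u v → 1 ≤ b2n (adj G u v) → Adj u v
  positive-adj u v h with adj G u v
  ... | true = refl

  third-neighbour : ∀ {v a b w} → Adj v a → Adj v b → a ≢ b → Adj v w → w ≡ a ⊎ w ≡ b
  third-neighbour {v} {a} {b} {w} va vb a≢b vw with w F.≟ a | w F.≟ b
  ... | yes e | _ = inj₁ e
  ... | no _ | yes e = inj₂ e
  ... | no p | no q = ⊥-elim (1+n≰n {2} (≤-trans (three-terms≤∑ (λ u → b2n (adj G v u)) a≢b (p ∘ sym) (q ∘ sym)
    (adj-positive va) (adj-positive vb) (adj-positive vw)) (≤-trans (≤-reflexive (sym (deg-∑ G v))) (deg≤2 v))))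

  second-neighbour : ∀ {v a w} → deg G v ≤ 1 → Adj v a → Adj v w → w ≡ a
  second-neighbour {v} {a} {w} d va vw with w F.≟ a
  ... | yes e = e
  ... | no p = ⊥-elim (1+n≰n {1} (≤-trans (≤-trans (+-mono-≤ (adj-positive vw) (adj-positive va))
    (two-terms≤∑ (λ u → b2n (adj G v u)) p)) (≤-trans (≤-reflexive (sym (deg-∑ G v))) d)))

  another-neighbour : ∀ {v a} → 2 ≤ deg G v → Σ V λ w → w ≢ a × Adj v w
  another-neighbour {v} {a} d with FP.any? (λ w → ¬? (w F.≟ a) ×-dec (adj G v w ≟ᵇ true))
  ... | yes p = p
  ... | no p = ⊥-elim (1+n≰n {1} (≤-trans d (≤-trans (≤-reflexive (deg-∑ G v))
    (≤-trans (∑-mono-≤ only) (≤-reflexive (∑-count-one a))))))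
    where
    only : ∀ w → b2n (adj G v w) ≤ b2n (w == a)
    only w with w F.≟ a
    ... | yes _ = b2n≤1 _
    ... | no q with adj G v w in eq
    ...   | false = z≤n
    ...   | true = ⊥-elim (p (w , q , eq))

  neighbour : ∀ {v} → 1 ≤ deg G v → Σ V (Adj v)
  neighbour {v} d with ∑-positive (λ u → b2n (adj G v u)) (≤-trans d (≤-reflexive (deg-∑ G v)))
  ... | u , p = u , positive-adj v u p

  adj⇒deg≥1 : ∀ {v w} → Adj v w → 1 ≤ deg G v
  adj⇒deg≥1 {v} {w} h = ≤-trans (≤-trans (adj-positive h) (term≤∑ (λ u → b2n (adj G v u)) w))
    (≤-reflexive (sym (deg-∑ G v)))

  linked-edge : ∀ xs → Linked Adj xs → ∀ {u v} → edgeIn xs u v ≡ true → Adj u v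
  linked-edge (x ∷ y ∷ xs) (a ∷ l) h with edgeIn-inv x y xs h
  ... | inj₁ (refl , refl) = a
  ... | inj₂ (inj₁ (refl , refl)) = Adj-sym a
  ... | inj₂ (inj₂ q) = linked-edge (y ∷ xs) l q

  -- The entries before and after u are two different neighbours of it, and degree two leaves no
  -- room for a third.
  inner-saturated : ∀ p xs z → Linked Adj (p ∷ xs ++ [ z ]) → SpreadOut (p ∷ xs ++ [ z ]) →
    ∀ {u v} → u ∈ xs → Adj u v → edgeIn (p ∷ xs ++ [ z ]) u v ≡ true
  inner-saturated p (x ∷ []) z (a ∷ b ∷ _) (p≢z ∷ˢ _) (here refl) h with third-neighbour (Adj-sym a) b p≢z h
  ... | inj₁ refl = edgeIn-first p x [ z ] (FW.edge-flip p x)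
  ... | inj₂ refl = edgeIn-later p (x ∷ z ∷ []) (edgeIn-first x z [] (FW.edge-refl x z))
  inner-saturated p (x ∷ y ∷ xs) z (a ∷ b ∷ _) (p≢y ∷ˢ _) (here refl) h with third-neighbour (Adj-sym a) b p≢y h
  ... | inj₁ refl = edgeIn-first p x (y ∷ xs ++ [ z ]) (FW.edge-flip p x)
  ... | inj₂ refl = edgeIn-later p (x ∷ y ∷ xs ++ [ z ]) (edgeIn-first x y (xs ++ [ z ]) (FW.edge-refl x y))
  inner-saturated p (x ∷ y ∷ xs) z (_ ∷ l) (_ ∷ˢ s) (there i) h =
    edgeIn-later p (x ∷ y ∷ xs ++ [ z ]) (inner-saturated x (y ∷ xs) z l s i h)

  last-edge : ∀ x ms s → Linked Adj (x ∷ ms ++ [ s ]) → Σ V λ p → edgeIn (x ∷ ms ++ [ s ]) s p ≡ true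
  last-edge x [] s l = x , edgeIn-first x s [] (FW.edge-flip x s)
  last-edge x (y ∷ ms) s (_ ∷ l) = let p , e = last-edge y ms s l in p , edgeIn-later x (y ∷ ms ++ [ s ]) e

  closing-edge : ∀ (xs : List V) s x → edgeIn ((xs ++ [ s ]) ++ [ x ]) s x ≡ true
  closing-edge [] s x = edgeIn-first s x [] (FW.edge-refl s x)
  closing-edge (y ∷ xs) s x = edgeIn-later y ((xs ++ [ s ]) ++ [ x ]) (closing-edge xs s x)

  linked-snoc : ∀ xs s x → Linked Adj (xs ++ [ s ]) → Adj s x → Linked Adj ((xs ++ [ s ]) ++ [ x ])
  linked-snoc [] s x l a = a ∷ [-]
  linked-snoc (y ∷ []) s x (b ∷ l) a = b ∷ linked-snoc [] s x l a
  linked-snoc (y ∷ z ∷ xs) s x (b ∷ l) a = b ∷ linked-snoc (z ∷ xs) s x l a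

  Closed : List V → Set
  Closed W = ∀ {u v} → u ∈ W → Adj u v → v ∈ W

  -- Only the end x grows, so a path started at a leaf s keeps this leaf as an end. W holds the
  -- components found before; being closed under adjacency it is never entered.
  record Maximal (W : List V) (s : V) : Set where
    field
      x       : V
      ms      : List V
      linked  : Linked Adj (x ∷ ms ++ [ s ])
      unique  : Unique (x ∷ ms ++ [ s ])
      avoids  : ∀ {u} → u ∈ x ∷ ms ++ [ s ] → u ∉ W
      maximal : ∀ {w} → Adj x w → w ∈ ms ++ [ s ]

  grow : ∀ fuel {W s} → Closed W → ∀ x ms → Linked Adj (x ∷ ms ++ [ s ]) → Unique (x ∷ ms ++ [ s ]) →
    (∀ {u} → u ∈ x ∷ ms ++ [ s ] → u ∉ W) → size G < length (x ∷ ms ++ [ s ]) + fuel → Maximal W s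
  -- A path without repetition has at most `size G` vertices, so the fuel cannot run out.
  grow zero closed x ms l u av f = ⊥-elim (<⇒≱ (≤-trans f (≤-reflexive (+-identityʳ _)))
    (Unique⇒length≤ (x ∷ ms ++ [ _ ]) u))
  grow (suc fuel) {W} {s} closed x ms l u av f
    with FP.any? (λ w → (adj G x w ≟ᵇ true) ×-dec ¬? (_∈?_ F._≟_ w (x ∷ ms ++ [ s ])))
  ... | yes (w , a , new) = grow fuel closed w (x ∷ ms) (Adj-sym a ∷ l)
    (All.tabulate (λ i e → new (subst (_∈ x ∷ ms ++ [ s ]) (sym e) i)) ∷ u)
    (λ { (here refl) i → av (here refl) (closed i (Adj-sym a)) ; (there j) → av j })
    (≤-trans f (≤-reflexive (+-suc _ fuel)))
  ... | no stuck = record { x = x ; ms = ms ; linked = l ; unique = u ; avoids = av ; maximal = inside }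
    where
    inside : ∀ {w} → Adj x w → w ∈ ms ++ [ s ]
    inside {w} a with _∈?_ F._≟_ w (x ∷ ms ++ [ s ])
    ... | yes (here e) = ⊥-elim (Adj⇒≢ a (sym e))
    ... | yes (there i) = i
    ... | no new = ⊥-elim (stuck (w , a , new))

  maximal-path : ∀ {W s t} → Closed W → s ∉ W → Adj t s → Maximal W s
  maximal-path {W} {s} {t} closed s∉ a = grow (size G) closed t [] (a ∷ [-]) ((Adj⇒≢ a ∷ []) ∷ [] ∷ [])
    (λ { (here refl) i → s∉ (closed i a) ; (there (here refl)) → s∉ })
    (≤-trans (n≤1+n _) ≤-refl)

  module _ {W : List V} {s : V} (M : Maximal W s) where

    open Maximal M

    spine : List V
    spine = x ∷ ms ++ [ s ]

    spread : SpreadOut spine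
    spread = Unique⇒SpreadOut spine unique

    s∈spine : s ∈ spine
    s∈spine = ∈-++⁺ʳ (x ∷ ms) (here refl)

    s≢x : s ≢ x
    s≢x e = All.lookup (AllPairs-head unique) (∈-++⁺ʳ ms (here refl)) (sym e)
      where
      AllPairs-head : Unique spine → All (x ≢_) (ms ++ [ s ])
      AllPairs-head (p ∷ _) = p

    -- By maximality w is on the path. At an inner vertex all edges belong to the path already, so s
    -- alone can give x an edge outside it.
    head-neighbour : ∀ {w} → Adj x w → edgeIn spine x w ≡ true ⊎ w ≡ s
    head-neighbour {w} a with ∈-++⁻ ms (maximal a)
    ... | inj₁ i = inj₁ (trans (edgeIn-comm spine x w) (inner-saturated x ms s linked spread i (Adj-sym a)))
    ... | inj₂ (here e) = inj₂ e

    first-edge : Σ V λ y → edgeIn spine x y ≡ true × (∀ {u} → edgeIn spine u x ≡ true → u ≡ y)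
    first-edge = go ms unique
      where
      go : ∀ ms → Unique (x ∷ ms ++ [ s ]) → Σ V λ y → edgeIn (x ∷ ms ++ [ s ]) x y ≡ true ×
        (∀ {u} → edgeIn (x ∷ ms ++ [ s ]) u x ≡ true → u ≡ y)
      go [] u = s , edgeIn-first x s [] (FW.edge-refl x s) , edgeIn-at-head x s [] u
      go (y ∷ ms) u = y , edgeIn-first x y (ms ++ [ s ]) (FW.edge-refl x y) , edgeIn-at-head x y (ms ++ [ s ]) u

    module _ (leaf : deg G s ≤ 1) where

      leaf-saturated : ∀ {v} → Adj s v → edgeIn spine s v ≡ true
      leaf-saturated a = let p , e = last-edge x ms s linked in
        subst (λ v → edgeIn spine s v ≡ true) (sym (second-neighbour leaf (linked-edge spine linked e) a)) e

      head-saturated : ∀ {v} → Adj x v → edgeIn spine x v ≡ true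
      head-saturated a with head-neighbour a
      ... | inj₁ e = e
      -- The edge at the leaf s lies on the path, so s is its second vertex and xs its first edge.
      ... | inj₂ refl = let y , e , uniq = first-edge in
        subst (λ v → edgeIn spine x v ≡ true) (sym (uniq (leaf-saturated (Adj-sym a)))) e

      path-component : ∀ {u} → u ∈ spine → ∀ v → adj G u v ≡ edgeIn spine u v
      path-component {u} i v = same-truth (forth i) (linked-edge spine linked)
        where
        forth : ∀ {u} → u ∈ spine → Adj u v → edgeIn spine u v ≡ true
        forth (here refl) a = head-saturated a
        forth (there j) a with ∈-++⁻ ms j
        ... | inj₁ k = inner-saturated x ms s linked spread k a
        ... | inj₂ (here refl) = leaf-saturated a

      head-leaf : deg G x ≤ 1
      head-leaf with deg G x ≤? 1
      ... | yes h = h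
      ... | no h = let y , e , uniq = first-edge
                       w , w≢y , a = another-neighbour {a = y} (≰⇒> h)
                   in ⊥-elim (w≢y (uniq (trans (sym (path-component (proj₂ (edgeIn-∈ spine (head-saturated a))) x)) (Adj-sym a))))

    module _ (even-end : 2 ≤ deg G x) where

      -- A neighbour of x other than the second vertex is not joined to x along the path, which
      -- leaves only s.
      closes : Adj x s
      closes = let y , e , uniq = first-edge
                   w , w≢y , a = another-neighbour {a = y} even-end
               in [ (λ e → ⊥-elim (w≢y (uniq (trans (edgeIn-comm spine w x) e)))) , (λ e → subst (Adj x) e a) ]′
                    (head-neighbour a)

      closed-spine : List V
      closed-spine = spine ++ [ x ]

      private
        s-edge : edgeIn closed-spine s x ≡ true
        s-edge = closing-edge (x ∷ ms) s x

        long : 3 ≤ length spine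
        long = go ms refl
          where
          go : ∀ ms′ → ms′ ≡ ms → 3 ≤ length (x ∷ ms′ ++ [ s ])
          go (_ ∷ []) e = s≤s (s≤s (s≤s z≤n))
          go (_ ∷ _ ∷ _) e = s≤s (s≤s (s≤s z≤n))
          -- If s came directly after x, maximality would leave x no neighbour but s, against its
          -- degree.
          go [] refl = let w , w≢s , a = another-neighbour {a = s} even-end
                       in ⊥-elim ([ w≢s , (λ ()) ]′ (cases (maximal a)))
            where
            cases : ∀ {w} → w ∈ [ s ] → w ≡ s ⊎ ⊥
            cases (here e) = inj₁ e

        closed-linked : Linked Adj closed-spine
        closed-linked = linked-snoc (x ∷ ms) s x linked (Adj-sym closes)

        rotated : Unique ((ms ++ [ s ]) ++ [ x ])
        rotated = Unique-rotate x (ms ++ [ s ]) unique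

        -- Only the repeated x could do harm, and its two copies are at least three places apart.
        closed-spread : SpreadOut closed-spine
        closed-spread = go ms long unique rotated
          where
          go : ∀ ms → 3 ≤ length (x ∷ ms ++ [ s ]) → Unique (x ∷ ms ++ [ s ]) → Unique ((ms ++ [ s ]) ++ [ x ]) →
            SpreadOut ((x ∷ ms ++ [ s ]) ++ [ x ])
          go [] (s≤s (s≤s ())) _ _
          go (y ∷ []) _ ((_ ∷ p ∷ _) ∷ _) r = p ∷ˢ Unique⇒SpreadOut _ r
          go (y ∷ z ∷ ms) _ ((_ ∷ p ∷ _) ∷ _) r = p ∷ˢ Unique⇒SpreadOut _ r

      cycle-is-cycle : IsCycle spine
      cycle-is-cycle = unique , long

      cycle-component : ∀ {u} → u ∈ spine → ∀ v → adj G u v ≡ cycleEdge spine u v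
      cycle-component {u} i v = same-truth (forth i) (linked-edge closed-spine closed-linked)
        where
        prefix : ∀ xs {u v} → edgeIn xs u v ≡ true → edgeIn (xs ++ [ x ]) u v ≡ true
        prefix (y ∷ z ∷ xs) {u} {v} h = go (edgeIn-inv y z xs {u} {v} h) (prefix (z ∷ xs))
          where
          go : (y ≡ u × z ≡ v) ⊎ (y ≡ v × z ≡ u) ⊎ edgeIn (z ∷ xs) u v ≡ true →
            (edgeIn (z ∷ xs) u v ≡ true → edgeIn (z ∷ xs ++ [ x ]) u v ≡ true) → edgeIn (y ∷ z ∷ xs ++ [ x ]) u v ≡ true
          go (inj₁ (refl , refl)) _ = edgeIn-first y z (xs ++ [ x ]) (FW.edge-refl y z)
          go (inj₂ (inj₁ (refl , refl))) _ = edgeIn-first y z (xs ++ [ x ]) (FW.edge-flip y z)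
          go (inj₂ (inj₂ q)) rec = edgeIn-later y (z ∷ xs ++ [ x ]) (rec q)
        forth : ∀ {u} → u ∈ spine → Adj u v → edgeIn closed-spine u v ≡ true
        forth (there j) a = inner-saturated x (ms ++ [ s ]) x closed-linked closed-spread j a
        forth (here refl) a with head-neighbour a
        ... | inj₁ e = prefix spine e
        ... | inj₂ refl = trans (edgeIn-comm closed-spine x s) s-edge

-- Strands and switchings

open NW

total : (A → ℕ) → List A → ℕ
total f xs = LA.sum (map f xs)

xorOver : (A → Bool) → List A → Bool
xorOver g xs = foldr (λ x b → g x xor b) false xs

total-↭ : (f : A → ℕ) {xs ys : List A} → xs ↭ ys → total f xs ≡ total f ys
total-↭ f p = sum-↭ (Perm.map⁺ f p)

xorOver-↭ : (g : A → Bool) {xs ys : List A} → xs ↭ ys → xorOver g xs ≡ xorOver g ys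
xorOver-↭ g _↭_.refl = refl
xorOver-↭ g (_↭_.prep x p) = cong (g x xor_) (xorOver-↭ g p)
xorOver-↭ g (_↭_.swap {xs} x y p) = trans (cong (λ b → g x xor (g y xor b)) (xorOver-↭ g p))
  (solve 3 (λ a b c → a :+ (b :+ c) := b :+ (a :+ c)) refl (g x) (g y) _)
  where
  open xor-∧-Solver
xorOver-↭ g (_↭_.trans p q) = trans (xorOver-↭ g p) (xorOver-↭ g q)

∈⇒≤total : (f : A → ℕ) {x : A} {xs : List A} → x ∈ xs → f x ≤ total f xs
∈⇒≤total f (here refl) = m≤m+n _ _
∈⇒≤total f (there i) = ≤-trans (∈⇒≤total f i) (m≤n+m _ _)

⨁-delta : ∀ {k} (i : Fin k) (b : Bool) → ⨁ (λ j → (j == i) ∧ b) ≡ b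
⨁-delta {suc k} zero b = trans (cong (b xor_) (⨁-false k)) (xor-identityʳ b)
⨁-delta {suc k} (suc i) b = trans (⨁-cong (λ j → cong (_∧ b) (==-suc j i))) (⨁-delta i b)

-- Fragments of strands are recorded from the cut outwards, ending in a vertex of the graph.
record Frag : Set where
  constructor _▸_
  field
    inner : List ℕ
    tip   : ℕ
open Frag public

head : Frag → ℕ
head ([] ▸ a) = a
head ((w ∷ ws) ▸ a) = w

verts : Frag → List ℕ
verts (ws ▸ a) = ws ++ [ a ]

extend : ℕ → Frag → Frag
extend m (ws ▸ a) = (m ∷ ws) ▸ a

frag-walk : Frag → ℕ → ℕ → Bool
frag-walk f = walk (verts f)

walk-∷-verts : ∀ m f u v → walk (m ∷ verts f) u v ≡ edge m (head f) u v xor frag-walk f u v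
walk-∷-verts m ([] ▸ a) u v = refl
walk-∷-verts m ((w ∷ ws) ▸ a) u v = refl

-- A connection of two tips through new vertices, `mid` being one of them. The colours name paths
-- that contain the two edges at `mid` (see `Located`). These are the only places where the strand
-- is ever cut, so nothing is recorded about the paths of its other edges.
record Strand (k : ℕ) : Set where
  constructor strand
  field
    left   : Frag
    mid    : ℕ
    right  : Frag
    colour colour′ : Fin k
open Strand public

strand-walk : Strand k → ℕ → ℕ → Bool
strand-walk s u v = walk (mid s ∷ verts (left s)) u v xor walk (mid s ∷ verts (right s)) u v

inner-count : Strand k → ℕ → ℕ
inner-count s z = count z (inner (left s)) + (b2n (mid s ≐ z) + count z (inner (right s)))

tip-count : ℕ → Strand k → ℕ
tip-count z s = b2n (tip (left s) ≐ z) + b2n (tip (right s) ≐ z)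

Located : (Fin k → List ℕ) → Strand k → Set
Located P s = walk (P (colour s)) (mid s) (head (left s)) ≡ true
            × walk (P (colour′ s)) (mid s) (head (right s)) ≡ true

-- The fragments are what remains of s when the edge between their heads, an edge of path c, is
-- removed. The old `mid` becomes an inner vertex of one of them.
record Cut (s : Strand k) (c : Fin k) (f g : Frag) : Set where
  field
    cut-walk  : ∀ u v → strand-walk s u v ≡ edge (head f) (head g) u v xor (frag-walk f u v xor frag-walk g u v)
    cut-count : ∀ z → inner-count s z ≡ count z (inner f) + count z (inner g)
    cut-located : ∀ P → Located P s → walk (P c) (head f) (head g) ≡ true
open Cut public

Cut-sym : ∀ {s : Strand k} {c f g} → Cut s c f g → Cut s c g f
Cut-sym {f = f} {g} C = record
  { cut-walk = λ u v → trans (cut-walk C u v)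
      (cong₂ _xor_ (edge-comm (head f) (head g) u v) (xor-comm (frag-walk f u v) _))
  ; cut-count = λ z → trans (cut-count C z) (+-comm (count z (inner f)) _)
  ; cut-located = λ P l → trans (walk-sym (P _) (head g) (head f)) (cut-located C P l)
  }

flip : Strand k → Strand k
flip (strand l m r c d) = strand r m l d c

cut-left : ∀ (s : Strand k) → Cut s (colour s) (left s) (extend (mid s) (right s))
cut-left (strand l m r c d) = record
  { cut-walk = λ u v → trans (cong₂ _xor_ (trans (walk-∷-verts m l u v)
        (cong (_xor frag-walk l u v) (edge-comm m (head l) u v))) refl)
      (xor-assoc (edge (head l) m u v) _ _)
  ; cut-count = λ z → refl
  ; cut-located = λ P p → trans (walk-sym (P c) (head l) m) (proj₁ p)
  }

cut-flip : ∀ {s : Strand k} {c f g} → Cut (flip s) c f g → Cut s c f g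
cut-flip {s = strand l m r c d} C = record
  { cut-walk = λ u v → trans (xor-comm (walk (m ∷ verts l) u v) _) (cut-walk C u v)
  ; cut-count = λ z → trans
      (solve 3 (λ a b c → a :+ (b :+ c) := c :+ (b :+ a)) refl (count z (inner l)) (b2n (m ≐ z)) (count z (inner r)))
      (cut-count C z)
  ; cut-located = λ P (p , q) → cut-located C P (q , p)
  }
  where
  open +-*-Solver

cut-right : ∀ (s : Strand k) → Cut s (colour′ s) (right s) (extend (mid s) (left s))
cut-right s = cut-flip (cut-left (flip s))

-- The change made to a path when its edge pq is rerouted as p x y q.
detour : ℕ → ℕ → ℕ → ℕ → ℕ → ℕ → Bool
detour p q x y u v = edge p q u v xor (edge x p u v xor (edge x y u v xor edge y q u v))

-- The first occurrence of pq is rerouted. If the list traverses it from q to p, then y is inserted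
-- before x, so that x is next to p in either case.
splice : ∀ a xs {p q} x y → walk (a ∷ xs) p q ≡ true → Σ (List ℕ) λ xs′ →
  (∀ z → count z (a ∷ xs′) ≡ b2n (x ≐ z) + (b2n (y ≐ z) + count z (a ∷ xs))) ×
  (∀ u v → walk (a ∷ xs′) u v ≡ walk (a ∷ xs) u v xor detour p q x y u v)
splice a (b ∷ xs) {p} {q} x y h with edge a b p q in eq
... | true with edge-sound {a} {b} eq
...   | inj₁ (refl , refl) = x ∷ y ∷ b ∷ xs
  , (λ z → N.solve 4 (λ α β γ δ → α N.:+ (β N.:+ (γ N.:+ δ)) N.:= β N.:+ (γ N.:+ (α N.:+ δ))) refl
      (b2n (a ≐ z)) (b2n (x ≐ z)) (b2n (y ≐ z)) (count z (b ∷ xs)))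
  , (λ u v → trans (cong (_xor _) (edge-comm a x u v))
      (solve 5 (λ α β γ δ w → β :+ (γ :+ (δ :+ w)) := (α :+ w) :+ (α :+ (β :+ (γ :+ δ)))) refl
        (edge a b u v) (edge x a u v) (edge x y u v) (edge y b u v) (walk (b ∷ xs) u v)))
  where
  module N = +-*-Solver
  open xor-∧-Solver
...   | inj₂ (refl , refl) = y ∷ x ∷ b ∷ xs
  , (λ z → N.solve 4 (λ α β γ δ → α N.:+ (γ N.:+ (β N.:+ δ)) N.:= β N.:+ (γ N.:+ (α N.:+ δ))) refl
      (b2n (a ≐ z)) (b2n (x ≐ z)) (b2n (y ≐ z)) (count z (b ∷ xs)))
  , (λ u v → trans (cong₂ _xor_ (edge-comm a y u v) (cong (_xor _) (edge-comm y x u v)))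
      (trans (solve 5 (λ α β γ δ w → δ :+ (γ :+ (β :+ w)) := (α :+ w) :+ (α :+ (β :+ (γ :+ δ)))) refl
        (edge a b u v) (edge x b u v) (edge x y u v) (edge y a u v) (walk (b ∷ xs) u v))
        (cong (λ e → walk (a ∷ b ∷ xs) u v xor (e xor (edge x b u v xor (edge x y u v xor edge y a u v))))
          (edge-comm a b u v))))
  where
  module N = +-*-Solver
  open xor-∧-Solver
splice a (b ∷ xs) {p} {q} x y h | false with splice b xs x y h
... | xs′ , c , w = b ∷ xs′
  , (λ z → trans (cong (b2n (a ≐ z) +_) (c z))
      (N.solve 4 (λ α β γ δ → α N.:+ (β N.:+ (γ N.:+ δ)) N.:= β N.:+ (γ N.:+ (α N.:+ δ))) refl
      (b2n (a ≐ z)) (b2n (x ≐ z)) (b2n (y ≐ z)) (count z (b ∷ xs))))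
  , (λ u v → trans (cong (edge a b u v xor_) (w u v)) (sym (xor-assoc (edge a b u v) _ _)))
  where
  module N = +-*-Solver

set : (Fin k → A) → Fin k → A → Fin k → A
set P i Q j = if j == i then Q else P j

set-same : (P : Fin k → A) (i : Fin k) (Q : A) → set P i Q i ≡ Q
set-same P i Q rewrite ==-refl i = refl

set-other : (P : Fin k → A) {i j : Fin k} (Q : A) → j ≢ i → set P i Q j ≡ P j
set-other P Q h rewrite ==-≢ h = refl

⨁-set : (P : Fin k → List ℕ) (i : Fin k) (Q : List ℕ) (δ : ℕ → ℕ → Bool) →
  (∀ u v → walk Q u v ≡ walk (P i) u v xor δ u v) →
  ∀ u v → ⨁ (λ j → walk (set P i Q j) u v) ≡ ⨁ (λ j → walk (P j) u v) xor δ u v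
⨁-set P i Q δ h u v = trans (⨁-cong pointwise)
  (trans (⨁-distrib-xor (λ j → walk (P j) u v) (λ j → (j == i) ∧ δ u v))
    (cong (⨁ (λ j → walk (P j) u v) xor_) (⨁-delta i (δ u v))))
  where
  pointwise : ∀ j → walk (set P i Q j) u v ≡ walk (P j) u v xor ((j == i) ∧ δ u v)
  pointwise j with j F.≟ i
  ... | yes refl = h u v
  ... | no _ = sym (xor-identityʳ _)

isVertex : ℕ → ℕ → ℕ
isVertex n z = b2n (does (z <? n))

occupancy : ℕ → List (Strand k) → ℕ → ℕ
occupancy n ss z = isVertex n z + total (λ s → inner-count s z) ss

occupancy-↭ : ∀ n {ss ss′ : List (Strand k)} → ss ↭ ss′ → ∀ z → occupancy n ss z ≡ occupancy n ss′ z
occupancy-↭ n p z = cong (isVertex n z +_) (total-↭ (λ s → inner-count s z) p)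

-- The numbers below n are the vertices of the graph, all others are available as new vertices.
-- An occupancy of at most one makes the inner vertices of all strands new and distinct.
record Layout (n : ℕ) (ss : List (Strand k)) : Set where
  field
    path    : Fin k → List ℕ
    bound   : ℕ
    fresh   : ∀ z → bound ≤ z → occupancy n ss z ≡ 0
    simple  : ∀ z → occupancy n ss z ≤ 1
    inside  : ∀ i z → count z (path i) ≤ occupancy n ss z
    covers  : ∀ u v → ⨁ (λ i → walk (path i) u v) ≡ xorOver (λ s → strand-walk s u v) ss
    located : All (Located path) ss
    tips    : All (λ s → tip (left s) < n × tip (right s) < n) ss

module _ {n : ℕ} where

  Layout-↭ : {ss ss′ : List (Strand k)} → ss ↭ ss′ → Layout n ss → Layout n ss′
  Layout-↭ p S = record
    { path = path
    ; bound = bound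
    ; fresh = λ z h → trans (sym (occupancy-↭ n p z)) (fresh z h)
    ; simple = λ z → subst (_≤ 1) (occupancy-↭ n p z) (simple z)
    ; inside = λ i z → subst (count z (path i) ≤_) (occupancy-↭ n p z) (inside i z)
    ; covers = λ u v → trans (covers u v) (xorOver-↭ (λ s → strand-walk s u v) p)
    ; located = All-resp-↭ p located
    ; tips = All-resp-↭ p tips
    }
    where
    open Layout S

  isVertex-< : ∀ {z} → z < n → isVertex n z ≡ 1
  isVertex-< {z} h = cong b2n (dec-true (z <? n) h)

  isVertex-≥ : ∀ {z} → n ≤ z → isVertex n z ≡ 0
  isVertex-≥ {z} h = cong b2n (dec-false (z <? n) (≤⇒≯ h))

  head-occupied : ∀ f → tip f < n → 1 ≤ isVertex n (head f) + count (head f) (inner f)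
  head-occupied ([] ▸ a) h = ≤-trans (≤-reflexive (sym (isVertex-< h))) (m≤m+n _ _)
  head-occupied ((w ∷ ws) ▸ a) h = ≤-trans (count-here w ws) (m≤n+m _ (isVertex n w))

  mid-occupied : (s : Strand k) → 1 ≤ inner-count s (mid s)
  mid-occupied (strand l m r _ _) = ≤-trans (≤-reflexive (sym (count-self m)))
    (≤-trans (m≤m+n _ _) (m≤n+m _ (count m (inner l))))

  detour-off : ∀ {p q x y m} h → m ≢ p → m ≢ q → m ≢ x → m ≢ y → detour p q x y m h ≡ false
  detour-off {p} {q} {x} {y} h mp mq mx my = cong₂ _xor_ (off p q mp mq)
    (cong₂ _xor_ (off x p mx mp) (cong₂ _xor_ (off x y mx my) (off y q my mq)))
    where
    off : ∀ a b {m h} → m ≢ a → m ≢ b → edge a b m h ≡ false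
    off a b p q = edge-false λ { (inj₁ (r , _)) → p (sym r) ; (inj₂ (_ , r)) → q (sym r) }

  detour-x : ∀ {p q x y} → x ≢ p → x ≢ q → x ≢ y → y ≢ p → detour p q x y x p ≡ true
  detour-x {p} {q} {x} {y} xp xq xy yp
    rewrite edge-false {p} {q} {x} {p} (λ { (inj₁ (r , _)) → xp (sym r) ; (inj₂ (_ , r)) → xq (sym r) })
          | edge-refl x p
          | edge-off′ {y} {x} {p} x (xy ∘ sym) yp
          | edge-off {y} {x} {p} q (xy ∘ sym) yp = refl

  detour-y : ∀ {p q x y} → x ≢ q → x ≢ y → y ≢ p → y ≢ q → detour p q x y y q ≡ true
  detour-y {p} {q} {x} {y} xq xy yp yq
    rewrite edge-false {p} {q} {y} {q} (λ { (inj₁ (r , _)) → yp (sym r) ; (inj₂ (_ , r)) → yq (sym r) })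
          | edge-off {x} {y} {q} p xy xq
          | edge-off {x} {y} {q} y xy xq
          | edge-refl y q = refl

  walk-on : ∀ P {u v} → walk P u v ≡ true → 1 ≤ count u P
  walk-on P {u} {v} h with count u P in eq
  ... | suc _ = s≤s z≤n
  ... | zero with () ← trans (sym h) (walk-off v P eq)

  -- Two strands, cut at edges of different paths, exchange their halves: rerouting
  -- pq as p x y q and rs as r x y s makes xy cancel, which leaves p x r and q y s.
  rewire : ∀ {A B : Strand k} {ss c d f f′ g g′} → Layout n (A ∷ B ∷ ss) →
    Cut A c f f′ → Cut B d g g′ → c ≢ d →
    tip f < n × tip f′ < n → tip g < n × tip g′ < n →
    Σ ℕ λ x → Σ ℕ λ y → Layout n (strand f x g c d ∷ strand f′ y g′ c d ∷ ss)
  rewire {A = A} {B} {ss} {c} {d} {f} {f′} {g} {g′} S CA CB c≢d (tf , tf′) (tg , tg′) = x , y , record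
    { path = path″
    ; bound = 2 + bound
    ; fresh = fresh′
    ; simple = simple′
    ; inside = inside′
    ; covers = covers′
    ; located = (loc-xf , loc-xg) ∷ (loc-yf , loc-yg) ∷ All.tabulate others
    ; tips = (tf , tg) ∷ (tf′ , tg′) ∷ All.tail (All.tail tips)
    }
    where
    open Layout S
    x y p q r s : ℕ
    x = bound
    y = suc bound
    p = head f
    q = head f′
    r = head g
    s = head g′
    pq : walk (path c) p q ≡ true
    pq = cut-located CA path (All.head located)
    rs : walk (path d) r s ≡ true
    rs = cut-located CB path (All.head (All.tail located))

    spliced : ∀ P {p q} → walk P p q ≡ true → Σ (List ℕ) λ P′ →
      (∀ z → count z P′ ≡ b2n (x ≐ z) + (b2n (y ≐ z) + count z P)) ×
      (∀ u v → walk P′ u v ≡ walk P u v xor detour p q x y u v)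
    spliced (a ∷ P) h with splice a P x y h
    ... | P′ , rest = a ∷ P′ , rest

    Pc Pd : List ℕ
    Pc = proj₁ (spliced (path c) pq)
    Pd = proj₁ (spliced (path d) rs)
    path′ path″ : Fin _ → List ℕ
    path′ = set path c Pc
    path″ = set path′ d Pd

    path″-c : path″ c ≡ Pc
    path″-c = trans (set-other path′ Pd c≢d) (set-same path c Pc)
    path″-d : path″ d ≡ Pd
    path″-d = set-same path′ d Pd

    x≢y : x ≢ y
    x≢y e = 1+n≢n (sym e)

    freshʳ : ∀ {z w} → bound ≤ w → 1 ≤ occupancy n (A ∷ B ∷ ss) z → z ≢ w
    freshʳ h o refl = 1+n≰n (≤-trans o (≤-reflexive (fresh _ h)))

    occ-path : ∀ {i u v} → walk (path i) u v ≡ true → 1 ≤ occupancy n (A ∷ B ∷ ss) u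
    occ-path {i} h = ≤-trans (walk-on (path i) h) (inside i _)

    occ-p = occ-path pq
    occ-q = occ-path {u = q} {p} (trans (walk-sym (path c) q p) pq)
    occ-r = occ-path rs
    occ-s = occ-path {u = s} {r} (trans (walk-sym (path d) s r) rs)

    x≢ : ∀ {z} → 1 ≤ occupancy n (A ∷ B ∷ ss) z → x ≢ z
    x≢ o e = freshʳ ≤-refl o (sym e)
    y≢ : ∀ {z} → 1 ≤ occupancy n (A ∷ B ∷ ss) z → y ≢ z
    y≢ o e = freshʳ (n≤1+n bound) o (sym e)

    off-path : ∀ i {w} v → bound ≤ w → walk (path i) w v ≡ false
    off-path i {w} v h = walk-off v (path i) (n≤0⇒n≡0 (≤-trans (inside i w) (≤-reflexive (fresh w h))))

    loc-xf : walk (path″ c) x p ≡ true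
    loc-xf rewrite path″-c = trans (proj₂ (proj₂ (spliced (path c) pq)) x p)
      (cong₂ _xor_ (off-path c p ≤-refl) (detour-x (x≢ occ-p) (x≢ occ-q) x≢y (y≢ occ-p)))
    loc-yf : walk (path″ c) y q ≡ true
    loc-yf rewrite path″-c = trans (proj₂ (proj₂ (spliced (path c) pq)) y q)
      (cong₂ _xor_ (off-path c q (n≤1+n bound)) (detour-y (x≢ occ-q) x≢y (y≢ occ-p) (y≢ occ-q)))
    loc-xg : walk (path″ d) x r ≡ true
    loc-xg rewrite path″-d = trans (proj₂ (proj₂ (spliced (path d) rs)) x r)
      (cong₂ _xor_ (off-path d r ≤-refl) (detour-x (x≢ occ-r) (x≢ occ-s) x≢y (y≢ occ-r)))
    loc-yg : walk (path″ d) y s ≡ true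
    loc-yg rewrite path″-d = trans (proj₂ (proj₂ (spliced (path d) rs)) y s)
      (cong₂ _xor_ (off-path d s (n≤1+n bound)) (detour-y (x≢ occ-s) x≢y (y≢ occ-r) (y≢ occ-s)))

    -- The two recorded edges of a strand C not involved contain its mid μ, while each edge that a
    -- detour adds or removes has both ends among the heads of the four fragments and x, y.
    others : ∀ {C} → C ∈ ss → Located path″ C
    others {C} C∈ = kept (colour C) (head (left C)) (proj₁ locC) , kept (colour′ C) (head (right C)) (proj₂ locC)
      where
      locC = All.lookup located (there (there C∈))
      μ = mid C
      occ-μ : 1 ≤ total (λ t → inner-count t μ) ss
      occ-μ = ≤-trans (mid-occupied C) (∈⇒≤total (λ t → inner-count t μ) C∈)
      occ-μ′ : 1 ≤ occupancy n (A ∷ B ∷ ss) μ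
      occ-μ′ = ≤-trans occ-μ (≤-trans (m≤n+m _ (inner-count B μ))
        (≤-trans (m≤n+m _ (inner-count A μ)) (m≤n+m _ (isVertex n μ))))
      -- If μ were the head of h, that number would be occupied twice: by C, and as a vertex of the
      -- graph or an inner vertex of A or B.
      apart : ∀ h → tip h < n → (∀ z → count z (inner h) ≤ inner-count A z + inner-count B z) → μ ≢ head h
      apart h th le e = 1+n≰n {1} (≤-trans (+-mono-≤ (≤-trans (head-occupied h th)
          (+-monoʳ-≤ (isVertex n (head h)) (le (head h))))
          (subst (λ z → 1 ≤ total (λ t → inner-count t z) ss) e occ-μ))
        (≤-trans (≤-reflexive (solve 4 (λ v a b t → v :+ (a :+ b) :+ t := v :+ (a :+ (b :+ t))) refl
            (isVertex n (head h)) (inner-count A (head h)) (inner-count B (head h)) _))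
          (simple (head h))))
        where
        open +-*-Solver
      fromA : ∀ {h h′ c} → Cut A c h h′ → ∀ z → count z (inner h) ≤ inner-count A z + inner-count B z
      fromA C z = ≤-trans (m≤m+n _ _) (≤-trans (≤-reflexive (sym (cut-count C z))) (m≤m+n _ _))
      fromB : ∀ {h h′ c} → Cut B c h h′ → ∀ z → count z (inner h) ≤ inner-count A z + inner-count B z
      fromB C z = ≤-trans (m≤m+n _ _) (≤-trans (≤-reflexive (sym (cut-count C z))) (m≤n+m _ (inner-count A z)))
      μ≢x : μ ≢ x
      μ≢x = freshʳ ≤-refl occ-μ′
      μ≢y : μ ≢ y
      μ≢y = freshʳ (n≤1+n bound) occ-μ′
      kept : ∀ i h → walk (path i) μ h ≡ true → walk (path″ i) μ h ≡ true
      kept i h w with i F.≟ d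
      ... | yes refl = trans (proj₂ (proj₂ (spliced (path d) rs)) μ h)
        (cong₂ _xor_ w (detour-off h (apart g tg (fromB CB)) (apart g′ tg′ (fromB (Cut-sym CB))) μ≢x μ≢y))
      ... | no _ with i F.≟ c
      ...   | yes refl = trans (proj₂ (proj₂ (spliced (path c) pq)) μ h)
        (cong₂ _xor_ w (detour-off h (apart f tf (fromA CA)) (apart f′ tf′ (fromA (Cut-sym CA))) μ≢x μ≢y))
      ...   | no _ = w

    ss′ : List (Strand _)
    ss′ = strand f x g c d ∷ strand f′ y g′ c d ∷ ss

    occupancy′ : ∀ z → occupancy n ss′ z ≡ b2n (x ≐ z) + (b2n (y ≐ z) + occupancy n (A ∷ B ∷ ss) z)
    occupancy′ z = trans (solve 8 (λ v a b a′ b′ X Y t →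
        v :+ ((a :+ (X :+ b)) :+ ((a′ :+ (Y :+ b′)) :+ t)) := X :+ (Y :+ (v :+ ((a :+ a′) :+ ((b :+ b′) :+ t))))) refl
        (isVertex n z) (count z (inner f)) (count z (inner g)) (count z (inner f′)) (count z (inner g′))
        (b2n (x ≐ z)) (b2n (y ≐ z)) rest)
      (cong₂ (λ a b → b2n (x ≐ z) + (b2n (y ≐ z) + (isVertex n z + (a + (b + rest)))))
        (sym (cut-count CA z)) (sym (cut-count CB z)))
      where
      open +-*-Solver
      rest = total (λ t → inner-count t z) ss

    fresh′ : ∀ z → 2 + bound ≤ z → occupancy n ss′ z ≡ 0
    fresh′ z h = trans (occupancy′ z) (cong₂ _+_ (cong b2n (≐-≢ (<⇒≢ (≤-trans (n≤1+n _) h))))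
      (cong₂ _+_ (cong b2n (≐-≢ (<⇒≢ h))) (fresh z (≤-trans (≤-trans (n≤1+n _) (n≤1+n _)) h))))

    simple′ : ∀ z → occupancy n ss′ z ≤ 1
    simple′ z with x ≟ z | y ≟ z
    ... | yes refl | _ = ≤-reflexive (trans (occupancy′ x)
      (cong₂ _+_ (count-self x) (cong₂ _+_ (cong b2n (≐-≢ {y} {x} (x≢y ∘ sym))) (fresh x ≤-refl))))
    ... | no h | yes refl = ≤-reflexive (trans (occupancy′ y)
      (cong₂ _+_ (cong b2n (≐-≢ h)) (cong₂ _+_ (count-self y) (fresh y (n≤1+n bound)))))
    ... | no h | no h′ = ≤-trans (≤-reflexive (trans (occupancy′ z)
      (cong₂ _+_ (cong b2n (≐-≢ h)) (cong (_+ _) (cong b2n (≐-≢ h′)))))) (simple z)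

    inside′ : ∀ i z → count z (path″ i) ≤ occupancy n ss′ z
    inside′ i z rewrite occupancy′ z with i F.≟ d
    ... | yes refl = ≤-trans (≤-reflexive (proj₁ (proj₂ (spliced (path d) rs)) z))
      (+-monoʳ-≤ (b2n (x ≐ z)) (+-monoʳ-≤ (b2n (y ≐ z)) (inside d z)))
    ... | no _ with i F.≟ c
    ...   | yes refl = ≤-trans (≤-reflexive (proj₁ (proj₂ (spliced (path c) pq)) z))
      (+-monoʳ-≤ (b2n (x ≐ z)) (+-monoʳ-≤ (b2n (y ≐ z)) (inside c z)))
    ...   | no _ = ≤-trans (inside i z) (≤-trans (m≤n+m _ (b2n (y ≐ z))) (m≤n+m _ (b2n (x ≐ z))))

    covers′ : ∀ u v → ⨁ (λ i → walk (path″ i) u v) ≡ xorOver (λ t → strand-walk t u v) ss′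
    covers′ u v = begin
      ⨁ (λ i → walk (path″ i) u v)
        ≡⟨ ⨁-set path′ d Pd (detour r s x y) (λ u v → trans (proj₂ (proj₂ (spliced (path d) rs)) u v)
             (cong (λ l → walk l u v xor detour r s x y u v) (sym (set-other path Pc (c≢d ∘ sym))))) u v ⟩
      ⨁ (λ i → walk (path′ i) u v) xor detour r s x y u v
        ≡⟨ cong (_xor detour r s x y u v) (⨁-set path c Pc (detour p q x y) (proj₂ (proj₂ (spliced (path c) pq))) u v) ⟩
      (⨁ (λ i → walk (path i) u v) xor detour p q x y u v) xor detour r s x y u v
        ≡⟨ cong (λ b → (b xor detour p q x y u v) xor detour r s x y u v)
             (trans (covers u v) (cong₂ (λ a b → a xor (b xor R)) (cut-walk CA u v) (cut-walk CB u v))) ⟩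
      (((edge p q u v xor (wf xor wf′)) xor ((edge r s u v xor (wg xor wg′)) xor R))
        xor detour p q x y u v) xor detour r s x y u v
        ≡⟨ solve 12 (λ PQ RS XY XP YQ XR YS WF WF′ WG WG′ R →
             (((PQ :+ (WF :+ WF′)) :+ ((RS :+ (WG :+ WG′)) :+ R)) :+ (PQ :+ (XP :+ (XY :+ YQ)))) :+ (RS :+ (XR :+ (XY :+ YS)))
             := ((XP :+ WF) :+ (XR :+ WG)) :+ (((YQ :+ WF′) :+ (YS :+ WG′)) :+ R)) refl
             (edge p q u v) (edge r s u v) (edge x y u v) (edge x p u v) (edge y q u v) (edge x r u v) (edge y s u v)
             wf wf′ wg wg′ R ⟩
      ((edge x p u v xor wf) xor (edge x r u v xor wg)) xor
        (((edge y q u v xor wf′) xor (edge y s u v xor wg′)) xor R)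
        ≡⟨ cong₂ (λ a b → a xor (b xor R)) (cong₂ _xor_ (walk-∷-verts x f u v) (walk-∷-verts x g u v))
             (cong₂ _xor_ (walk-∷-verts y f′ u v) (walk-∷-verts y g′ u v)) ⟨
      xorOver (λ t → strand-walk t u v) ss′ ∎
      where
      open ≡-Reasoning
      open xor-∧-Solver
      R = xorOver (λ t → strand-walk t u v) ss
      wf = frag-walk f u v
      wf′ = frag-walk f′ u v
      wg = frag-walk g u v
      wg′ = frag-walk g′ u v

-- Switching until the connections are the prescribed edges

∈⇒↭∷ : {x : A} {xs : List A} → x ∈ xs → Σ (List A) λ ys → xs ↭ x ∷ ys
∈⇒↭∷ {xs = _ ∷ xs} (here refl) = xs , ↭-refl
∈⇒↭∷ {xs = y ∷ _} (there i) with ∈⇒↭∷ i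
... | ys , p = y ∷ ys , ↭-trans (↭-prep y p) (↭-swap y _ ↭-refl)

total-positive : (f : A → ℕ) (xs : List A) → 1 ≤ total f xs →
  Σ A λ x → Σ (List A) λ ys → 1 ≤ f x × xs ↭ x ∷ ys
total-positive f (x ∷ xs) h with f x in eq
... | suc _ = x , xs , subst (1 ≤_) (sym eq) (s≤s z≤n) , ↭-refl
... | zero with total-positive f xs h
...   | y , ys , p , π = y , x ∷ ys , p , ↭-trans (↭-prep x π) (↭-swap x y ↭-refl)

Bicoloured : Strand k → Set
Bicoloured s = colour s ≢ colour′ s

ends : Strand k → ℕ × ℕ
ends s = tip (left s) , tip (right s)

Ends : Strand k → ℕ → ℕ → Set
Ends s u w = ends s ≡ (u , w) ⊎ ends s ≡ (w , u)

ends-count : ℕ → ℕ × ℕ → ℕ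
ends-count z (u , v) = b2n (u ≐ z) + b2n (v ≐ z)

Ends-count : (s : Strand k) {u w : ℕ} → Ends s u w → ∀ z → tip-count z s ≡ ends-count z (u , w)
Ends-count s (inj₁ refl) z = refl
Ends-count s (inj₂ refl) z = +-comm (b2n (tip (left s) ≐ z)) _

tip-count-positive : (s : Strand k) (u : ℕ) → 1 ≤ tip-count u s → Σ ℕ (Ends s u)
tip-count-positive s u h with tip (left s) ≟ u
... | yes refl = tip (right s) , inj₁ refl
... | no p with tip (right s) ≟ u
...   | yes refl = tip (left s) , inj₂ refl
...   | no q with () ← subst₂ (λ a b → 1 ≤ b2n a + b2n b) (≐-≢ p) (≐-≢ q) h

HasColour : Strand k → Fin k → Set
HasColour s c = c ≡ colour s ⊎ c ≡ colour′ s

-- The halves may be named in either order, whichever of the two edges at `mid` is cut. This freedom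
-- lets a switching join any tip of one strand to any tip of the other.
cut-at : (s : Strand k) {c : Fin k} → HasColour s c → ∀ {u w} → Ends s u w →
  Σ Frag λ f → Σ Frag λ g → Cut s c f g × tip f ≡ u × tip g ≡ w
cut-at s (inj₁ refl) (inj₁ refl) = _ , _ , cut-left s , refl , refl
cut-at s (inj₁ refl) (inj₂ refl) = _ , _ , Cut-sym (cut-left s) , refl , refl
cut-at s (inj₂ refl) (inj₁ refl) = _ , _ , Cut-sym (cut-right s) , refl , refl
cut-at s (inj₂ refl) (inj₂ refl) = _ , _ , cut-right s , refl , refl

Contrasting : Strand k → Strand k → Set
Contrasting A B = Σ _ λ c → Σ _ λ d → HasColour A c × HasColour B d × c ≢ d

-- Of two different colours at least one differs from `colour B`. A single bicoloured strand can
-- therefore be switched with any other strand.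
bicoloured-contrast : (A B : Strand k) → Bicoloured A → Contrasting A B
bicoloured-contrast A B h with colour A F.≟ colour B
... | no p = colour A , colour B , inj₁ refl , inj₁ refl , p
... | yes p = colour′ A , colour B , inj₂ refl , inj₁ refl , λ q → h (trans p (sym q))

module _ {n : ℕ} where

  flip-first : {A : Strand k} {ss : List (Strand k)} → Layout n (A ∷ ss) → Layout n (flip A ∷ ss)
  flip-first {A = A} {ss} S = record
    { path = path
    ; bound = bound
    ; fresh = λ z h → trans (occ z) (fresh z h)
    ; simple = λ z → subst (_≤ 1) (sym (occ z)) (simple z)
    ; inside = λ i z → subst (count z (path i) ≤_) (sym (occ z)) (inside i z)
    ; covers = λ u v → trans (covers u v) (cong (_xor _) (xor-comm (walk (mid A ∷ verts (left A)) u v) _))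
    ; located = (proj₂ (All.head located) , proj₁ (All.head located)) ∷ All.tail located
    ; tips = (proj₂ (All.head tips) , proj₁ (All.head tips)) ∷ All.tail tips
    }
    where
    open Layout S
    open +-*-Solver
    occ : ∀ z → occupancy n (flip A ∷ ss) z ≡ occupancy n (A ∷ ss) z
    occ z = cong (λ c → isVertex n z + (c + total (λ s → inner-count s z) ss))
      (solve 3 (λ a b c → a :+ (b :+ c) := c :+ (b :+ a)) refl
        (count z (inner (right A))) (b2n (mid A ≐ z)) (count z (inner (left A))))

  tips-of : ∀ (s : Strand k) {u w} → Ends s u w → tip (left s) < n × tip (right s) < n → u < n × w < n
  tips-of s (inj₁ refl) h = h
  tips-of s (inj₂ refl) (p , q) = q , p

  Joined : List (Strand k) → (ℕ × ℕ) → (ℕ × ℕ) → Set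
  Joined {k} ss e e′ = Σ (Strand k) λ C → Σ (Strand k) λ D → Layout n (C ∷ D ∷ ss) ×
    Bicoloured C × Bicoloured D × ends C ≡ e × ends D ≡ e′

  join : ∀ {A B : Strand k} {ss} → Layout n (A ∷ B ∷ ss) → Contrasting A B →
    ∀ {u u′ v v′} → Ends A u u′ → Ends B v v′ → Joined ss (u , v) (u′ , v′)
  join {A = A} {B} {ss} S (c , d , hc , hd , c≢d) {u} {u′} {v} {v′} eA eB =
    glue (cut-at A hc eA) (cut-at B hd eB)
    where
    glue : (Σ Frag λ f → Σ Frag λ g → Cut A c f g × tip f ≡ u × tip g ≡ u′) →
           (Σ Frag λ f → Σ Frag λ g → Cut B d f g × tip f ≡ v × tip g ≡ v′) →
           Joined ss (u , v) (u′ , v′)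
    glue (f , f′ , CA , refl , refl) (g , g′ , CB , refl , refl) =
      let x , y , S′ = rewire S CA CB c≢d (tips-of A eA (All.head tips)) (tips-of B eB (All.head (All.tail tips)))
      in strand f x g c d , strand f′ y g′ c d , S′ , c≢d , c≢d , refl , refl
      where
      open Layout S

  Bicolouring : List (Strand k) → Set
  Bicolouring {k} ss = Σ (List (Strand k)) λ ss′ → Layout n ss′ × All Bicoloured ss′ ×
      (∀ z → total (tip-count z) ss′ ≡ total (tip-count z) ss)

  join-count : ∀ {A B C D : Strand k} {u u′ v v′} → Ends A u u′ → Ends B v v′ →
    ends C ≡ (u , v) → ends D ≡ (u′ , v′) →
    ∀ z → tip-count z C + tip-count z D ≡ tip-count z A + tip-count z B
  join-count {A = A} {B} {C} {D} {u} {u′} {v} {v′} eA eB eC eD z = trans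
    (cong₂ _+_ (Ends-count C (inj₁ eC) z) (Ends-count D (inj₁ eD) z))
    (trans (solve 4 (λ a b c d → (a :+ b) :+ (c :+ d) := (a :+ c) :+ (b :+ d)) refl
        (b2n (u ≐ z)) (b2n (v ≐ z)) (b2n (u′ ≐ z)) (b2n (v′ ≐ z)))
      (sym (cong₂ _+_ (Ends-count A eA z) (Ends-count B eB z))))
    where
    open +-*-Solver

  bicolour-all : ∀ (D : Strand k) todo ported → Bicoloured D → All Bicoloured ported →
    Layout n (D ∷ todo ++ ported) → Bicolouring (D ∷ todo ++ ported)
  bicolour-all D [] ported bD bp S = D ∷ ported , S , bD ∷ bp , λ z → refl
  bicolour-all D (A ∷ todo) ported bD bp S =
    continue (join S (bicoloured-contrast D A bD) (inj₁ refl) (inj₁ refl))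
    where
    continue : Joined (todo ++ ported) (tip (left D) , tip (left A)) (tip (right D) , tip (right A)) →
      Bicolouring (D ∷ A ∷ todo ++ ported)
    continue (D′ , A′ , S′ , bD′ , bA′ , eD′ , eA′) =
      let ss , S″ , b , count≡ = bicolour-all D′ todo (A′ ∷ ported) bD′ (bA′ ∷ bp)
            (Layout-↭ (↭-prep D′ (↭-sym (shift A′ todo ported))) S′)
      in ss , S″ , b , λ z → trans (count≡ z)
        (trans (total-↭ (tip-count z) (↭-prep D′ (shift A′ todo ported)))
        (trans (sym (+-assoc (tip-count z D′) _ _))
        (trans (cong (_+ total (tip-count z) (todo ++ ported))
          (join-count {A = D} {A} {D′} {A′} (inj₁ refl) (inj₁ refl) eD′ eA′ z)) (+-assoc (tip-count z D) _ _))))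

  Picked : ℕ → List (Strand k) → Set
  Picked {k} u ss = Σ (Strand k) λ A → Σ (List (Strand k)) λ rest → Σ ℕ λ w → Ends A u w × ss ↭ A ∷ rest

  pick : ∀ u (ss : List (Strand k)) → 1 ≤ total (tip-count u) ss → Picked u ss
  pick u ss h = let A , rest , p , π = total-positive (tip-count u) ss h
                    w , e = tip-count-positive A u p
                in A , rest , w , e , π

  Realisation : ℕ → List (ℕ × ℕ) → Set
  Realisation k es = Σ (List (Strand k)) λ ss → Layout n ss × map ends ss ≡ es

  -- Joining a strand that ends in u to one that ends in v gives a strand for the edge uv and a
  -- remainder that is bicoloured again.
  realise : ∀ {k} es (todo done : List (Strand k)) → All Bicoloured todo → Layout n (todo ++ done) →
    (∀ z → total (tip-count z) todo ≡ total (ends-count z) es) →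
    All (λ e → proj₁ e ≢ proj₂ e) es → Realisation k (es ʳ++ map ends done)
  realise [] [] done b S count≡ loopless = done , S , refl
  realise [] (A ∷ todo) done b S count≡ loopless = ⊥-elim (1+n≰n {0} (≤-trans
    (≤-trans (≤-trans (≤-reflexive (sym (count-self a))) (m≤m+n _ (b2n (tip (right A) ≐ a))))
      (m≤m+n _ (total (tip-count a) todo))) (≤-reflexive (count≡ a))))
    where
    a = tip (left A)
  realise {k} ((u , v) ∷ es) todo done b S count≡ (u≢v ∷ loopless) = first
    (pick u todo (subst (1 ≤_) (sym (count≡ u)) (≤-trans (≤-reflexive (sym (count-self u)))
             (≤-trans (m≤m+n _ (b2n (v ≐ u))) (m≤m+n _ (total (ends-count u) es))))))
    where
    Goal = Realisation k (es ʳ++ ((u , v) ∷ map ends done))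

    place : ∀ (C : Strand k) todo′ → Layout n (C ∷ todo′ ++ done) → ends C ≡ (u , v) → All Bicoloured todo′ →
      (∀ z → ends-count z (u , v) + total (tip-count z) todo′ ≡ total (tip-count z) todo) → Goal
    place C todo′ S′ e b′ c = subst (λ x → Realisation k (es ʳ++ (x ∷ map ends done))) e
      (realise es todo′ (C ∷ done) b′ (Layout-↭ (↭-sym (shift C todo′ done)) S′)
        (λ z → +-cancelˡ-≡ (ends-count z (u , v)) _ _ (trans (c z) (count≡ z))) loopless)

    second : ∀ {A w rest} → Ends A u w → todo ↭ A ∷ rest → Picked v rest → Goal
    second {A} {w} {rest} eA π (B , rest′ , w′ , eB , π′) =
      let π″ = ↭-trans π (↭-prep A π′)
          C , D , S′ , bC , bD , eC , eD = join (Layout-↭ (Perm.++⁺ʳ done π″) S)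
            (bicoloured-contrast A B (All.head (All-resp-↭ π b))) eA eB
      in place C (D ∷ rest′) S′ eC (bD ∷ All.tail (All.tail (All-resp-↭ π″ b)))
        (λ z → trans (cong (_+ (tip-count z D + total (tip-count z) rest′)) (sym (Ends-count C (inj₁ eC) z)))
          (trans (sym (+-assoc (tip-count z C) (tip-count z D) _))
          (trans (cong (_+ total (tip-count z) rest′) (join-count {A = A} {B} {C} {D} eA eB eC eD z))
          (trans (+-assoc (tip-count z A) (tip-count z B) _)
            (sym (total-↭ (tip-count z) π″))))))

    count-rest : ∀ {A w rest} → Ends A u w → todo ↭ A ∷ rest →
      ∀ z → ends-count z (u , w) + total (tip-count z) rest ≡ total (tip-count z) todo
    count-rest {A} {w} {rest} eA π z = trans (cong (_+ total (tip-count z) rest) (sym (Ends-count A eA z)))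
      (sym (total-↭ (tip-count z) π))

    first : Picked u todo → Goal
    first (A , rest , w , eA , π) with w ≟ v
    ... | no w≢v = second eA π (pick v rest (subst (1 ≤_) (sym rest≡) (s≤s z≤n)))
      where
      -- A has no tip at v, so the tip that the edge uv requires there belongs to another strand.
      rest≡ : total (tip-count v) rest ≡ 1 + total (ends-count v) es
      rest≡ = trans (cong (_+ total (tip-count v) rest)
          (sym (cong₂ (λ a c → b2n a + b2n c) (≐-≢ u≢v) (≐-≢ w≢v))))
        (trans (count-rest eA π v) (trans (count≡ v)
          (cong (_+ total (ends-count v) es) (cong₂ (λ a c → b2n a + b2n c) (≐-≢ u≢v) (≐-refl v)))))
    ... | yes refl with Layout-↭ (Perm.++⁺ʳ done π) S | eA
    ...   | S′ | inj₁ e = place A rest S′ e (All.tail (All-resp-↭ π b)) (count-rest eA π)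
    -- The strand has the right tips in the wrong order; it is turned round because the target is a
    -- list of ordered pairs.
    ...   | S′ | inj₂ refl = place (flip A) rest (flip-first S′) refl (All.tail (All-resp-↭ π b)) (count-rest {A} (inj₂ refl) π)

≐-toℕ : (i j : Fin n) → (toℕ i ≐ toℕ j) ≡ (i == j)
≐-toℕ i j with i F.≟ j
... | yes refl = ≐-refl (toℕ i)
... | no h = ≐-≢ (h ∘ FP.toℕ-injective)

∑-set : (h : Fin k → Fin n) (j : Fin k) (b z : Fin n) →
  ∑ (λ i → b2n (set h j b i == z)) + b2n (h j == z) ≡ ∑ (λ i → b2n (h i == z)) + b2n (b == z)
∑-set {suc k} h zero b z = solve 3 (λ x y s → x :+ s :+ y := y :+ s :+ x) refl
    (b2n (b == z)) (b2n (h zero == z)) (∑ (λ i → b2n (h (suc i) == z)))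
  where
  open +-*-Solver
∑-set {suc k} h (suc j) b z = trans (+-assoc (b2n (h zero == z)) _ _)
  (trans (cong (b2n (h zero == z) +_) (trans
     (cong (_+ b2n (h (suc j) == z)) (∑-cong (λ i → cong (λ c → b2n ((if c then b else h (suc i)) == z)) (==-suc i j))))
     (∑-set (h ∘ suc) j b z)))
  (sym (+-assoc (b2n (h zero == z)) _ _)))

-- Building the k paths vertex by vertex

Push : ℕ → ℕ → Set
Push k n = Fin k × Fin n

pushes : Fin k → Fin n → List (Push k n) → ℕ
pushes i v = total (λ (j , b) → b2n (j == i) * b2n (b == v))

-- A list of pushes is read from its end: the entry in front is carried out last and so determines
-- the head of its path.
heads : (Fin k → Fin n) → List (Push k n) → Fin k → Fin n
heads R [] = R
heads R ((j , b) ∷ I) = set (heads R I) j b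

record Built (R : Fin k → Fin n) (I : List (Push k n)) : Set where
  field
    strands : List (Strand k)
    layout  : Layout n strands
  open Layout layout
  field
    headed  : ∀ i → Σ (List ℕ) λ xs → path i ≡ toℕ (heads R I i) ∷ xs
    visits  : ∀ i v → count (toℕ v) (path i) ≡ b2n (R i == v) + pushes i v I
    -- A visit to v supplies two tips, but one is missing at either end of a path, and both on a
    -- path with a single vertex.
    degrees : ∀ v → total (tip-count (toℕ v)) strands + (∑ (λ i → b2n (heads R I i == v)) + ∑ (λ i → b2n (R i == v)))
                    ≡ 2 * ∑ (λ i → b2n (R i == v) + pushes i v I)
    -- This will provide strands of two different paths for the very first switching.
    present : All (λ (i , _) → Σ (Strand k) λ s → s ∈ strands × colour s ≡ i × colour′ s ≡ i) I

start : (R : Fin k → Fin n) → Built R []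
start {k} {n} R = record
  { strands = []
  ; layout = record
    { path = λ i → toℕ (R i) ∷ []
    ; bound = n
    ; fresh = λ z h → trans (+-identityʳ _) (isVertex-≥ h)
    ; simple = λ z → ≤-trans (≤-reflexive (+-identityʳ _)) (b2n≤1 (does (z <? n)))
    ; inside = λ i z → +-monoˡ-≤ 0 (in-range i z)
    ; covers = λ u v → ⨁-false k
    ; located = []
    ; tips = []
    }
  ; headed = λ i → [] , refl
  ; visits = λ i v → cong (λ b → b2n b + 0) (≐-toℕ (R i) v)
  ; degrees = λ v → trans (cong (λ s → ∑ (λ i → b2n (R i == v)) + s) (sym (+-identityʳ _)))
      (cong (2 *_) (∑-cong (λ i → sym (+-identityʳ (b2n (R i == v))))))
  ; present = []
  }
  where
  in-range : ∀ i z → b2n (toℕ (R i) ≐ z) ≤ isVertex n z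
  in-range i z with toℕ (R i) ≟ z
  ... | yes refl = ≤-trans (b2n≤1 (toℕ (R i) ≐ toℕ (R i))) (≤-reflexive (sym (isVertex-< (FP.toℕ<n (R i)))))
  ... | no h = ≤-trans (≤-reflexive (cong b2n (≐-≢ h))) z≤n

module _ {ss : List (Strand k)} (S : Layout n ss) where

  open Layout S

  vertex-mid-apart : ∀ {C} → C ∈ ss → ∀ {b} → b < n → mid C ≢ b
  vertex-mid-apart {C} C∈ b<n refl = 1+n≰n {1} (≤-trans
    (+-mono-≤ (≤-reflexive (sym (isVertex-< b<n)))
      (≤-trans (mid-occupied {n = n} C) (∈⇒≤total (λ s → inner-count s (mid C)) C∈)))
    (simple (mid C)))

  bound-fresh : ∀ i → count bound (path i) ≡ 0
  bound-fresh i = n≤0⇒n≡0 (≤-trans (inside i bound) (≤-reflexive (fresh bound ≤-refl)))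

  occupied≢bound : ∀ {z} → 1 ≤ occupancy n ss z → z ≢ bound
  occupied≢bound o refl = 1+n≰n (≤-trans o (≤-reflexive (fresh bound ≤-refl)))

  vertex≢bound : ∀ {z} → z < n → z ≢ bound
  vertex≢bound h = occupied≢bound (≤-trans (≤-reflexive (sym (isVertex-< h))) (m≤m+n _ _))

  push : ∀ (i : Fin k) {a b xs} → path i ≡ a ∷ xs → a < n → b < n → count b (path i) ≡ 0 →
    Σ (Layout n (strand ([] ▸ b) bound ([] ▸ a) i i ∷ ss)) λ S′ →
      Layout.path S′ ≡ set path i (b ∷ bound ∷ path i)
  push i {a} {b} {xs} pi a<n b<n b∉ = record
    { path = path′
    ; bound = suc t
    ; fresh = λ z h → trans (occ z) (cong₂ _+_ (cong b2n (≐-≢ (<⇒≢ h))) (fresh z (≤-trans (n≤1+n t) h)))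
    ; simple = simple′
    ; inside = inside′
    ; covers = covers′
    ; located = (loc-b , loc-a) ∷ All.tabulate others
    ; tips = (b<n , a<n) ∷ tips
    } , refl
    where
    t = bound
    path′ : Fin _ → List ℕ
    path′ = set path i (b ∷ t ∷ path i)
    s = strand ([] ▸ b) t ([] ▸ a) i i

    b≢a : b ≢ a
    b≢a e = All.head (count≡0⇒All≢ (a ∷ xs) (subst (λ p → count b p ≡ 0) pi b∉)) e

    path-walk : ∀ u v → walk (b ∷ t ∷ path i) u v ≡ edge b t u v xor (edge t a u v xor walk (path i) u v)
    path-walk u v rewrite pi = refl

    occ : ∀ z → occupancy n (s ∷ ss) z ≡ b2n (t ≐ z) + occupancy n ss z
    occ z = solve 3 (λ v x r → v :+ ((x :+ con 0) :+ r) := x :+ (v :+ r)) refl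
        (isVertex n z) (b2n (t ≐ z)) (total (λ s → inner-count s z) ss)
      where
      open +-*-Solver

    simple′ : ∀ z → occupancy n (s ∷ ss) z ≤ 1
    simple′ z with t ≟ z
    ... | yes refl = ≤-reflexive (trans (occ t) (cong₂ _+_ (count-self t) (fresh t ≤-refl)))
    ... | no h = ≤-trans (≤-reflexive (trans (occ z) (cong (λ c → b2n c + occupancy n ss z) (≐-≢ h)))) (simple z)

    room : ∀ z → b2n (b ≐ z) + count z (path i) ≤ occupancy n ss z
    room z with b ≟ z
    ... | yes refl = ≤-trans (≤-reflexive (cong₂ _+_ (count-self b) b∉))
      (≤-trans (≤-reflexive (sym (isVertex-< b<n))) (m≤m+n _ _))
    ... | no h = ≤-trans (≤-reflexive (cong (λ c → b2n c + count z (path i)) (≐-≢ h))) (inside i z)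

    inside′ : ∀ j z → count z (path′ j) ≤ occupancy n (s ∷ ss) z
    inside′ j z with j F.≟ i
    ... | yes refl = ≤-trans (≤-reflexive (solve 3 (λ x y r → x :+ (y :+ r) := y :+ (x :+ r)) refl
            (b2n (b ≐ z)) (b2n (t ≐ z)) (count z (path i))))
          (≤-trans (+-monoʳ-≤ (b2n (t ≐ z)) (room z)) (≤-reflexive (sym (occ z))))
      where
      open +-*-Solver
    ... | no _ = ≤-trans (inside j z) (≤-trans (m≤n+m _ (b2n (t ≐ z))) (≤-reflexive (sym (occ z))))

    covers′ : ∀ u v → ⨁ (λ j → walk (path′ j) u v) ≡ xorOver (λ s → strand-walk s u v) (s ∷ ss)
    covers′ u v = trans (⨁-set path i _ (λ u v → edge b t u v xor edge t a u v) (λ u v →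
        trans (path-walk u v) (solve 3 (λ x y w → x :+ (y :+ w) := w :+ (x :+ y)) refl
          (edge b t u v) (edge t a u v) (walk (path i) u v))) u v)
      (trans (cong (_xor (edge b t u v xor edge t a u v)) (covers u v))
      (trans (solve 3 (λ r x y → r :+ (x :+ y) := ((x :+ con false) :+ (y :+ con false)) :+ r) refl
        (xorOver (λ s → strand-walk s u v) ss) (edge b t u v) (edge t a u v))
        (cong (λ e → ((e xor false) xor (edge t a u v xor false)) xor xorOver (λ s → strand-walk s u v) ss)
          (edge-comm b t u v))))
      where
      open xor-∧-Solver

    t≢b : t ≢ b
    t≢b = vertex≢bound b<n ∘ sym
    t≢a : t ≢ a
    t≢a = vertex≢bound a<n ∘ sym

    loc-b : walk (path′ i) t b ≡ true
    loc-b rewrite set-same path i (b ∷ t ∷ path i) = trans (path-walk t b)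
      (cong₂ _xor_ (edge-flip b t) (cong₂ _xor_ (edge-off′ t (t≢a ∘ sym) (b≢a ∘ sym))
        (walk-off b (path i) (bound-fresh i))))
    loc-a : walk (path′ i) t a ≡ true
    loc-a rewrite set-same path i (b ∷ t ∷ path i) = trans (path-walk t a)
      (cong₂ _xor_ (edge-off t (t≢b ∘ sym) b≢a) (cong₂ _xor_ (edge-refl t a)
        (walk-off a (path i) (bound-fresh i))))

    others : ∀ {C} → C ∈ ss → Located path′ C
    others {C} C∈ = kept (colour C) _ (proj₁ locC) , kept (colour′ C) _ (proj₂ locC)
      where
      locC = All.lookup located C∈
      μ≢t : mid C ≢ t
      μ≢t = occupied≢bound (≤-trans (≤-trans (mid-occupied {n = n} C)
        (∈⇒≤total (λ s → inner-count s (mid C)) C∈)) (m≤n+m _ (isVertex n (mid C))))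
      away : ∀ x y h → mid C ≢ x → mid C ≢ y → edge x y (mid C) h ≡ false
      away x y h p q = edge-false λ { (inj₁ (r , _)) → p (sym r) ; (inj₂ (_ , r)) → q (sym r) }
      kept : ∀ j h → walk (path j) (mid C) h ≡ true → walk (path′ j) (mid C) h ≡ true
      kept j h w with j F.≟ i
      ... | yes refl = trans (path-walk (mid C) h)
        (cong₂ _xor_ (away b t h (vertex-mid-apart C∈ b<n) μ≢t)
          (cong₂ _xor_ (away t a h μ≢t (vertex-mid-apart C∈ a<n)) w))
      ... | no _ = w

build : (R : Fin k → Fin n) (I : List (Push k n)) →
  (∀ i v → b2n (R i == v) + pushes i v I ≤ 1) → Built R I
build R [] once = start R
build {k} {n} R ((j , b) ∷ I) once = record
  { strands = strand ([] ▸ toℕ b) (Layout.bound L) ([] ▸ toℕ a) j j ∷ strands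
  ; layout = proj₁ pushed
  ; headed = headed′
  ; visits = visits′
  ; degrees = degrees′
  ; present = (_ , here refl , refl , refl) ∷ All.map (λ (s , s∈ , c) → s , there s∈ , c) present
  }
  where
  once′ : ∀ i v → b2n (R i == v) + pushes i v I ≤ 1
  once′ i v = ≤-trans (+-monoʳ-≤ (b2n (R i == v)) (m≤n+m _ (b2n (j == i) * b2n (b == v)))) (once i v)
  open Built (build R I once′) renaming (layout to L)
  a = heads R I j
  -- The push of b is itself the one visit that `once` allows, so the path built before does not
  -- contain b.
  new : count (toℕ b) (Layout.path L j) ≡ 0
  new = trans (visits j b) (n≤0⇒n≡0 (+-cancelˡ-≤ 1 _ 0 (≤-trans (≤-reflexive
      (trans (cong (_+ (b2n (R j == b) + pushes j b I)) (sym (cong₂ (λ x y → b2n x * b2n y) (==-refl j) (==-refl b))))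
        (solve 3 (λ x y z → x :+ (y :+ z) := y :+ (x :+ z)) refl
          (b2n (j == j) * b2n (b == b)) (b2n (R j == b)) (pushes j b I)))) (once j b))))
    where
    open +-*-Solver
  pushed = push L j (proj₂ (headed j)) (FP.toℕ<n a) (FP.toℕ<n b) new
  headed′ : ∀ i → Σ (List ℕ) λ xs → Layout.path (proj₁ pushed) i ≡ toℕ (heads R ((j , b) ∷ I) i) ∷ xs
  headed′ i rewrite proj₂ pushed with i F.≟ j
  ... | yes refl = _ , refl
  ... | no _ = headed i
  visits′ : ∀ i v → count (toℕ v) (Layout.path (proj₁ pushed) i) ≡ b2n (R i == v) + pushes i v ((j , b) ∷ I)
  visits′ i v rewrite proj₂ pushed with i F.≟ j
  ... | yes refl = trans (cong₂ (λ x y → b2n x + (b2n y + count (toℕ v) (Layout.path L i))) (≐-toℕ b v)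
        (≐-≢ (vertex≢bound L (FP.toℕ<n v) ∘ sym)))
      (trans (cong (b2n (b == v) +_) (visits i v))
      (trans (solve 3 (λ x y z → x :+ (y :+ z) := y :+ (con 1 :* x :+ z)) refl
        (b2n (b == v)) (b2n (R i == v)) (pushes i v I))
        (cong (λ c → b2n (R i == v) + (b2n c * b2n (b == v) + pushes i v I)) (sym (==-refl i)))))
    where
    open +-*-Solver
  ... | no h = trans (visits i v) (cong (λ c → b2n (R i == v) + (b2n c * b2n (b == v) + pushes i v I))
        (sym (==-≢ (h ∘ sym))))
  degrees′ : ∀ v → (b2n (toℕ b ≐ toℕ v) + b2n (toℕ a ≐ toℕ v) + total (tip-count (toℕ v)) strands)
      + (∑ (λ i → b2n (heads R ((j , b) ∷ I) i == v)) + ∑ (λ i → b2n (R i == v)))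
      ≡ 2 * ∑ (λ i → b2n (R i == v) + pushes i v ((j , b) ∷ I))
  degrees′ v = begin
    (b2n (toℕ b ≐ toℕ v) + b2n (toℕ a ≐ toℕ v) + t) + (H′ + r)
      ≡⟨ cong₂ (λ x y → (b2n x + b2n y + t) + (H′ + r)) (≐-toℕ b v) (≐-toℕ a v) ⟩
    (β + α + t) + (H′ + r)
      ≡⟨ solve 5 (λ β α t H′ r → (β :+ α :+ t) :+ (H′ :+ r) := β :+ t :+ ((H′ :+ α) :+ r)) refl β α t H′ r ⟩
    β + t + ((H′ + α) + r) ≡⟨ cong (λ x → β + t + (x + r)) (∑-set (heads R I) j b v) ⟩
    β + t + ((H + β) + r)
      ≡⟨ solve 4 (λ β t H r → β :+ t :+ ((H :+ β) :+ r) := con 2 :* β :+ (t :+ (H :+ r))) refl β t H r ⟩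
    2 * β + (t + (H + r)) ≡⟨ cong (2 * β +_) (degrees v) ⟩
    2 * β + 2 * V ≡⟨ *-distribˡ-+ 2 β V ⟨
    2 * (β + V) ≡⟨ cong (λ x → 2 * (x + V)) (∑-delta (λ _ → β) j) ⟨
    2 * (∑ (λ i → β * b2n (i == j)) + V)
      ≡⟨ cong (2 *_) (∑-distrib-+ (λ i → β * b2n (i == j)) (λ i → b2n (R i == v) + pushes i v I)) ⟨
    2 * ∑ (λ i → β * b2n (i == j) + (b2n (R i == v) + pushes i v I))
      ≡⟨ cong (2 *_) (∑-cong (λ i → trans
           (cong (λ c → β * b2n c + (b2n (R i == v) + pushes i v I)) (==-sym i j))
           (solve 4 (λ β c x y → β :* c :+ (x :+ y) := x :+ (c :* β :+ y)) refl
             β (b2n (j == i)) (b2n (R i == v)) (pushes i v I)))) ⟩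
    2 * ∑ (λ i → b2n (R i == v) + pushes i v ((j , b) ∷ I)) ∎
    where
    open ≡-Reasoning
    open +-*-Solver
    β = b2n (b == v)
    α = b2n (a == v)
    t = total (tip-count (toℕ v)) strands
    H = ∑ (λ i → b2n (heads R I i == v))
    H′ = ∑ (λ i → b2n (heads R ((j , b) ∷ I) i == v))
    r = ∑ (λ i → b2n (R i == v))
    V = ∑ (λ i → b2n (R i == v) + pushes i v I)

-- From strands to subdivisions

-- `subdivide` renumbers all vertices at every step. Permanent names, with T as the indicator of
-- those in use, turn adjacency into a function X on numbers, and a subdivision adds three edges to
-- X over the field with two elements.
record Realised (G : Graph) (X : ℕ → ℕ → Bool) (T : ℕ → ℕ) : Set where
  field
    {graph}     : Graph
    subdivision : Subdivision G graph
    name        : Fin (size graph) → ℕ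
    name-count  : ∀ z → ∑ (λ i → b2n (name i ≐ z)) ≡ T z
    name-once   : ∀ z → T z ≤ 1
    name-adj    : ∀ i j → adj graph i j ≡ X (name i) (name j)
    supportˡ    : ∀ {u} v → T u ≡ 0 → X u v ≡ false
    supportʳ    : ∀ {v} u → T v ≡ 0 → X u v ≡ false

  name-of : ∀ {z} → 1 ≤ T z → Σ (Fin (size graph)) λ i → name i ≡ z
  name-of {z} h with ∑-positive (λ i → b2n (name i ≐ z)) (subst (1 ≤_) (sym (name-count z)) h)
  ... | i , p with name i ≟ z
  ...   | yes e = i , e
  ...   | no ne with () ← subst (λ b → 1 ≤ b2n b) (≐-≢ ne) p

  name-injective : ∀ {i j} → name i ≡ name j → i ≡ j
  name-injective {i} {j} e with i F.≟ j
  ... | yes p = p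
  ... | no p = ⊥-elim (1+n≰n {1} (≤-trans (≤-reflexive (sym
          (cong₂ _+_ (trans (cong (λ w → b2n (w ≐ name j)) e) (count-self (name j))) (count-self (name j)))))
        (≤-trans (two-terms≤∑ (λ l → b2n (name l ≐ name j)) p)
          (≤-trans (≤-reflexive (name-count (name j))) (name-once (name j))))))

  name-≐ : ∀ i j → (i == j) ≡ (name i ≐ name j)
  name-≐ i j with i F.≟ j
  ... | yes refl = sym (≐-refl (name i))
  ... | no h = sym (≐-≢ (h ∘ name-injective))

  named : ∀ i → 1 ≤ T (name i)
  named i = ≤-trans (≤-trans (≤-reflexive (sym (count-self (name i))))
    (term≤∑ (λ j → b2n (name j ≐ name i)) i)) (≤-reflexive (name-count (name i)))

  support-pos : ∀ {u v} → X u v ≡ true → 1 ≤ T u × 1 ≤ T v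
  support-pos {u} {v} h = pos (T u) (λ e → true≢false h (supportˡ v e)) , pos (T v) (λ e → true≢false h (supportʳ u e))
    where
    pos : ∀ t → t ≢ 0 → 1 ≤ t
    pos zero h = ⊥-elim (h refl)
    pos (suc t) h = s≤s z≤n

Realised-cong : ∀ {G X X′ T T′} → (∀ u v → X u v ≡ X′ u v) → (∀ z → T z ≡ T′ z) →
  Realised G X T → Realised G X′ T′
Realised-cong eX eT R = record
  { subdivision = subdivision
  ; name = name
  ; name-count = λ z → trans (name-count z) (eT z)
  ; name-once = λ z → subst (_≤ 1) (eT z) (name-once z)
  ; name-adj = λ i j → trans (name-adj i j) (eX _ _)
  ; supportˡ = λ v h → trans (sym (eX _ _)) (supportˡ v (trans (eT _) h))
  ; supportʳ = λ u h → trans (sym (eX _ _)) (supportʳ u (trans (eT _) h))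
  }
  where
  open Realised R

module _ {G : Graph} (G-simple : IsSimple G) where

  loopless : ∀ {X T} → Realised G X T → ∀ {c d} → X c d ≡ true → c ≢ d
  loopless {X} R {c} h refl with Realised.name-of R (proj₁ (Realised.support-pos R h))
  ... | i , refl = true≢false h (trans (sym (name-adj i i)) (proj₂ simple i))
    where
    open Realised R
    simple = proj₁ (Subdivision-invariants G-simple subdivision)

  subdivide-edge : ∀ {X T} → Realised G X T → ∀ {c d w} → X c d ≡ true → T w ≡ 0 →
    Realised G (λ u v → X u v xor (edge c d u v xor (edge w c u v xor edge w d u v)))
               (λ z → b2n (w ≐ z) + T z)
  subdivide-edge {X} {T} R {c} {d} {w} Xcd w-new
    with Realised.name-of R (proj₁ (Realised.support-pos R Xcd))
       | Realised.name-of R (proj₂ (Realised.support-pos R Xcd))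
  ... | a , refl | b , refl = record
    { subdivision = step subdivision a b (trans (name-adj a b) Xcd)
    ; name = name′
    ; name-count = λ z → cong (b2n (w ≐ z) +_) (name-count z)
    ; name-once = once
    ; name-adj = adj′
    ; supportˡ = λ {u} v h → cong₂ _xor_ (supportˡ v (m+n≡0⇒n≡0 (b2n (w ≐ u)) h))
        (cong₂ _xor_ (edgeˡ u h (name a) (name b) (old a) (old b))
          (cong₂ _xor_ (edgeˡ u h w (name a) wT (old a)) (edgeˡ u h w (name b) wT (old b))))
    ; supportʳ = λ {v} u h → cong₂ _xor_ (supportʳ u (m+n≡0⇒n≡0 (b2n (w ≐ v)) h))
        (cong₂ _xor_ (edgeʳ v h (name a) (name b) (old a) (old b))
          (cong₂ _xor_ (edgeʳ v h w (name a) wT (old a)) (edgeʳ v h w (name b) wT (old b))))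
    }
    where
    open Realised R
    H-simple = proj₁ (Subdivision-invariants G-simple subdivision)
    T′ : ℕ → ℕ
    T′ z = b2n (w ≐ z) + T z
    old : ∀ i → 1 ≤ T′ (name i)
    old i = ≤-trans (named i) (m≤n+m _ _)
    wT : 1 ≤ T′ w
    wT = ≤-trans (≤-reflexive (sym (count-self w))) (m≤m+n _ _)
    edgeˡ : ∀ u → T′ u ≡ 0 → ∀ x y → 1 ≤ T′ x → 1 ≤ T′ y → ∀ {v} → edge x y u v ≡ false
    edgeˡ u h x y p q {v} = edge-false {x} {y} {u} {v} λ
      { (inj₁ (refl , _)) → 1+n≰n (≤-trans p (≤-reflexive h))
      ; (inj₂ (_ , refl)) → 1+n≰n (≤-trans q (≤-reflexive h)) }
    edgeʳ : ∀ v → T′ v ≡ 0 → ∀ x y → 1 ≤ T′ x → 1 ≤ T′ y → ∀ {u} → edge x y u v ≡ false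
    edgeʳ v h x y p q {u} = trans (edge-sym x y u v) (edgeˡ v h x y p q)
    name≢w : ∀ i → name i ≢ w
    name≢w i refl = 1+n≰n (≤-trans (named i) (≤-reflexive w-new))
    a≢b : name a ≢ name b
    a≢b = loopless R Xcd
    name′ : Fin (suc (size graph)) → ℕ
    name′ zero = w
    name′ (suc i) = name i
    once : ∀ z → T′ z ≤ 1
    once z with w ≟ z
    ... | yes refl = ≤-reflexive (cong₂ _+_ (count-self w) w-new)
    ... | no h = ≤-trans (≤-reflexive (cong (λ e → b2n e + T z) (≐-≢ h))) (name-once z)
    X′ : ℕ → ℕ → Bool
    X′ u v = X u v xor (edge (name a) (name b) u v xor (edge w (name a) u v xor edge w (name b) u v))

    edge-w : ∀ i j → edge w (name i) w (name j) ≡ (name j ≐ name i)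
    edge-w i j with name j ≟ name i
    ... | yes e rewrite e = trans (edge-refl w (name i)) (sym (≐-refl (name i)))
    ... | no h = trans (edge-false λ { (inj₁ (_ , e)) → h (sym e) ; (inj₂ (e , _)) → name≢w j (sym e) }) (sym (≐-≢ h))

    ∨≡xor : ∀ p q → (p ≡ true → q ≡ true → ⊥) → p ∨ q ≡ p xor q
    ∨≡xor true true h = ⊥-elim (h refl refl)
    ∨≡xor true false h = refl
    ∨≡xor false q h = refl

    new-edge : ∀ j → (j == a) ∨ (j == b) ≡ X′ w (name j)
    new-edge j = trans (trans (∨≡xor (j == a) (j == b) (λ p q → a≢b (cong name (trans
          (sym (==-sound {i = j} {a} p)) (==-sound {i = j} {b} q)))))
        (cong₂ _xor_ (trans (name-≐ j a) (sym (edge-w a j))) (trans (name-≐ j b) (sym (edge-w b j)))))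
      (sym (cong₂ _xor_ (supportˡ (name j) w-new) (cong (_xor (edge w (name a) w (name j) xor edge w (name b) w (name j)))
        (edge-false {name a} {name b} {w} {name j} λ { (inj₁ (e , _)) → name≢w a e ; (inj₂ (_ , e)) → name≢w b e }))))

    X′-sym : ∀ j → X′ (name j) w ≡ X′ w (name j)
    X′-sym j = cong₂ _xor_ (trans (supportʳ (name j) w-new) (sym (supportˡ (name j) w-new)))
      (cong₂ _xor_ (edge-sym (name a) (name b) (name j) w)
        (cong₂ _xor_ (edge-sym w (name a) (name j) w) (edge-sym w (name b) (name j) w)))

    remove : ∀ p e → (e ≡ true → p ≡ true) → p ∧ not e ≡ p xor e
    remove true e h = refl
    remove false true h with () ← h refl
    remove false false h = refl

    edge-name : ∀ i j → FW.edge i j a b ≡ edge (name a) (name b) (name i) (name j)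
    edge-name i j = cong₂ _∨_
      (cong₂ _∧_ (trans (==-sym i a) (name-≐ a i)) (trans (==-sym j b) (name-≐ b j)))
      (trans (cong₂ _∧_ (trans (==-sym i b) (name-≐ b i)) (trans (==-sym j a) (name-≐ a j))) (∧-comm (name b ≐ name i) _))

    adj′ : ∀ i j → adj (subdivide graph a b) i j ≡ X′ (name′ i) (name′ j)
    adj′ zero zero = sym (cong₂ _xor_ (supportˡ w w-new) (cong₂ _xor_ (off (name a) (name b) (name≢w a) (name≢w b))
      (cong₂ _xor_ (off′ (name a) (name≢w a)) (off′ (name b) (name≢w b)))))
      where
      off : ∀ x y → x ≢ w → y ≢ w → edge x y w w ≡ false
      off x y p q = edge-off y p p
      off′ : ∀ x → x ≢ w → edge w x w w ≡ false
      off′ x p = edge-off′ w p p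
    adj′ zero (suc j) = new-edge j
    adj′ (suc i) zero = trans (new-edge i) (sym (X′-sym i))
    adj′ (suc i) (suc j) = trans (remove (adj graph i j) (FW.edge i j a b) implies)
      (cong₂ _xor_ (name-adj i j) (trans (edge-name i j) (sym (trans
        (cong (edge (name a) (name b) (name i) (name j) xor_) (cong₂ _xor_
          (edge-off (name a) (name≢w i ∘ sym) (name≢w j ∘ sym)) (edge-off (name b) (name≢w i ∘ sym) (name≢w j ∘ sym))))
        (xor-identityʳ _)))))
      where
      implies : FW.edge i j a b ≡ true → adj graph i j ≡ true
      implies h with FW.edge-sound {x = i} {j} {a} {b} h
      ... | inj₁ (refl , refl) = trans (name-adj a b) Xcd
      ... | inj₂ (refl , refl) = trans (proj₁ H-simple b a) (trans (name-adj a b) Xcd)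

  -- The vertices are inserted starting next to d: once `ws` is in place, the edge at c that leads
  -- to `ws` (or to d, if `ws` is empty) is subdivided by w.
  expand-edge : ∀ {X T} → Realised G X T → ∀ {c d} ws → X c d ≡ true → (∀ z → count z ws + T z ≤ 1) →
    Realised G (λ u v → X u v xor (edge c d u v xor walk (c ∷ verts (ws ▸ d)) u v)) (λ z → count z ws + T z)
  expand-edge {X} R {c} {d} [] Xcd free = Realised-cong
    (λ u v → solve 2 (λ x e → x := x :+ (e :+ (e :+ con false))) refl (X u v) (edge c d u v)) (λ z → refl) R
    where
    open xor-∧-Solver
  expand-edge {X} {T} R {c} {d} (w ∷ ws) Xcd free = Realised-cong eX (λ z → sym (+-assoc (b2n (w ≐ z)) _ _))
    (subdivide-edge R′ {c} {head (ws ▸ d)} {w} (on ws refl) w-new)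
    where
    R′ = expand-edge R ws Xcd (λ z → ≤-trans (+-monoˡ-≤ (T z) (m≤n+m (count z ws) (b2n (w ≐ z)))) (free z))
    w-new : count w ws + T w ≡ 0
    w-new = n≤0⇒n≡0 (s≤s⁻¹ (≤-trans (≤-reflexive (trans (cong (_+ (count w ws + T w)) (sym (count-self w)))
      (sym (+-assoc (b2n (w ≐ w)) _ _)))) (free w)))
    pos = Realised.support-pos R Xcd
    c-new : count c ws ≡ 0
    c-new = n≤0⇒n≡0 (+-cancelʳ-≤ 1 _ 0 (≤-trans (+-mono-≤ (m≤n+m (count c ws) (b2n (w ≐ c))) (proj₁ pos)) (free c)))
    on : ∀ vs → vs ≡ ws →
      X c (head (vs ▸ d)) xor (edge c d c (head (vs ▸ d)) xor walk (c ∷ verts (vs ▸ d)) c (head (vs ▸ d))) ≡ true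
    on [] refl = trans (cong₂ (λ x e → x xor (e xor (e xor false))) Xcd (edge-refl c d)) refl
    on (x ∷ vs) refl = cong₂ _xor_ (Realised.supportʳ R c x-new)
      (cong₂ _xor_ (edge-false λ { (inj₁ (_ , e)) → x≢d (sym e) ; (inj₂ (e , _)) → x≢c (sym e) })
        (cong₂ _xor_ (edge-refl c x) (walk-off x (verts ((x ∷ vs) ▸ d)) c-off)))
      where
      x-new : T x ≡ 0
      x-new = n≤0⇒n≡0 (+-cancelˡ-≤ 1 _ 0 (≤-trans (+-monoˡ-≤ (T x)
        (≤-trans (count-here x vs) (m≤n+m _ (b2n (w ≐ x))))) (free x)))
      x≢ : ∀ {z} → 1 ≤ T z → x ≢ z
      x≢ h refl = 1+n≰n (≤-trans h (≤-reflexive x-new))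
      x≢c = x≢ (proj₁ pos)
      x≢d = x≢ (proj₂ pos)
      c-off : count c (verts ((x ∷ vs) ▸ d)) ≡ 0
      c-off = trans (count-++ c (x ∷ vs) [ d ]) (cong₂ _+_ c-new
        (trans (+-identityʳ _) (cong b2n (≐-≢ (loopless R Xcd ∘ sym)))))
    eX : ∀ u v → (X u v xor (edge c d u v xor walk (c ∷ verts (ws ▸ d)) u v))
        xor (edge c (head (ws ▸ d)) u v xor (edge w c u v xor edge w (head (ws ▸ d)) u v))
      ≡ X u v xor (edge c d u v xor (edge c w u v xor walk (w ∷ verts (ws ▸ d)) u v))
    eX u v rewrite walk-∷-verts c (ws ▸ d) u v | walk-∷-verts w (ws ▸ d) u v | edge-comm w c u v =
      solve 6 (λ x e ch r cw wh → (x :+ (e :+ (ch :+ r))) :+ (ch :+ (cw :+ wh)) := x :+ (e :+ (cw :+ (wh :+ r)))) refl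
        (X u v) (edge c d u v) (edge c (head (ws ▸ d)) u v) (frag-walk (ws ▸ d) u v) (edge c w u v) (edge w (head (ws ▸ d)) u v)
      where
      open xor-∧-Solver

  -- `mid` is inserted first and then serves as the starting point for both halves, since fragments
  -- are recorded outwards from it.
  expand-strand : ∀ {X T} → Realised G X T → (s : Strand k) → X (tip (left s)) (tip (right s)) ≡ true →
    (∀ z → inner-count s z + T z ≤ 1) →
    Realised G (λ u v → X u v xor (edge (tip (left s)) (tip (right s)) u v xor strand-walk s u v))
      (λ z → inner-count s z + T z)
  expand-strand {X = X} {T} R s@(strand l m r _ _) Xab free =
    Realised-cong eX eT (expand-edge R₂ {m} {b} (inner r) on₂ free₂)
    where
    a = tip l
    b = tip r
    ints = λ z → count z (inner l) + (b2n (m ≐ z) + count z (inner r))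
    pos = Realised.support-pos R Xab
    a≢b = loopless R Xab
    m-in : 1 ≤ ints m
    m-in = mid-occupied {n = 0} s
    m-new : T m ≡ 0
    m-new = n≤0⇒n≡0 (+-cancelˡ-≤ 1 _ 0 (≤-trans (+-monoˡ-≤ (T m) m-in) (free m)))
    m≢ : ∀ {z} → 1 ≤ T z → m ≢ z
    m≢ h refl = 1+n≰n (≤-trans h (≤-reflexive m-new))
    m≢a = m≢ (proj₁ pos)
    m≢b = m≢ (proj₂ pos)
    R₁ = subdivide-edge R {a} {b} {m} Xab m-new
    free₁ : ∀ z → count z (inner l) + (b2n (m ≐ z) + T z) ≤ 1
    free₁ z = ≤-trans (≤-trans (≤-reflexive (sym (+-assoc (count z (inner l)) _ _)))
      (+-monoˡ-≤ (T z) (+-monoʳ-≤ (count z (inner l)) (m≤m+n (b2n (m ≐ z)) _)))) (free z)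
    on₁ : X m a xor (edge a b m a xor (edge m a m a xor edge m b m a)) ≡ true
    on₁ = cong₂ _xor_ (Realised.supportˡ R a m-new) (cong₂ _xor_
      (edge-false λ { (inj₁ (e , _)) → m≢a (sym e) ; (inj₂ (_ , e)) → m≢b (sym e) })
      (cong₂ _xor_ (edge-refl m a) (edge-false λ { (inj₁ (_ , e)) → a≢b (sym e) ; (inj₂ (e , _)) → m≢a e })))
    R₂ = expand-edge R₁ {m} {a} (inner l) on₁ free₁
    free₂ : ∀ z → count z (inner r) + (count z (inner l) + (b2n (m ≐ z) + T z)) ≤ 1
    free₂ z = ≤-trans (≤-reflexive (solve 4 (λ r l m t → r :+ (l :+ (m :+ t)) := (l :+ (m :+ r)) :+ t) refl
        (count z (inner r)) (count z (inner l)) (b2n (m ≐ z)) (T z))) (free z)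
      where
      open +-*-Solver
    b-off : count b (m ∷ verts l) ≡ 0
    b-off = cong₂ _+_ (cong b2n (≐-≢ m≢b)) (trans (count-++ b (inner l) [ a ]) (cong₂ _+_
      (n≤0⇒n≡0 (+-cancelʳ-≤ 1 _ 0 (≤-trans (+-mono-≤ (m≤m+n (count b (inner l)) _) (proj₂ pos)) (free b))))
      (trans (+-identityʳ _) (cong b2n (≐-≢ a≢b)))))
    on₂ : (X m b xor (edge a b m b xor (edge m a m b xor edge m b m b))) xor
          (edge m a m b xor walk (m ∷ verts l) m b) ≡ true
    on₂ = cong₂ _xor_ (cong₂ _xor_ (Realised.supportˡ R b m-new) (cong₂ _xor_
        (edge-false λ { (inj₁ (e , _)) → m≢a (sym e) ; (inj₂ (_ , e)) → m≢b (sym e) })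
        (cong₂ _xor_ mamb (edge-refl m b))))
      (cong₂ _xor_ mamb (trans (walk-sym (m ∷ verts l) m b) (walk-off m (m ∷ verts l) b-off)))
      where
      mamb : edge m a m b ≡ false
      mamb = edge-false λ { (inj₁ (_ , e)) → a≢b e ; (inj₂ (e , _)) → m≢b e }
    eT : ∀ z → count z (inner r) + (count z (inner l) + (b2n (m ≐ z) + T z)) ≡ ints z + T z
    eT z = solve 4 (λ r l m t → r :+ (l :+ (m :+ t)) := (l :+ (m :+ r)) :+ t) refl
        (count z (inner r)) (count z (inner l)) (b2n (m ≐ z)) (T z)
      where
      open +-*-Solver
    eX : ∀ u v → ((X u v xor (edge a b u v xor (edge m a u v xor edge m b u v)))
        xor (edge m a u v xor walk (m ∷ verts l) u v)) xor (edge m b u v xor walk (m ∷ verts r) u v)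
      ≡ X u v xor (edge a b u v xor (walk (m ∷ verts l) u v xor walk (m ∷ verts r) u v))
    eX u v = solve 6 (λ x e p q wl wr → ((x :+ (e :+ (p :+ q))) :+ (p :+ wl)) :+ (q :+ wr) := x :+ (e :+ (wl :+ wr))) refl
        (X u v) (edge a b u v) (edge m a u v) (edge m b u v) (walk (m ∷ verts l) u v) (walk (m ∷ verts r) u v)
      where
      open xor-∧-Solver

edgeOf : ℕ → ℕ → ℕ × ℕ → Bool
edgeOf i j (u , v) = edge u v i j

total-++ : (f : A → ℕ) (xs ys : List A) → total f (xs ++ ys) ≡ total f xs + total f ys
total-++ f [] ys = refl
total-++ f (x ∷ xs) ys = trans (cong (f x +_) (total-++ f xs ys)) (sym (+-assoc (f x) _ _))

total-concat-tabulate : (f : A → ℕ) (g : Fin n → List A) →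
  total f (concat (tabulate g)) ≡ ∑ (λ i → total f (g i))
total-concat-tabulate {n = zero} f g = refl
total-concat-tabulate {n = suc n} f g = trans (total-++ f (g zero) _)
  (cong (total f (g zero) +_) (total-concat-tabulate f (g ∘ suc)))

total-zero : {f : A → ℕ} {xs : List A} → All (λ x → f x ≡ 0) xs → total f xs ≡ 0
total-zero [] = refl
total-zero (p ∷ ps) = cong₂ _+_ p (total-zero ps)

total≡0⇒xorOver : (g : A → Bool) (xs : List A) → total (b2n ∘ g) xs ≡ 0 → xorOver g xs ≡ false
total≡0⇒xorOver g [] h = refl
total≡0⇒xorOver g (x ∷ xs) h with g x
... | false = total≡0⇒xorOver g xs h

isOddB-total : (g : A → Bool) (xs : List A) → isOddB (total (b2n ∘ g) xs) ≡ xorOver g xs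
isOddB-total g [] = refl
isOddB-total g (x ∷ xs) = trans (isOddB-+ (b2n (g x)) _) (cong₂ _xor_ (isOddB-b2n (g x)) (isOddB-total g xs))

total-map : (f : B → ℕ) (h : A → B) (xs : List A) → total f (map h xs) ≡ total (f ∘ h) xs
total-map f h [] = refl
total-map f h (x ∷ xs) = cong (f (h x) +_) (total-map f h xs)

xorOver-map : (f : B → Bool) (h : A → B) (xs : List A) → xorOver f (map h xs) ≡ xorOver (f ∘ h) xs
xorOver-map f h [] = refl
xorOver-map f h (x ∷ xs) = cong (f (h x) xor_) (xorOver-map f h xs)

walk-inner-off : ∀ {i j} c ws a → count i (c ∷ ws) ≡ 0 → count j (c ∷ ws) ≡ 0 →
  walk (c ∷ verts (ws ▸ a)) i j ≡ false
walk-inner-off {i} {j} c [] a p q = cong₂ _xor_ (edge-off {c} {i} {j} a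
  (All.head (count≡0⇒All≢ [ c ] p) ∘ sym) (All.head (count≡0⇒All≢ [ c ] q) ∘ sym)) refl
walk-inner-off {i} {j} c (w ∷ ws) a p q = cong₂ _xor_ (edge-off {c} {i} {j} w
  (All.head (count≡0⇒All≢ (c ∷ w ∷ ws) p) ∘ sym) (All.head (count≡0⇒All≢ (c ∷ w ∷ ws) q) ∘ sym))
  (walk-inner-off w ws a (m+n≡0⇒n≡0 (b2n (c ≐ i)) p) (m+n≡0⇒n≡0 (b2n (c ≐ j)) q))

strand-walk-off : ∀ {i j} (s : Strand k) → inner-count s i ≡ 0 → inner-count s j ≡ 0 → strand-walk s i j ≡ false
strand-walk-off {i = i} {j} (strand (ls ▸ a) m (rs ▸ b) _ _) p q = cong₂ _xor_
  (walk-inner-off m ls a (leftwards i p) (leftwards j q)) (walk-inner-off m rs b (rightwards i p) (rightwards j q))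
  where
  leftwards : ∀ z → count z ls + (b2n (m ≐ z) + count z rs) ≡ 0 → count z (m ∷ ls) ≡ 0
  leftwards z h = cong₂ _+_ {b2n (m ≐ z)} {0} {count z ls} {0}
    (m+n≡0⇒m≡0 (b2n (m ≐ z)) (m+n≡0⇒n≡0 (count z ls) h)) (m+n≡0⇒m≡0 (count z ls) h)
  rightwards : ∀ z → count z ls + (b2n (m ≐ z) + count z rs) ≡ 0 → count z (m ∷ rs) ≡ 0
  rightwards z h = m+n≡0⇒n≡0 (count z ls) h

module _ (G : Graph) (G-simple : IsSimple G) where

  private N = size G

  -- A subdivided edge keeps its new edges off the old vertices, so it does not interfere
  -- with the edges that are yet to be subdivided.
  expand-all : ∀ (todo : List (Strand k)) {Y T} →
    Realised G (λ u v → xorOver (λ s → edgeOf u v (ends s)) todo xor Y u v) T →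
    (∀ (i j : Fin N) → total (λ s → b2n (edgeOf (toℕ i) (toℕ j) (ends s))) todo ≤ 1) →
    (∀ {i j} → i < N → j < N → Y i j ≡ false) →
    (∀ z → isVertex N z ≤ T z) →
    (∀ z → total (λ s → inner-count s z) todo + T z ≤ 1) →
    All (λ s → tip (left s) < N × tip (right s) < N) todo →
    Realised G (λ u v → xorOver (λ s → strand-walk s u v) todo xor Y u v) (λ z → total (λ s → inner-count s z) todo + T z)
  expand-all [] R distinct Y-off V≤T free tips = R
  expand-all (s ∷ todo) {Y} {T} R distinct Y-off V≤T free ((a<N , b<N) ∷ tips) = Realised-cong eX eT
    (expand-all todo {Y = λ u v → strand-walk s u v xor Y u v} R₁
      (λ i j → ≤-trans (m≤n+m _ (b2n (edgeOf (toℕ i) (toℕ j) (ends s)))) (distinct i j))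
      (λ p q → cong₂ _xor_ (strand-walk-off s (outside p) (outside q)) (Y-off p q))
      (λ z → ≤-trans (V≤T z) (m≤n+m _ _)) (λ z → ≤-trans (≤-reflexive (eT z)) (free z)) tips)
    where
    a = tip (left s)
    b = tip (right s)
    I = λ z → total (λ s → inner-count s z) todo
    rest-off : total (λ t → b2n (edgeOf a b (ends t))) todo ≡ 0
    rest-off = n≤0⇒n≡0 (+-cancelˡ-≤ 1 _ 0 (subst₂ (λ i j → 1 + total (λ t → b2n (edgeOf i j (ends t))) todo ≤ 1)
      (FP.toℕ-fromℕ< a<N) (FP.toℕ-fromℕ< b<N)
      (≤-trans (+-monoˡ-≤ _ (≤-reflexive (sym (cong b2n
         (subst₂ (λ i j → edge a b i j ≡ true) (sym (FP.toℕ-fromℕ< a<N)) (sym (FP.toℕ-fromℕ< b<N)) (edge-refl a b))))))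
        (distinct (F.fromℕ< a<N) (F.fromℕ< b<N)))))
    Xab : (edge a b a b xor xorOver (λ t → edgeOf a b (ends t)) todo) xor Y a b ≡ true
    Xab = cong₂ _xor_ (cong₂ _xor_ (edge-refl a b) (total≡0⇒xorOver (λ t → edgeOf a b (ends t)) todo rest-off)) (Y-off a<N b<N)
    outside : ∀ {i} → i < N → inner-count s i ≡ 0
    outside {i} p = n≤0⇒n≡0 (+-cancelʳ-≤ 1 _ 0 (≤-trans (+-mono-≤ (m≤m+n (inner-count s i) (I i))
      (≤-trans (≤-reflexive (sym (isVertex-< p))) (V≤T i))) (free i)))
    eT : ∀ z → I z + (inner-count s z + T z) ≡ inner-count s z + I z + T z
    eT z = trans (sym (+-assoc (I z) _ _)) (cong (_+ T z) (+-comm (I z) (inner-count s z)))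
    R₁ : Realised G (λ u v → xorOver (λ t → edgeOf u v (ends t)) todo xor (strand-walk s u v xor Y u v))
      (λ z → inner-count s z + T z)
    R₁ = Realised-cong
      (λ u v → solve 4 (λ e r y w → ((e :+ r) :+ y) :+ (e :+ w) := r :+ (w :+ y)) refl
        (edge a b u v) (xorOver (λ t → edgeOf u v (ends t)) todo) (Y u v) (strand-walk s u v))
      (λ z → refl)
      (expand-strand G-simple R s Xab (λ z → ≤-trans (+-monoˡ-≤ (T z) (m≤m+n _ (I z))) (free z)))
      where
      open xor-∧-Solver
    eX : ∀ u v → xorOver (λ t → strand-walk t u v) todo xor (strand-walk s u v xor Y u v)
      ≡ (strand-walk s u v xor xorOver (λ t → strand-walk t u v) todo) xor Y u v
    eX u v = solve 3 (λ r w y → r :+ (w :+ y) := (w :+ r) :+ y) refl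
        (xorOver (λ t → strand-walk t u v) todo) (strand-walk s u v) (Y u v)
      where
      open xor-∧-Solver

  ∑-isVertex : ∀ m z → ∑ {m} (λ i → b2n (toℕ i ≐ z)) ≡ isVertex m z
  ∑-isVertex m z with z <? m
  ... | yes h = trans (∑-cong (λ i → trans (cong (λ w → b2n (toℕ i ≐ w)) (sym (FP.toℕ-fromℕ< h)))
        (cong b2n (≐-toℕ i (F.fromℕ< h))))) (trans (∑-count-one (F.fromℕ< h)) (sym (isVertex-< h)))
  ... | no h = trans (∑-zero {m} {λ i → b2n (toℕ i ≐ z)} (λ i → cong b2n (≐-≢ {toℕ i} {z} λ { refl → h (FP.toℕ<n i) })))
    (sym (isVertex-≥ (≮⇒≥ h)))

  realise-base : ∀ (ss : List (Strand k)) →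
    (∀ (i j : Fin N) → xorOver (λ s → edgeOf (toℕ i) (toℕ j) (ends s)) ss ≡ adj G i j) →
    All (λ s → tip (left s) < N × tip (right s) < N) ss →
    Realised G (λ u v → xorOver (λ s → edgeOf u v (ends s)) ss xor false) (isVertex N)
  realise-base ss edges tips = record
    { subdivision = base
    ; name = toℕ
    ; name-count = ∑-isVertex N
    ; name-once = λ z → b2n≤1 (does (z <? N))
    ; name-adj = λ i j → sym (trans (xor-identityʳ _) (edges i j))
    ; supportˡ = λ v h → trans (xor-identityʳ _) (offˡ v h tips)
    ; supportʳ = λ u h → trans (xor-identityʳ _) (offʳ u h tips)
    }
    where
    ≢-vertex : ∀ {z a} → isVertex N z ≡ 0 → a < N → a ≢ z
    ≢-vertex h p refl with () ← trans (sym (isVertex-< p)) h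
    offˡ : ∀ {u} v → isVertex N u ≡ 0 → ∀ {ss : List (Strand _)} → All (λ s → tip (left s) < N × tip (right s) < N) ss →
      xorOver (λ s → edgeOf u v (ends s)) ss ≡ false
    offˡ v h [] = refl
    offˡ v h ((p , q) ∷ ps) = cong₂ _xor_ (edge-false
      λ { (inj₁ (e , _)) → ≢-vertex h p e ; (inj₂ (_ , e)) → ≢-vertex h q e }) (offˡ v h ps)
    offʳ : ∀ {v} u → isVertex N v ≡ 0 → ∀ {ss : List (Strand _)} → All (λ s → tip (left s) < N × tip (right s) < N) ss →
      xorOver (λ s → edgeOf u v (ends s)) ss ≡ false
    offʳ u h [] = refl
    offʳ u h ((p , q) ∷ ps) = cong₂ _xor_ (edge-false
      λ { (inj₁ (_ , e)) → ≢-vertex h q e ; (inj₂ (e , _)) → ≢-vertex h p e }) (offʳ u h ps)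

  -- As T bounds the visits, every number on a path is the name of a vertex. Pulling back along the
  -- injective `name` preserves edges and creates no repetition.
  realised-cover : ∀ {X T} → Realised G X T → (path : Fin k → List ℕ) → (∀ i z → count z (path i) ≤ T z) →
    (∀ u v → ⨁ (λ i → walk (path i) u v) ≡ X u v) → Fin N →
    Σ Graph λ H → Subdivision G H × HasOddCover H k
  realised-cover {k} {X} {T} R path inside covers v₀ = graph , subdivision ,
    tabulate Q , AllP.tabulate⁺ Q-path , length-tabulate Q , correct
    where
    open Realised R
    index-list : ∀ xs → All (λ z → 1 ≤ T z) xs → Σ (List (Fin (size graph))) λ ys → map name ys ≡ xs
    index-list [] [] = [] , refl
    index-list (x ∷ xs) (p ∷ ps) =
      let i , e = name-of p ; ys , es = index-list xs ps in i ∷ ys , cong₂ _∷_ e es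
    supported : ∀ xs → (∀ z → count z xs ≤ T z) → All (λ z → 1 ≤ T z) xs
    supported [] h = []
    supported (x ∷ xs) h = ≤-trans (count-here x xs) (h x) ∷ supported xs (λ z → ≤-trans (m≤n+m _ (b2n (x ≐ z))) (h z))
    indexed : ∀ i → Σ (List (Fin (size graph))) λ ys → map name ys ≡ path i
    indexed i = index-list (path i) (supported (path i) (inside i))
    any-vertex : ∀ {H} → Subdivision G H → Fin (size H)
    any-vertex base = v₀
    any-vertex (step σ u v a) = zero
    -- A path of the layout may be empty, but a path of a cover may not.
    pad : List (Fin (size graph)) → List (Fin (size graph))
    pad [] = [ any-vertex subdivision ]
    pad (x ∷ xs) = x ∷ xs
    Q : Fin k → List (Fin (size graph))
    Q i = pad (proj₁ (indexed i))
    pad-path : ∀ ys → Unique ys → IsPath (pad ys)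
    pad-path [] u = [] ∷ []
    pad-path (x ∷ ys) u = u
    pad-Unique : ∀ ys → Unique ys → Unique (pad ys)
    pad-Unique [] u = [] ∷ []
    pad-Unique (x ∷ ys) u = u
    indexed-Unique : ∀ i → Unique (proj₁ (indexed i))
    indexed-Unique i = UniqueP.map⁻ (subst Unique (sym (proj₂ (indexed i)))
      (count≤1⇒Unique (path i) (λ z → ≤-trans (inside i z) (name-once z))))
    Q-path : ∀ i → IsPath (Q i)
    Q-path i = pad-path (proj₁ (indexed i)) (indexed-Unique i)
    edge-name : ∀ x y u v → FW.edge x y u v ≡ edge (name x) (name y) (name u) (name v)
    edge-name x y u v = cong₂ _∨_ (cong₂ _∧_ (name-≐ x u) (name-≐ y v)) (cong₂ _∧_ (name-≐ x v) (name-≐ y u))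
    walk-name : ∀ ys u v → FW.walk ys u v ≡ walk (map name ys) (name u) (name v)
    walk-name [] u v = refl
    walk-name (x ∷ []) u v = refl
    walk-name (x ∷ y ∷ ys) u v = cong₂ _xor_ (edge-name x y u v) (walk-name (y ∷ ys) u v)
    walk-pad : ∀ ys u v → FW.walk (pad ys) u v ≡ FW.walk ys u v
    walk-pad [] u v = refl
    walk-pad (x ∷ ys) u v = refl
    xorEdges-tabulate : ∀ {k} (Q : Fin k → List (Fin (size graph))) u v →
      xorEdges (tabulate Q) u v ≡ ⨁ (λ i → edgeIn (Q i) u v)
    xorEdges-tabulate {zero} Q u v = refl
    xorEdges-tabulate {suc k} Q u v = cong (edgeIn (Q zero) u v xor_) (xorEdges-tabulate (Q ∘ suc) u v)
    correct : ∀ u v → adj graph u v ≡ xorEdges (tabulate Q) u v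
    correct u v = trans (name-adj u v) (trans (sym (covers (name u) (name v))) (sym (trans (xorEdges-tabulate Q u v)
      (⨁-cong (λ i → trans (edgeIn≡walk (Q i) (pad-Unique _ (indexed-Unique i)) u v)
        (trans (walk-pad (proj₁ (indexed i)) u v) (trans (walk-name (proj₁ (indexed i)) u v)
          (cong (λ xs → walk xs (name u) (name v)) (proj₂ (indexed i))))))))))

-- The edges of the graph as a list, and covers from strands with the right degrees

∑∑-delta : (f : Fin m → Fin n → ℕ) (i : Fin m) (j : Fin n) →
  ∑ (λ u → ∑ (λ v → f u v * (b2n (u == i) * b2n (v == j)))) ≡ f i j
∑∑-delta f i j = trans (∑-cong (λ u → trans
    (∑-cong (λ v → sym (*-assoc (f u v) (b2n (u == i)) (b2n (v == j)))))
    (∑-delta (λ v → f u v * b2n (u == i)) j)))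
  (∑-delta (λ u → f u j) i)

module _ (G : Graph) (G-simple : IsSimple G) where

  private N = size G

  forward : Fin N → Fin N → Bool
  forward u v = adj G u v ∧ does (toℕ u <? toℕ v)

  edgeList : List (ℕ × ℕ)
  edgeList = concat (tabulate λ u → concat (tabulate λ v → if forward u v then [ (toℕ u , toℕ v) ] else []))

  All-edgeList : {P : ℕ × ℕ → Set} → (∀ u v → forward u v ≡ true → P (toℕ u , toℕ v)) → All P edgeList
  All-edgeList {P} h = AllP.concat⁺ (AllP.tabulate⁺ λ u → AllP.concat⁺ (AllP.tabulate⁺ λ v → single u v))
    where
    single : ∀ u v → All P (if forward u v then [ (toℕ u , toℕ v) ] else [])
    single u v with forward u v in eq
    ... | true = h u v eq ∷ []
    ... | false = []

  total-edgeList : (f : ℕ × ℕ → ℕ) → total f edgeList ≡ ∑ (λ u → ∑ (λ v → b2n (forward u v) * f (toℕ u , toℕ v)))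
  total-edgeList f = trans
    (total-concat-tabulate f (λ u → concat (tabulate (λ v → if forward u v then [ (toℕ u , toℕ v) ] else [])))) (∑-cong λ u →
    trans (total-concat-tabulate f (λ v → if forward u v then [ (toℕ u , toℕ v) ] else [])) (∑-cong λ v → single (forward u v)))
    where
    single : ∀ b {e} → total f (if b then [ e ] else []) ≡ b2n b * f e
    single true = refl
    single false = refl

  forward-< : ∀ u v → forward u v ≡ true → toℕ u < toℕ v
  forward-< u v h with toℕ u <? toℕ v
  ... | yes p = p
  ... | no q = ⊥-elim (true≢false (∧-trueʳ {adj G u v} h) (dec-false (toℕ u <? toℕ v) q))

  forward-sum : ∀ i j → b2n (forward i j) + b2n (forward j i) ≡ b2n (adj G i j)
  forward-sum i j rewrite proj₁ G-simple j i with <-cmp (toℕ i) (toℕ j)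
  ... | tri< p _ q rewrite dec-true (toℕ i <? toℕ j) p | dec-false (toℕ j <? toℕ i) q = one (adj G i j)
    where
    one : ∀ b → b2n (b ∧ true) + b2n (b ∧ false) ≡ b2n b
    one true = refl
    one false = refl
  ... | tri> p _ q rewrite dec-false (toℕ i <? toℕ j) p | dec-true (toℕ j <? toℕ i) q = one (adj G i j)
    where
    one : ∀ b → b2n (b ∧ false) + b2n (b ∧ true) ≡ b2n b
    one true = refl
    one false = refl
  ... | tri≈ _ e _ rewrite FP.toℕ-injective e | proj₂ G-simple j = refl

  edgeList-multiplicity : ∀ i j → total (λ e → b2n (edgeOf (toℕ i) (toℕ j) e)) edgeList ≡ b2n (adj G i j)
  edgeList-multiplicity i j = begin
    total (λ e → b2n (edgeOf (toℕ i) (toℕ j) e)) edgeList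
      ≡⟨ total-edgeList (λ e → b2n (edgeOf (toℕ i) (toℕ j) e)) ⟩
    ∑ (λ u → ∑ (λ v → b2n (forward u v) * b2n (edge (toℕ u) (toℕ v) (toℕ i) (toℕ j))))
      ≡⟨ ∑-cong (λ u → trans (∑-cong (λ v → splitTerm u v)) (∑-distrib-+ (α u) (β u))) ⟩
    ∑ (λ u → ∑ (α u) + ∑ (β u)) ≡⟨ ∑-distrib-+ (λ u → ∑ (α u)) (λ u → ∑ (β u)) ⟩
    ∑ (λ u → ∑ (α u)) + ∑ (λ u → ∑ (β u))
      ≡⟨ cong₂ _+_ (∑∑-delta (λ u v → b2n (forward u v)) i j) (∑∑-delta (λ u v → b2n (forward u v)) j i) ⟩
    b2n (forward i j) + b2n (forward j i) ≡⟨ forward-sum i j ⟩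
    b2n (adj G i j) ∎
    where
    open ≡-Reasoning
    α β : Fin N → Fin N → ℕ
    α u v = b2n (forward u v) * (b2n (u == i) * b2n (v == j))
    β u v = b2n (forward u v) * (b2n (u == j) * b2n (v == i))
    splitTerm : ∀ u v → b2n (forward u v) * b2n (edge (toℕ u) (toℕ v) (toℕ i) (toℕ j)) ≡ α u v + β u v
    splitTerm u v with forward u v in eq
    ... | false = refl
    ... | true = trans (+-identityʳ _) (trans (trans
        (cong b2n (cong₂ _∨_ (cong₂ _∧_ (≐-toℕ u i) (≐-toℕ v j)) (cong₂ _∧_ (≐-toℕ u j) (≐-toℕ v i))))
        (b2n-∨-disjoint ((u == i) ∧ (v == j)) ((u == j) ∧ (v == i)) (¬true⇒false clash)))
      (sym (cong₂ _+_ (trans (+-identityʳ _) (sym (b2n-∧ (u == i) (v == j))))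
        (trans (+-identityʳ _) (sym (b2n-∧ (u == j) (v == i)))))))
      where
      clash : ¬ (((u == i) ∧ (v == j)) ∧ ((u == j) ∧ (v == i)) ≡ true)
      clash h = <-irrefl (cong toℕ (trans (==-sound {i = u} {j} (∧-trueˡ (∧-trueʳ {(u == i) ∧ (v == j)} h)))
          (sym (==-sound {i = v} {j} (∧-trueʳ {u == i} (∧-trueˡ h))))))
        (forward-< u v eq)

  edgeList-degree : ∀ w → total (ends-count (toℕ w)) edgeList ≡ deg G w
  edgeList-degree w = begin
    total (ends-count (toℕ w)) edgeList ≡⟨ total-edgeList (ends-count (toℕ w)) ⟩
    ∑ (λ u → ∑ (λ v → c u v * (b2n (toℕ u ≐ toℕ w) + b2n (toℕ v ≐ toℕ w))))
      ≡⟨ ∑-cong (λ u → trans (∑-cong (λ v → trans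
           (cong₂ (λ a b → c u v * (b2n a + b2n b)) (≐-toℕ u w) (≐-toℕ v w))
           (*-distribˡ-+ (c u v) (b2n (u == w)) (b2n (v == w)))))
         (∑-distrib-+ (λ v → c u v * b2n (u == w)) (λ v → c u v * b2n (v == w)))) ⟩
    ∑ (λ u → ∑ (λ v → c u v * b2n (u == w)) + ∑ (λ v → c u v * b2n (v == w)))
      ≡⟨ ∑-distrib-+ (λ u → ∑ (λ v → c u v * b2n (u == w))) (λ u → ∑ (λ v → c u v * b2n (v == w))) ⟩
    ∑ (λ u → ∑ (λ v → c u v * b2n (u == w))) + ∑ (λ u → ∑ (λ v → c u v * b2n (v == w)))
      ≡⟨ cong₂ _+_ (trans (∑-comm (λ u v → c u v * b2n (u == w))) (∑-cong (λ v → ∑-delta (λ u → c u v) w)))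
                   (∑-cong (λ u → ∑-delta (c u) w)) ⟩
    ∑ (λ v → c w v) + ∑ (λ u → c u w) ≡⟨ ∑-distrib-+ (λ v → c w v) (λ v → c v w) ⟨
    ∑ (λ v → c w v + c v w) ≡⟨ ∑-cong (λ v → forward-sum w v) ⟩
    ∑ (λ v → b2n (adj G w v)) ≡⟨ deg-∑ G w ⟨
    deg G w ∎
    where
    open ≡-Reasoning
    c : Fin N → Fin N → ℕ
    c u v = b2n (forward u v)

  cover-from-layout : (ss : List (Strand k)) → Layout N ss → map ends ss ≡ edgeList → Fin N →
    Σ Graph λ H → Subdivision G H × HasOddCover H k
  cover-from-layout {k} ss S eq v₀ = realised-cover G G-simple
    (expand-all G G-simple ss (realise-base G G-simple ss edges tips)
      (λ i j → ≤-trans (≤-reflexive (mult i j)) (b2n≤1 (adj G i j)))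
      (λ _ _ → refl) (λ z → ≤-refl)
      (λ z → ≤-trans (≤-reflexive (+-comm (total (λ s → inner-count s z) ss) _)) (simple z)) tips)
    path (λ i z → ≤-trans (inside i z) (≤-reflexive (+-comm (isVertex N z) _)))
    (λ u v → trans (covers u v) (sym (xor-identityʳ _))) v₀
    where
    open Layout S
    mult : ∀ i j → total (λ s → b2n (edgeOf (toℕ i) (toℕ j) (ends s))) ss ≡ b2n (adj G i j)
    mult i j = trans (sym (total-map (λ e → b2n (edgeOf (toℕ i) (toℕ j) e)) ends ss))
      (trans (cong (total (λ e → b2n (edgeOf (toℕ i) (toℕ j) e))) eq) (edgeList-multiplicity i j))
    edges : ∀ i j → xorOver (λ s → edgeOf (toℕ i) (toℕ j) (ends s)) ss ≡ adj G i j
    edges i j = trans (sym (isOddB-total (λ s → edgeOf (toℕ i) (toℕ j) (ends s)) ss))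
      (trans (cong isOddB (mult i j)) (isOddB-b2n (adj G i j)))

  cover-from-bicoloured : (ss : List (Strand k)) → Layout N ss → All Bicoloured ss →
    (∀ z → total (tip-count z) ss ≡ total (ends-count z) edgeList) → Fin N →
    Σ Graph λ H → Subdivision G H × HasOddCover H k
  -- `realise` puts finished strands in front of each other and so reverses the order; hence it is
  -- given the reversed list.
  cover-from-bicoloured {k} ss S b balanced v₀ = finish (realise (reverse edgeList) ss [] b
    (subst (Layout N) (sym (++-identityʳ ss)) S)
    (λ z → trans (balanced z) (sym (total-↭ (ends-count z) (↭-reverse edgeList))))
    (All-resp-↭ (↭-sym (↭-reverse edgeList)) (All-edgeList (λ u v f → <⇒≢ (forward-< u v f)))))
    where
    finish : Realisation k (reverse (reverse edgeList)) → Σ Graph λ H → Subdivision G H × HasOddCover H k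
    finish (ss′ , S′ , eq) = cover-from-layout ss′ S′ (trans eq (reverse-involutive edgeList)) v₀

  -- Switching A with B, which lie on different paths, creates the first bicoloured strands, and
  -- `bicolour-all` spreads the property to all the others.
  bicolour : (ss : List (Strand k)) → Layout N ss → ∀ {A B} → A ∈ ss → B ∈ ss → colour A ≢ colour B →
    Bicolouring {n = N} ss
  bicolour {k} ss S {A} {B} A∈ B∈ A≢B = first (∈⇒↭∷ A∈)
    where
    seed : ∀ {rest} → ss ↭ A ∷ B ∷ rest → Joined {n = N} rest (tip (left A) , tip (left B)) (tip (right A) , tip (right B)) →
      Bicolouring {n = N} ss
    seed {rest} π (C , D , S′ , bC , bD , eC , eD) = transfer (bicolour-all C (D ∷ rest) [] bC []
        (subst (λ xs → Layout N (C ∷ D ∷ xs)) (sym (++-identityʳ rest)) S′))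
      where
      regroup : ∀ z → total (tip-count z) (C ∷ D ∷ rest ++ []) ≡ total (tip-count z) ss
      regroup z = trans (cong (λ xs → total (tip-count z) (C ∷ D ∷ xs)) (++-identityʳ rest))
        (trans (sym (+-assoc (tip-count z C) _ _)) (trans
          (cong (_+ total (tip-count z) rest) (join-count {n = N} {A = A} {B} {C} {D} (inj₁ refl) (inj₁ refl) eC eD z))
          (trans (+-assoc (tip-count z A) _ _) (sym (total-↭ (tip-count z) π)))))
      transfer : Bicolouring {n = N} (C ∷ D ∷ rest ++ []) → Bicolouring {n = N} ss
      transfer (ss′ , S″ , b , counts) = ss′ , S″ , b , λ z → trans (counts z) (regroup z)
    later : ∀ {rest} → B ∈ A ∷ rest → B ∈ rest
    later (here refl) = ⊥-elim (A≢B refl)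
    later (there i) = i
    second : ∀ {rest} → ss ↭ A ∷ rest → Σ (List (Strand k)) (λ rest′ → rest ↭ B ∷ rest′) → Bicolouring {n = N} ss
    second π (rest′ , π′) = seed (↭-trans π (↭-prep A π′)) (join (Layout-↭ (↭-trans π (↭-prep A π′)) S)
      (colour A , colour B , inj₁ refl , inj₁ refl , A≢B) (inj₁ refl) (inj₁ refl))
    first : Σ (List (Strand k)) (λ rest → ss ↭ A ∷ rest) → Bicolouring {n = N} ss
    first (rest , π) = second π (∈⇒↭∷ (later (∈-resp-↭ π B∈)))

  cover-from-degrees : (ss : List (Strand k)) → Layout N ss →
    (∀ w → total (tip-count (toℕ w)) ss ≡ deg G w) → Fin N →
    ∀ {A B} → A ∈ ss → B ∈ ss → colour A ≢ colour B →
    Σ Graph λ H → Subdivision G H × HasOddCover H k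
  cover-from-degrees {k} ss S degrees v₀ A∈ B∈ A≢B = finish (bicolour ss S A∈ B∈ A≢B)
    where
    outside : ∀ {a b z} → N ≤ z → a < N → b < N → ends-count z (a , b) ≡ 0
    outside {a} {b} {z} h p q = cong₂ _+_ (cong b2n (≐-≢ {a} {z} (<⇒≢ (≤-trans p h))))
      (cong b2n (≐-≢ {b} {z} (<⇒≢ (≤-trans q h))))
    balanced : ∀ z → total (tip-count z) ss ≡ total (ends-count z) edgeList
    balanced z with z <? N
    ... | yes h = subst (λ z → total (tip-count z) ss ≡ total (ends-count z) edgeList) (FP.toℕ-fromℕ< h)
      (trans (degrees (F.fromℕ< h)) (sym (edgeList-degree (F.fromℕ< h))))
    ... | no h = trans (total-zero (All.map (λ (p , q) → outside (≮⇒≥ h) p q) (Layout.tips S)))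
      (sym (total-zero (All-edgeList (λ u v _ → outside (≮⇒≥ h) (FP.toℕ<n u) (FP.toℕ<n v)))))
    finish : Bicolouring {n = N} ss → Σ Graph λ H → Subdivision G H × HasOddCover H k
    finish (ss′ , S′ , b , counts) = cover-from-bicoloured ss′ S′ b (λ z → trans (counts z) (balanced z)) v₀

-- Ends and interiors of the paths

total-tabulate : (f : A → ℕ) (g : Fin n → A) → total f (tabulate g) ≡ ∑ (f ∘ g)
total-tabulate {n = zero} f g = refl
total-tabulate {n = suc n} f g = cong (f (g zero) +_) (total-tabulate f (g ∘ suc))

select : (b : Fin k → Bool) (r : ℕ) → r ≤ ∑ (b2n ∘ b) →
  Σ (Fin k → Bool) λ c → ∑ (b2n ∘ c) ≡ r × (∀ i → c i ≡ true → b i ≡ true)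
select {zero} b zero h = b , refl , λ ()
select {suc k} b r h with b zero in eq
select {suc k} b r h | false with select (b ∘ suc) r h
... | c , s , imp = (λ { zero → false ; (suc i) → c i }) , s , λ { zero () ; (suc i) → imp i }
select {suc k} b zero h | true = (λ _ → false) , ∑-zero {suc k} {λ _ → 0} (λ _ → refl) , λ _ ()
select {suc k} b (suc r) h | true with select (b ∘ suc) r (s≤s⁻¹ h)
... | c , s , imp = (λ { zero → true ; (suc i) → c i }) , cong suc s , λ { zero _ → eq ; (suc i) → imp i }

terminals : (L R : Fin k → Fin n) → Fin n → ℕ
terminals L R v = ∑ (λ i → b2n (L i == v)) + ∑ (λ i → b2n (R i == v))

module _ (L R : Fin k → Fin n) (L≢R : ∀ i → L i ≢ R i) where

  -- Since no path has equal ends, v is an end of `terminals L R v` different paths. The other paths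
  -- may have v inside, and `room` says that there are enough of them. Choices for different v do
  -- not interact: only the visits are prescribed, not their order along a path.
  interior-choice : (r : Fin n → ℕ) → (∀ v → r v + terminals L R v ≤ k) →
    Σ (Fin k → Fin n → Bool) λ C → (∀ v → ∑ (λ i → b2n (C i v)) ≡ r v) ×
      (∀ i v → b2n (R i == v) + (b2n (L i == v) + b2n (C i v)) ≤ 1)
  interior-choice r room = (λ i v → proj₁ (chosen v) i) , (λ v → proj₁ (proj₂ (chosen v))) , once
    where
    open +-*-Solver
    free : Fin n → Fin k → Bool
    free v i = not ((L i == v) ∨ (R i == v))
    partition : ∀ v i → b2n (free v i) + (b2n (L i == v) + b2n (R i == v)) ≡ 1
    partition v i with L i F.≟ v | R i F.≟ v
    ... | yes p | yes q = ⊥-elim (L≢R i (trans p (sym q)))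
    ... | yes _ | no _ = refl
    ... | no _ | yes _ = refl
    ... | no _ | no _ = refl
    free-count : ∀ v → ∑ (b2n ∘ free v) + terminals L R v ≡ k
    free-count v = trans (cong (∑ (b2n ∘ free v) +_) (sym (∑-distrib-+ (λ i → b2n (L i == v)) (λ i → b2n (R i == v)))))
      (trans (sym (∑-distrib-+ (b2n ∘ free v) (λ i → b2n (L i == v) + b2n (R i == v))))
        (trans (∑-cong (partition v)) (∑-one k)))
    chosen : ∀ v → Σ (Fin k → Bool) λ c → ∑ (b2n ∘ c) ≡ r v × (∀ i → c i ≡ true → free v i ≡ true)
    chosen v = select (free v) (r v) (+-cancelʳ-≤ (terminals L R v) _ _
      (≤-trans (room v) (≤-reflexive (sym (free-count v)))))
    once : ∀ i v → b2n (R i == v) + (b2n (L i == v) + b2n (proj₁ (chosen v) i)) ≤ 1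
    once i v with proj₁ (chosen v) i in eq
    ... | true = ≤-reflexive (trans (solve 2 (λ l r → r :+ (l :+ con 1) := con 1 :+ (l :+ r)) refl (b2n (L i == v)) (b2n (R i == v)))
      (trans (cong (λ b → b2n b + (b2n (L i == v) + b2n (R i == v))) (sym (proj₂ (proj₂ (chosen v)) i eq))) (partition v i)))
    ... | false = ≤-trans (m≤n+m _ (b2n (free v i))) (≤-reflexive (trans
      (solve 3 (λ f l r → f :+ (r :+ (l :+ con 0)) := f :+ (l :+ r)) refl (b2n (free v i)) (b2n (L i == v)) (b2n (R i == v)))
      (partition v i)))

  module _ (C : Fin k → Fin n → Bool) where

    interior : List (Push k n)
    interior = concat (tabulate λ v → concat (tabulate λ i → if C i v then [ (i , v) ] else []))

    -- The left ends stand in front so that they are pushed last and become the heads. Every path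
    -- thereby also receives at least one strand.
    schedule : List (Push k n)
    schedule = tabulate (λ i → i , L i) ++ interior

    pushes-schedule : ∀ i v → pushes i v schedule ≡ b2n (L i == v) + b2n (C i v)
    pushes-schedule i v = trans (total-++ f (tabulate (λ i → i , L i)) interior) (cong₂ _+_
      (trans (total-tabulate f (λ i → i , L i)) (trans
        (∑-cong (λ j → *-comm (b2n (j == i)) (b2n (L j == v)))) (∑-delta (λ j → b2n (L j == v)) i)))
      (trans (total-concat-tabulate f (λ v → concat (tabulate λ i → if C i v then [ (i , v) ] else [])))
      (trans (∑-cong (λ w → trans (total-concat-tabulate f (λ i → if C i w then [ (i , w) ] else []))
          (∑-cong (λ j → trans (single (C j w)) (cong (b2n (C j w) *_) (*-comm (b2n (j == i)) (b2n (w == v))))))))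
        (∑∑-delta (λ w j → b2n (C j w)) v i))))
      where
      f : Push k n → ℕ
      f (j , b) = b2n (j == i) * b2n (b == v)
      single : ∀ b {e} → total f (if b then [ e ] else []) ≡ b2n b * f e
      single true = refl
      single false = refl

    heads-schedule : ∀ i → heads R schedule i ≡ L i
    heads-schedule = go id
      where
      go : ∀ {m} (f : Fin m → Fin k) j → heads R (tabulate (λ i → f i , L (f i)) ++ interior) (f j) ≡ L (f j)
      go {suc m} f zero rewrite ==-refl (f zero) = refl
      go {suc m} f (suc j) with f (suc j) F.≟ f zero
      ... | yes e = cong L (sym e)
      ... | no _ = go (f ∘ suc) j

module _ (G : Graph) (G-simple : IsSimple G) where

  -- An end of a path contributes one tip and an inner visit two, so `terminals` and r reproduce the
  -- degrees whatever the order of the vertices along the paths.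
  cover-from-terminals : (L R : Fin (suc (suc k)) → Fin (size G)) → (∀ i → L i ≢ R i) → (r : Fin (size G) → ℕ) →
    (∀ v → deg G v ≡ terminals L R v + 2 * r v) → (∀ v → r v + terminals L R v ≤ suc (suc k)) →
    Σ Graph λ H → Subdivision G H × HasOddCover H (suc (suc k))
  cover-from-terminals {k} L R L≢R r deg≡ room = finish (interior-choice L R L≢R r room)
    where
    finish : (Σ (Fin (suc (suc k)) → Fin (size G) → Bool) λ C → (∀ v → ∑ (λ i → b2n (C i v)) ≡ r v) ×
      (∀ i v → b2n (R i == v) + (b2n (L i == v) + b2n (C i v)) ≤ 1)) →
      Σ Graph λ H → Subdivision G H × HasOddCover H (suc (suc k))
    finish (C , C-count , once) = use (build R I (λ i v → ≤-trans
        (≤-reflexive (cong (b2n (R i == v) +_) (pushes-schedule L R L≢R C i v))) (once i v)))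
      where
      I = schedule L R L≢R C
      module _ (B : Built R I) where
        open Built B
        tip-degree : ∀ v → total (tip-count (toℕ v)) strands ≡ deg G v
        tip-degree v = +-cancelʳ-≡ (λL + ρ) _ _ (begin
          total (tip-count (toℕ v)) strands + (λL + ρ)
            ≡⟨ cong (λ x → total (tip-count (toℕ v)) strands + (x + ρ))
                 (∑-cong (λ i → cong (λ w → b2n (w == v)) (heads-schedule L R L≢R C i))) ⟨
          total (tip-count (toℕ v)) strands + (∑ (λ i → b2n (heads R I i == v)) + ρ) ≡⟨ degrees v ⟩
          2 * ∑ (λ i → b2n (R i == v) + pushes i v I)
            ≡⟨ cong (2 *_) (trans (∑-cong (λ i → cong (b2n (R i == v) +_) (pushes-schedule L R L≢R C i v)))
                 (trans (∑-distrib-+ (λ i → b2n (R i == v)) (λ i → b2n (L i == v) + b2n (C i v)))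
                 (cong (ρ +_) (trans (∑-distrib-+ (λ i → b2n (L i == v)) (λ i → b2n (C i v)))
                   (cong (λL +_) (C-count v)))))) ⟩
          2 * (ρ + (λL + r v))
            ≡⟨ solve 3 (λ p l r → con 2 :* (p :+ (l :+ r)) := (l :+ p :+ con 2 :* r) :+ (l :+ p)) refl ρ λL (r v) ⟩
          (λL + ρ + 2 * r v) + (λL + ρ) ≡⟨ cong (_+ (λL + ρ)) (deg≡ v) ⟨
          deg G v + (λL + ρ) ∎)
          where
          open ≡-Reasoning
          open +-*-Solver
          λL = ∑ (λ i → b2n (L i == v))
          ρ = ∑ (λ i → b2n (R i == v))
        use : Σ Graph λ H → Subdivision G H × HasOddCover H (suc (suc k))
        use with present
        -- The first two entries of the schedule are the left ends of the first two paths, hence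
        -- their strands have different colours.
        ... | (A , A∈ , refl , _) ∷ (B , B∈ , eB , _) ∷ _ =
          cover-from-degrees G G-simple strands layout tip-degree (L zero) A∈ B∈ (λ e → apart (trans e eB))
          where
          apart : Fin.zero ≢ suc zero
          apart ()

-- Providing all 2k path ends

Pairs : ℕ → Set
Pairs n = List (Fin n × Fin n)

pair-count : Fin n → Fin n × Fin n → ℕ
pair-count v (a , b) = b2n (a == v) + b2n (b == v)

Distinct : Pairs n → Set
Distinct = All λ (a , b) → a ≢ b

-- Each of the k paths needs two end vertices; ts lists those already provided, and v is to be
-- an inner vertex of r further paths.
record Prepared (k : ℕ) (G : Graph) (ts : Pairs (size G)) : Set where
  field
    simple   : IsSimple G
    link     : Σ (Fin (size G)) λ u → Σ (Fin (size G)) λ v → adj G u v ≡ true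
    balance  : ∀ v → Σ ℕ λ r → deg G v ≡ total (pair-count v) ts + 2 * r × r + total (pair-count v) ts ≤ k

  subdivided : Graph
  subdivided = subdivide G (proj₁ link) (proj₁ (proj₂ link))

  private
    u₀ = proj₁ link
    v₀ = proj₁ (proj₂ link)
    a₀ = proj₂ (proj₂ link)

  subdivided-step : Subdivision G subdivided
  subdivided-step = step base u₀ v₀ a₀

  -- Subdividing an edge provides a new vertex of degree two, an end vertex of two paths.
  extend-prepared : (ts′ : Pairs (suc (size G))) → 2 ≤ k →
    total (pair-count zero) ts′ ≡ 2 → (∀ v → total (pair-count (suc v)) ts′ ≡ total (pair-count v) ts) →
    Prepared k subdivided ts′
  extend-prepared ts′ 2≤k new old = record
    { simple = subdivide-simple G simple u₀ v₀ a₀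
    ; link = zero , suc u₀ , cong (_∨ (u₀ == v₀)) (==-refl u₀)
    ; balance = λ
      { zero → 0 , trans (deg-subdivide-new G simple u₀ v₀ a₀) (sym (trans (+-identityʳ _) new))
                 , ≤-trans (≤-reflexive new) 2≤k
      ; (suc v) → proj₁ (balance v)
                , trans (deg-subdivide-old G simple u₀ v₀ a₀ v)
                    (trans (proj₁ (proj₂ (balance v))) (cong (_+ 2 * proj₁ (balance v)) (sym (old v))))
                , subst (λ c → proj₁ (balance v) + c ≤ k) (sym (old v)) (proj₂ (proj₂ (balance v))) }
    }

Subdivision-trans : ∀ {G H K} → Subdivision G H → Subdivision H K → Subdivision G K
Subdivision-trans σ base = σ
Subdivision-trans σ (step τ u v a) = step (Subdivision-trans σ τ) u v a

raise : Fin n × Fin n → Fin (suc n) × Fin (suc n)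
raise (a , b) = suc a , suc b

raise-old : ∀ (v : Fin n) ts → total (pair-count (suc v)) (map raise ts) ≡ total (pair-count v) ts
raise-old v [] = refl
raise-old v ((a , b) ∷ ts) = cong₂ _+_ (cong₂ (λ x y → b2n x + b2n y) (==-suc a v) (==-suc b v)) (raise-old v ts)

raise-new : ∀ (ts : Pairs n) → total (pair-count zero) (map raise ts) ≡ 0
raise-new [] = refl
raise-new (_ ∷ ts) = raise-new ts

raise-distinct : ∀ {ts : Pairs n} → Distinct ts → Distinct (map raise ts)
raise-distinct = AllP.map⁺ ∘ All.map (_∘ FP.suc-injective)

PreparedSubdivision : ℕ → Graph → Set
PreparedSubdivision k G = Σ Graph λ H → Subdivision G H ×
  Σ (Pairs (size H)) λ ts → length ts ≡ k × Distinct ts × Prepared k H ts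

-- A subdivision vertex z splits the pair a, b into a, z and z, b. This gains one pair, leaves the
-- ends at old vertices as they were, and both new pairs have different entries.
fill : ∀ p {k G a b ts} → Prepared k G ((a , b) ∷ ts) → Distinct ((a , b) ∷ ts) → 2 ≤ k →
  p + suc (length ts) ≡ k → PreparedSubdivision k G
fill zero {G = G} {a} {b} {ts} P distinct 2≤k len = G , base , (a , b) ∷ ts , len , distinct , P
fill (suc p) {k} {G} {a} {b} {ts} P distinct 2≤k len =
  let H , σ , rest = fill p (extend-prepared ts′ 2≤k (cong (2 +_) (raise-new ts)) old) distinct′ 2≤k
        (trans (+-suc p _) (trans (cong (λ l → suc (p + suc l)) (length-map raise ts)) len))
  in H , Subdivision-trans subdivided-step σ , rest
  where
  open Prepared P
  ts′ : Pairs (suc (size G))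
  ts′ = (suc a , zero) ∷ (zero , suc b) ∷ map raise ts
  distinct′ : Distinct ts′
  distinct′ = (λ ()) ∷ (λ ()) ∷ raise-distinct (All.tail distinct)
  old : ∀ v → total (pair-count (suc v)) ts′ ≡ total (pair-count v) ((a , b) ∷ ts)
  old v = trans (cong₂ (λ x y → (b2n x + 0) + (b2n y + total (pair-count (suc v)) (map raise ts))) (==-suc a v) (==-suc b v))
    (trans (cong (λ t → (b2n (a == v) + 0) + (b2n (b == v) + t)) (raise-old v ts))
      (solve 3 (λ a b t → (a :+ con 0) :+ (b :+ t) := (a :+ b) :+ t) refl (b2n (a == v)) (b2n (b == v)) (total (pair-count v) ts)))
    where
    open +-*-Solver

-- Without odd vertices there is no pair to split. Two subdivision vertices y and z start the list
-- instead, with the pair y, z taken twice. The pair with equal entries occurs only on the way: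
-- `Prepared` concerns the number of ends at each vertex, while distinctness is a separate
-- condition.
fill-empty : ∀ {p G} → Prepared (2 + p) G [] → PreparedSubdivision (2 + p) G
fill-empty {p} P =
  let H , σ , rest = fill p P₂ ((λ ()) ∷ (λ ()) ∷ []) 2≤k (+-comm p 2)
  in H , Subdivision-trans (Subdivision-trans subdivided-step (Prepared.subdivided-step P₁)) σ , rest
  where
  open Prepared P
  2≤k : 2 ≤ 2 + p
  2≤k = s≤s (s≤s z≤n)
  P₁ : Prepared (2 + p) subdivided ((zero , zero) ∷ [])
  P₁ = extend-prepared ((zero , zero) ∷ []) 2≤k refl (λ v → refl)
  P₂ : Prepared (2 + p) (Prepared.subdivided P₁) ((suc zero , zero) ∷ (suc zero , zero) ∷ [])
  P₂ = Prepared.extend-prepared P₁ ((suc zero , zero) ∷ (suc zero , zero) ∷ []) 2≤k refl λ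
    { zero → refl ; (suc v) → refl }

pair-up : (xs : List (Fin n)) → isOddB (length xs) ≡ false → Unique xs → Σ (Pairs n) λ ts →
  Distinct ts × length xs ≡ 2 * length ts × (∀ v → total (pair-count v) ts ≡ FW.count v xs)
pair-up [] even u = [] , [] , refl , λ v → refl
pair-up (x ∷ y ∷ xs) even ((x≢y ∷ _) ∷ _ ∷ u) =
  let ts , d , len , c = pair-up xs even u
  in (x , y) ∷ ts , x≢y ∷ d , trans (cong (2 +_) len) (sym (*-suc 2 (length ts)))
   , λ v → trans (cong (b2n (x == v) + b2n (y == v) +_) (c v)) (+-assoc (b2n (x == v)) _ _)

module _ (G : Graph) where

  oddVertices : List (Fin (size G))
  oddVertices = concat (tabulate λ v → if isOddB (deg G v) then [ v ] else [])

  count≡total : ∀ v (xs : List (Fin n)) → FW.count v xs ≡ total (λ x → b2n (x == v)) xs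
  count≡total v [] = refl
  count≡total v (x ∷ xs) = cong (b2n (x == v) +_) (count≡total v xs)

  total-oddVertices : ∀ f → total f oddVertices ≡ ∑ (λ v → f v * b2n (isOddB (deg G v)))
  total-oddVertices f = trans (total-concat-tabulate f (λ v → if isOddB (deg G v) then [ v ] else []))
    (∑-cong (λ v → single (isOddB (deg G v))))
    where
    single : ∀ b {v} → total f (if b then [ v ] else []) ≡ f v * b2n b
    single true {v} = trans (+-identityʳ (f v)) (sym (*-identityʳ (f v)))
    single false {v} = sym (*-zeroʳ (f v))

  count-oddVertices : ∀ v → FW.count v oddVertices ≡ b2n (isOddB (deg G v))
  count-oddVertices v = trans (count≡total v oddVertices) (trans (total-oddVertices (λ x → b2n (x == v)))
    (trans (∑-cong (λ u → *-comm (b2n (u == v)) (b2n (isOddB (deg G u))))) (∑-delta (λ u → b2n (isOddB (deg G u))) v)))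

  length-oddVertices : length oddVertices ≡ vodd G
  length-oddVertices = trans (length≡total oddVertices) (trans (total-oddVertices (λ _ → 1))
    (trans (∑-cong (λ v → +-identityʳ (b2n (isOddB (deg G v))))) (sym (vodd-∑ G))))
    where
    length≡total : (xs : List (Fin n)) → length xs ≡ total (λ _ → 1) xs
    length≡total [] = refl
    length≡total (x ∷ xs) = cong suc (length≡total xs)

module _ {k : ℕ} (G : Graph) (G-simple : IsSimple G) (k-odd : ⌊ vodd G /2⌋ ≤ 2 + k) (k-deg : ⌈ Δ G /2⌉ ≤ 2 + k)
  (u v : Fin (size G)) (uv : adj G u v ≡ true) where

  private
    odds = pair-up (oddVertices G) (trans (cong isOddB (length-oddVertices G)) (handshake G G-simple))
      (FW.count≤1⇒Unique (oddVertices G) λ v → ≤-trans (≤-reflexive (count-oddVertices G v)) (b2n≤1 _))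
    ts = proj₁ odds

    ts-count : ∀ v → total (pair-count v) ts ≡ b2n (isOddB (deg G v))
    ts-count v = trans (proj₂ (proj₂ (proj₂ odds)) v) (count-oddVertices G v)

    ts-length : length ts ≤ 2 + k
    ts-length = ≤-trans (≤-reflexive (trans (sym (⌊2*n/2⌋≡n (length ts))) (cong ⌊_/2⌋
      (trans (sym (proj₁ (proj₂ (proj₂ odds)))) (length-oddVertices G))))) k-odd

    prepared : Prepared (2 + k) G ts
    prepared = record
      { simple = G-simple
      ; link = u , v , uv
      ; balance = λ v → ⌊ deg G v /2⌋
        , trans (half-split (deg G v)) (cong (_+ 2 * ⌊ deg G v /2⌋) (sym (ts-count v)))
        , ≤-trans (≤-reflexive (trans (cong (⌊ deg G v /2⌋ +_) (ts-count v)) (sym (ceil-half (deg G v)))))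
            (≤-trans (⌈n/2⌉-mono (deg≤Δ G v)) k-deg)
      }

    filled : ∀ ts → Prepared (2 + k) G ts → Distinct ts → length ts ≤ 2 + k → PreparedSubdivision (2 + k) G
    filled [] P d le = fill-empty P
    filled (_ ∷ ts) P d le = fill (2 + k ∸ suc (length ts)) P d (s≤s (s≤s z≤n)) (m∸n+n≡m le)

    terminals-lookup : ∀ {n} (ts : Pairs n) v →
      terminals (λ i → proj₁ (lookup ts i)) (λ i → proj₂ (lookup ts i)) v ≡ total (pair-count v) ts
    terminals-lookup [] v = refl
    terminals-lookup ((a , b) ∷ ts) v = trans
      (solve 4 (λ a b x y → (a :+ x) :+ (b :+ y) := (a :+ b) :+ (x :+ y)) refl (b2n (a == v)) (b2n (b == v)) _ _)
      (cong (b2n (a == v) + b2n (b == v) +_) (terminals-lookup ts v))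
      where
      open +-*-Solver

  upper-bound : Σ Graph λ H → Subdivision G H × HasOddCover H (2 + k)
  upper-bound with filled ts prepared (proj₁ (proj₂ odds)) ts-length
  ... | H , σ , (x ∷ y ∷ ts′) , refl , d , P =
    let K , τ , cover = cover-from-terminals H simple (λ i → proj₁ (lookup pairs i)) (λ i → proj₂ (lookup pairs i))
          (λ i → All.lookup d (∈-lookup i)) (λ v → proj₁ (balance v))
          (λ v → trans (proj₁ (proj₂ (balance v))) (cong (_+ 2 * proj₁ (balance v)) (sym (terminals-lookup pairs v))))
          (λ v → ≤-trans (≤-reflexive (cong (proj₁ (balance v) +_) (terminals-lookup pairs v))) (proj₂ (proj₂ (balance v))))
    in K , Subdivision-trans σ τ , cover
    where
    open Prepared P
    pairs = x ∷ y ∷ ts′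

-- Covering with a single path

cyclesEdge : List (List (Fin n)) → Fin n → Fin n → Bool
cyclesEdge Cs u v = foldr (λ C b → cycleEdge C u v ∨ b) false Cs

cycleEdge-∈ : (C : List (Fin n)) {u v : Fin n} → cycleEdge C u v ≡ true → u ∈ C × v ∈ C
cycleEdge-∈ (x ∷ xs) h = back (proj₁ (edgeIn-∈ _ h)) , back (proj₂ (edgeIn-∈ _ h))
  where
  back : ∀ {w} → w ∈ (x ∷ xs) ++ [ x ] → w ∈ x ∷ xs
  back i with ∈-++⁻ (x ∷ xs) i
  ... | inj₁ j = j
  ... | inj₂ (here e) = here e

cyclesEdge-∈ : (Cs : List (List (Fin n))) {u v : Fin n} → cyclesEdge Cs u v ≡ true → u ∈ concat Cs × v ∈ concat Cs
cyclesEdge-∈ (C ∷ Cs) {u} {v} h with ∨-true {cycleEdge C u v} h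
... | inj₁ e = let p , q = cycleEdge-∈ C e in ∈-++⁺ˡ p , ∈-++⁺ˡ q
... | inj₂ e = let p , q = cyclesEdge-∈ Cs e in ∈-++⁺ʳ C p , ∈-++⁺ʳ C q

even-positive : ∀ d → 1 ≤ d → isOddB d ≡ false → 2 ≤ d
even-positive (suc (suc d)) _ _ = s≤s (s≤s z≤n)

odd-positive : ∀ d → isOddB d ≡ true → 1 ≤ d
odd-positive (suc d) h = s≤s z≤n

module _ (G : Graph) (simple : IsSimple G) (deg≤2 : ∀ v → deg G v ≤ 2) where

  private
    V = Fin (size G)

  module _ (P : List V) where

    covered : List (List V) → List V
    covered Cs = concat Cs ++ P

    component-edge : List (List V) → V → V → Bool
    component-edge Cs u v = cyclesEdge Cs u v ∨ edgeIn P u v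

    -- P is fixed while cycles are added one by one. As `correct` determines all edges at covered
    -- vertices, the covered set is a union of components and new paths stay clear of it.
    record Decomposed (Cs : List (List V)) : Set where
      field
        disjoint : Unique (covered Cs)
        cycles   : All IsCycle Cs
        correct  : ∀ {u} → u ∈ covered Cs → ∀ v → adj G u v ≡ component-edge Cs u v

    component-edge-∈ : ∀ Cs {u v} → component-edge Cs u v ≡ true → u ∈ covered Cs × v ∈ covered Cs
    component-edge-∈ Cs {u} {v} h with ∨-true {cyclesEdge Cs u v} h
    ... | inj₁ e = let p , q = cyclesEdge-∈ Cs e in ∈-++⁺ˡ p , ∈-++⁺ˡ q
    ... | inj₂ e = let p , q = edgeIn-∈ P e in ∈-++⁺ʳ (concat Cs) p , ∈-++⁺ʳ (concat Cs) q

    component-edge-off : ∀ Cs {u} v → u ∉ covered Cs → component-edge Cs u v ≡ false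
    component-edge-off Cs v u∉ = ¬true⇒false (λ h → u∉ (proj₁ (component-edge-∈ Cs h)))

    covered-closed : ∀ {Cs} → Decomposed Cs → Closed G simple deg≤2 (covered Cs)
    covered-closed {Cs} D i a = proj₂ (component-edge-∈ Cs (trans (sym (Decomposed.correct D i _)) a))

    add-cycle : ∀ {Cs s} → Decomposed Cs → (M : Maximal G simple deg≤2 (covered Cs) s) →
      2 ≤ deg G (Maximal.x M) → Decomposed (spine G simple deg≤2 M ∷ Cs)
    add-cycle {Cs} D M even = record
      { disjoint = subst Unique (sym (++-assoc C (concat Cs) P))
          (UniqueP.++⁺ unique disjoint (λ (i , j) → avoids i j))
      ; cycles = cycle-is-cycle G simple deg≤2 M even ∷ cycles
      ; correct = λ {u} i v → correct′ (∈-++⁻ C (subst (u ∈_) (++-assoc C (concat Cs) P) i)) v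
      }
      where
      open Decomposed D
      open Maximal M
      C = spine G simple deg≤2 M
      correct′ : ∀ {u} → u ∈ C ⊎ u ∈ covered Cs → ∀ v →
        adj G u v ≡ (cycleEdge C u v ∨ cyclesEdge Cs u v) ∨ edgeIn P u v
      correct′ {u} (inj₁ i) v = trans (cycle-component G simple deg≤2 M even i v) (sym (trans
        (∨-assoc (cycleEdge C u v) _ _) (trans (cong (cycleEdge C u v ∨_) (component-edge-off Cs v (avoids i))) (∨-identityʳ _))))
      correct′ {u} (inj₂ i) v = trans (correct i v) (sym (cong (λ b → (b ∨ cyclesEdge Cs u v) ∨ edgeIn P u v)
        (¬true⇒false λ h → avoids (proj₁ (cycleEdge-∈ C h)) i)))

    module _ (even-outside : ∀ u → u ∉ P → isOddB (deg G u) ≡ false) where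

      -- An edge at an uncovered vertex starts a maximal path there. This path avoids P, so the
      -- degree of its end x is even and positive, hence at least two, and the path closes up to a
      -- cycle.
      decompose : ∀ fuel Cs → Decomposed Cs → size G < length (covered Cs) + fuel →
        Σ (List (List V)) λ Cs → Decomposed Cs × (∀ u v → adj G u v ≡ component-edge Cs u v)
      decompose zero Cs D f = ⊥-elim (<⇒≱ (≤-trans f (≤-reflexive (+-identityʳ _)))
        (Unique⇒length≤ (covered Cs) (Decomposed.disjoint D)))
      decompose (suc fuel) Cs D f
        with FP.any? (λ u → FP.any? (λ v → ¬? (_∈?_ F._≟_ u (covered Cs)) ×-dec (adj G u v ≟ᵇ true)))
      ... | no none-left = Cs , D , all-edges
        where
        all-edges : ∀ u v → adj G u v ≡ component-edge Cs u v
        all-edges u v with _∈?_ F._≟_ u (covered Cs)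
        ... | yes i = Decomposed.correct D i v
        ... | no u∉ = trans (¬true⇒false (λ a → none-left (u , v , u∉ , a))) (sym (component-edge-off Cs v u∉))
      ... | yes (u , v , u∉ , a) = decompose fuel (spine G simple deg≤2 M ∷ Cs) (add-cycle D M even) (≤-trans f longer)
        where
        M = maximal-path G simple deg≤2 (covered-closed D) u∉ (Adj-sym G simple deg≤2 a)
        open Maximal M
        x-edge : Σ V λ y → adj G x y ≡ true
        x-edge = let y , e , _ = first-edge G simple deg≤2 M
                 in y , linked-edge G simple deg≤2 (spine G simple deg≤2 M) linked e
        even : 2 ≤ deg G x
        even = even-positive (deg G x) (adj⇒deg≥1 G simple deg≤2 (proj₂ x-edge))
          (even-outside x (λ i → avoids (here refl) (∈-++⁺ʳ (concat Cs) i)))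
        longer : length (covered Cs) + suc fuel ≤ length (covered (spine G simple deg≤2 M ∷ Cs)) + fuel
        longer = ≤-trans (≤-reflexive (+-suc _ fuel)) (+-monoˡ-≤ fuel (≤-trans
          (s≤s (m≤n+m _ (length (ms ++ [ u ]))))
          (≤-reflexive (sym (trans (cong length (++-assoc (spine G simple deg≤2 M) (concat Cs) P))
            (length-++ (spine G simple deg≤2 M)))))))

    -- If a cycle was found, G has the excluded form. Otherwise P alone carries all edges, and it is
    -- nonempty because ab is among them.
    cover-or-cycles : (∀ u → u ∉ P → isOddB (deg G u) ≡ false) → Decomposed [] → ¬ CyclesPlusPath G →
      ∀ {a b} → adj G a b ≡ true → HasOddCover G 1
    cover-or-cycles even D ¬cpp {a} {b} ab with decompose even (suc (size G)) [] D (m≤n+m _ (length P))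
    ... | [] , D′ , edges = P ∷ [] , path P (Decomposed.disjoint D′) (proj₁ (edgeIn-∈ P (trans (sym (edges a b)) ab))) ∷ []
        , refl , λ u v → trans (edges u v) (sym (xor-identityʳ (edgeIn P u v)))
      where
      path : ∀ P → Unique P → a ∈ P → IsPath P
      path (x ∷ xs) u i = u
    ... | C ∷ Cs , D′ , edges =
      ⊥-elim (¬cpp (C ∷ Cs , P , s≤s z≤n , Decomposed.cycles D′ , Decomposed.disjoint D′ , edges))

  -- An odd degree is one here, so a maximal path from an odd vertex s is a component and ends in a
  -- second odd vertex x. These are all the odd vertices, which makes every vertex off the path
  -- even. If no vertex is odd, the empty list replaces the path.
  single-cover : vodd G ≤ 2 → ¬ CyclesPlusPath G → ∀ {a b} → adj G a b ≡ true → HasOddCover G 1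
  single-cover v≤2 ¬cpp ab with FP.any? (λ s → isOddB (deg G s) ≟ᵇ true)
  ... | no no-odd = cover-or-cycles [] (λ u _ → ¬true⇒false (λ o → no-odd (u , o)))
      (record { disjoint = [] ; cycles = [] ; correct = λ () }) ¬cpp ab
  ... | yes (s , s-odd) = cover-or-cycles P even
      (record { disjoint = unique ; cycles = [] ; correct = path-component G simple deg≤2 M leaf }) ¬cpp ab
    where
    odd≤1 : ∀ d → d ≤ 2 → isOddB d ≡ true → d ≤ 1
    odd≤1 (suc zero) _ _ = ≤-refl
    odd≤1 (suc (suc (suc d))) (s≤s (s≤s ())) _
    leaf : deg G s ≤ 1
    leaf = odd≤1 (deg G s) (deg≤2 s) s-odd
    t = neighbour G simple deg≤2 (odd-positive (deg G s) s-odd)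
    M : Maximal G simple deg≤2 [] s
    M = maximal-path G simple deg≤2 (λ ()) (λ ()) (Adj-sym G simple deg≤2 (proj₂ t))
    open Maximal M
    P = spine G simple deg≤2 M
    x-odd : isOddB (deg G x) ≡ true
    x-odd = cong isOddB (≤-antisym (head-leaf G simple deg≤2 M leaf)
      (let y , e , _ = first-edge G simple deg≤2 M in adj⇒deg≥1 G simple deg≤2 (linked-edge G simple deg≤2 P linked e)))
    odd : ∀ {v} → isOddB (deg G v) ≡ true → 1 ≤ b2n (isOddB (deg G v))
    odd h = ≤-reflexive (sym (cong b2n h))
    even : ∀ u → u ∉ P → isOddB (deg G u) ≡ false
    even u u∉ = ¬true⇒false λ o → 1+n≰n {2} (≤-trans (three-terms≤∑ (λ v → b2n (isOddB (deg G v)))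
      (λ e → u∉ (subst (_∈ P) (sym e) (s∈spine G simple deg≤2 M))) (λ e → u∉ (subst (_∈ P) (sym e) (here refl)))
      (s≢x G simple deg≤2 M) (odd o) (odd s-odd) (odd x-odd))
      (≤-trans (≤-reflexive (sym (vodd-∑ G))) v≤2))

theorem1p1 : (G : Graph) → IsSimple G → ¬ CyclesPlusPath G →
    P2TopIs G (⌊ vodd G /2⌋ ⊔ ⌈ Δ G /2⌉)
theorem1p1 G simple ¬cpp = cover , lower-bound G simple
  where
  K = ⌊ vodd G /2⌋ ⊔ ⌈ Δ G /2⌉

  with-edge : ∀ k → K ≡ k → ∀ {u v} → adj G u v ≡ true → Σ Graph λ H → Subdivision G H × HasOddCover H k
  -- An edge gives Δ ≥ 1 and therefore ⌈Δ/2⌉ ≥ 1.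
  with-edge zero e {u} {v} uv = ⊥-elim (1+n≰n {0} (≤-trans (⌈n/2⌉-mono {1} (≤-trans
    (≤-trans (≤-trans (≤-reflexive (sym (cong b2n uv))) (term≤∑ (λ w → b2n (adj G u w)) v)) (≤-reflexive (sym (deg-∑ G u))))
    (deg≤Δ G u))) (≤-trans (m≤n⊔m ⌊ vodd G /2⌋ _) (≤-reflexive e))))
  with-edge (suc zero) e uv = G , base , single-cover G simple deg≤2 vodd≤2 ¬cpp uv
    where
    deg≤2 : ∀ v → deg G v ≤ 2
    deg≤2 v with deg G v ≤? 2
    ... | yes h = h
    ... | no h = ⊥-elim (1+n≰n {1} (≤-trans (⌈n/2⌉-mono (≤-trans (≰⇒> h) (deg≤Δ G v)))
      (≤-trans (m≤n⊔m ⌊ vodd G /2⌋ _) (≤-reflexive e))))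
    vodd≤2 : vodd G ≤ 2
    vodd≤2 = ≤-trans (≤-reflexive (trans (half-split (vodd G)) (cong (λ b → b2n b + 2 * ⌊ vodd G /2⌋) (handshake G simple))))
      (*-monoʳ-≤ 2 (≤-trans (m≤m⊔n ⌊ vodd G /2⌋ _) (≤-reflexive e)))
  with-edge (suc (suc k)) e uv = upper-bound G simple
    (≤-trans (m≤m⊔n ⌊ vodd G /2⌋ _) (≤-reflexive e)) (≤-trans (m≤n⊔m ⌊ vodd G /2⌋ _) (≤-reflexive e)) _ _ uv

  cover : Σ Graph λ H → Subdivision G H × HasOddCover H K
  cover with FP.any? (λ u → FP.any? (λ v → adj G u v ≟ᵇ true))
  ... | yes (u , v , uv) = with-edge K refl uv
  -- Without edges the empty collection is a cover, and the lower bound applied to it shows that `K`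
  -- is zero.
  ... | no no-edge = G , base , subst (HasOddCover G) (sym (n≤0⇒n≡0 (lower-bound G simple G 0 base empty))) empty
    where
    empty : HasOddCover G 0
    empty = [] , [] , refl , λ u v → ¬true⇒false (λ uv → no-edge (u , v , uv))
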